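{- Let $v>1$ be an integer such that every component $q$ of $v$ satisfies $q>9$ and $q\equiv1\pmod 8$. Then there exists an S$(2,\{2,4\},2v)$ which is harmonious under $\mathbb Z_2\times\mathbb F_v$.
   Context: The components of an integer $v$ are the maximal prime power divisors of $v$; $\mathbb F_v$ denotes the ring which is the direct product of the finite fields whose orders are the components of $v$ (its additive group is used). A linear space S$(2,K,v)$: $v$ points, blocks with sizes in $K$ (every element of $K$ occurring), every pair of points in exactly one block; a resolution partitions the blocks into parallel classes each partitioning the points. A linear space is harmonious under an additive group $\Gamma$ if it has point set $\Gamma$ and a resolution such that the group of translations of $\Gamma$ is an automorphism group of the resolved linear space acting sharply transitively on points and transitively on parallel classes. -}

module Defs where

open import Level using (0ℓ)
open import Data.Nat using (ℕ; zero; suc; _+_; _*_; _^_; _≤_; _<_)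
open import Data.Nat.Divisibility using (_∣_; _∣?_)
open import Data.Nat.DivMod using (_mod_)
open import Data.Nat.Primality using (Prime; prime?)
open import Data.Fin using (Fin; toℕ)
open import Data.List using (List; []; _∷_; length; filter; concatMap; replicate; upTo)
open import Data.List.Membership.Propositional using (_∈_)
open import Data.List.Relation.Unary.Unique.Propositional using (Unique)
open import Data.Product using (Σ; _×_; _,_)
open import Data.Unit using (⊤; tt)
open import Relation.Nullary using (¬_; does)
open import Relation.Binary.PropositionalEquality using (_≡_; _≢_)
open import Function.Bundles using (_⇔_)
open import Data.Bool using (if_then_else_)
open import Data.Sum using (_⊎_)

∃!′ : {A : Set} → (A → Set) → Set
∃!′ {A} P = Σ A λ a → P a × (∀ a′ → P a′ → a ≡ a′)

Component : ℕ → ℕ → Set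
Component q v = Σ ℕ λ p → Σ ℕ λ k →
  Prime p × 1 ≤ k × q ≡ p ^ k × q ∣ v × ¬ (p * q ∣ v)

-- The additive group of F_v.
-- The additive group of the field of order p^n is (Z_p)^n, so the additive
-- group of F_v = ∏ F_{p^n} (over the components p^n of v) is the product of
-- cyclic groups Z_p, where each prime p dividing v occurs ν_p(v) times.

-- ν p v = #{ k ∈ [1 .. v] : p^k ∣ v }  (the p-adic valuation for prime p, v ≥ 1)
ν : ℕ → ℕ → ℕ
ν p v = length (filter (λ k → p ^ suc k ∣? v) (upTo v))

moduli : ℕ → List ℕ
moduli v = concatMap (λ p → if does (prime? p) then replicate (ν p v) p else []) (upTo (suc v))

Tuple : List ℕ → Set
Tuple []       = ⊤
Tuple (m ∷ ms) = Fin m × Tuple ms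

addFin : ∀ {m} → Fin m → Fin m → Fin m
addFin {suc k} x y = (toℕ x + toℕ y) mod suc k

addTuple : ∀ ms → Tuple ms → Tuple ms → Tuple ms
addTuple []       tt       tt       = tt
addTuple (m ∷ ms) (x , xs) (y , ys) = addFin x y , addTuple ms xs ys

Z2×Fv : ℕ → Set
Z2×Fv v = Tuple (2 ∷ moduli v)

addZ2×Fv : ∀ v → Z2×Fv v → Z2×Fv v → Z2×Fv v
addZ2×Fv v = addTuple (2 ∷ moduli v)

HasSize : {P B : Set} → (P → B → Set) → B → ℕ → Set
HasSize {P} _∈B_ b k = Σ (List P) λ xs →
  length xs ≡ k × Unique xs × (∀ x → (x ∈B b) ⇔ (x ∈ xs))

-- A resolved linear space S(2,K,|Γ|) on point set Γ, harmonious under the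
-- additive group (Γ, _⊕_): translations x ↦ x ⊕ g act as automorphisms of
-- the resolved linear space, transitively on parallel classes
-- (sharp transitivity on points is automatic for translations).
record Harmonious (Γ : Set) (_⊕_ : Γ → Γ → Γ) (K : ℕ → Set) : Set₁ where
  field
    Block   : Set
    Class   : Set
    _∈B_    : Γ → Block → Set
    classOf : Block → Class
    blockSizes : ∀ b → Σ ℕ λ k → K k × HasSize _∈B_ b k
    allSizes   : ∀ k → K k → Σ Block λ b → HasSize _∈B_ b k
    pairs      : ∀ x y → x ≢ y → ∃!′ (λ b → x ∈B b × y ∈B b)
    parallel   : ∀ c x → ∃!′ (λ b → classOf b ≡ c × x ∈B b)
    τB      : Γ → Block → Block
    τB-spec : ∀ g b x → (x ∈B b) ⇔ ((x ⊕ g) ∈B τB g b)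
    τC      : Γ → Class → Class
    τC-spec : ∀ g b → classOf (τB g b) ≡ τC g (classOf b)
    transitive : ∀ c c′ → Σ Γ λ g → τC g c ≡ c′

K24 : ℕ → Set
K24 k = k ≡ 2 ⊎ k ≡ 4

-- A base parallel class fixed by ℤ₂ consists of {0,1} × 0 and of the translates by (0,0) and (1,0)
-- of base blocks whose points cover F_v ∖ 0 once and whose differences cover each of
-- 0 × (F_v ∖ 0) and 1 × (F_v ∖ 0) once.  We use units of one quadruple with labels 0, 0, 1, 1 and
-- two pairs, so that the points and both kinds of differences are enumerated by (unit, slot),
-- with eight slots per unit.  Families on H and K combine to one on H × K whenever K has four
-- automorphisms with invertible differences, so ℤ_p (p ≡ 1 mod 8), ℤ_p² (p ≥ 5), ℤ₃⁴ and ℤ₃⁶ suffice.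
--
-- In a field of order q ≡ 1 mod 8 take the units m (a, b, c, d), with pairs −m {a, c} and −m {b, d},
-- where m runs over the biquadratic residues up to sign.  They form a family as soon as
-- {a, b, c, d}, {a − b, c − d, a − c, b − d} and {a − c, a − d, b − c, b − d} meet all four
-- biquadratic classes.  For q > 2¹⁷ such a, b, c, d are chosen one after the other by averaging: for
-- w_κ(z) = 4 [z ∈ κ] − [z ≠ 0] one has
-- Σ_κ Σ_x (Σ_{y ∈ Y} w_κ(x − y))² = 12 |Y| (q − |Y|), so that most x see about |Y| / 4 elements y
-- with x − y in a given class.  The smaller q are settled by a table, except for 17, 3⁴ and 3⁶,
-- for which the units are listed.
module Submission where

open import Defs
open import Algebra.Bundles using (AbelianGroup; CommutativeRing; CommutativeMonoid; CommutativeSemiring)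
open import Algebra.Core using (Op₁; Op₂)
import Algebra.Properties.AbelianGroup as AbelianGroupProperties
import Algebra.Properties.CommutativeSemigroup as CommutativeSemigroupProperties
import Algebra.Properties.CommutativeSemiring.Exp as Exp
import Algebra.Properties.Ring as RingProperties
import Algebra.Solver.Ring.NaturalCoefficients.Default as SemiringSolver
open import Algebra.Structures using (IsAbelianGroup; IsCommutativeRing)
open import Data.Bool using (Bool; true; false; not; _xor_; _∧_; if_then_else_; _∨_)
open import Data.Bool.ListAction using (all; any)
open import Data.Bool.Properties using (T-≡; not-involutive; xor-comm; not-¬)
open import Data.Empty using (⊥)
open import Data.Fin using (Fin; toℕ; zero; suc)
open import Data.Fin.Patterns
import Data.Fin.Properties as Fin
open import Data.Integer using (ℤ; 0ℤ; 1ℤ; -[1+_]; ∣_∣) renaming (+_ to pos)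
import Data.Integer.Properties as ℤ
import Data.Integer.Tactic.RingSolver as ℤ-Solver
import Data.Integer as ℤ
open import Data.List
  using (List; []; _∷_; map; length; _++_; filter; foldr; lookup; cartesianProduct; allFin; concatMap;
         upTo; filterᵇ)
import Data.List.Membership.DecPropositional as DecMembership
open import Data.List.Membership.Propositional using (_∈_; find; lose)
open import Data.List.Membership.Propositional.Properties
  using (∈-map⁺; ∈-map⁻; ∈-filter⁺; ∈-filter⁻; ∈-allFin; ∈-cartesianProduct⁺; ∈-upTo⁺)
open import Data.List.Membership.Propositional.Properties.WithK using (unique∧set⇒bag)
open import Data.List.Properties using (length-map; map-∘; length-++; length-tabulate)
open import Data.List.Relation.Binary.BagAndSetEquality using (∼bag⇒↭)
open import Data.List.Relation.Binary.Permutation.Propositional using (_↭_; ↭⇒↭ₛ)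
open import Data.List.Relation.Binary.Permutation.Propositional.Properties using (map⁺; ↭-length)
import Data.List.Relation.Binary.Permutation.Setoid.Properties as ↭ₛ
open import Data.List.Relation.Unary.All using ([]; _∷_; All)
open import Data.List.Relation.Unary.AllPairs using ([]; _∷_)
import Data.List.Relation.Unary.All as All
open import Data.List.Relation.Unary.Any using (here; there)
open import Data.List.Relation.Unary.Any.Properties using (lookup-index)
import Data.List.Relation.Unary.Any as Any
open import Data.List.Relation.Unary.Unique.Propositional using (Unique)
import Data.List.Relation.Unary.Unique.Propositional.Properties as Unique
open import Data.Nat using (ℕ; zero; suc; z≤n; s≤s; NonZero; _<ᵇ_; _<_; _%_; _∸_; _/_; _≡ᵇ_)
open import Data.Nat.Coprimality using (prime⇒coprime; coprime-Bézout)
open import Data.Nat.DivMod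
  using (_mod_; m%n<n; m<n⇒m%n≡m; %-distribˡ-+; %-distribˡ-*; [m+kn]%n≡m%n; n%n≡0; m≡m%n+[m/n]*n;
         m%n%n≡m%n; /-mono-≤; m*n/n≡m)
open import Data.Nat.Divisibility using (m%n≡0⇒n∣m; hasNonTrivialDivisor)
open import Data.Nat.GCD using (module Bézout)
open import Data.Nat.ListAction using (product)
open import Data.Nat.Primality using (Prime; prime⇒nonTrivial; Composite; prime⇒¬composite; prime?)
import Data.Nat.Properties as ℕ
import Data.Nat as ℕ
open import Data.Product using (Σ; _×_; _,_; proj₁; proj₂; uncurry; swap)
open import Data.Product.Properties using (≡-dec)
open import Data.Sum using (inj₁; inj₂; _⊎_)
open import Data.Unit using (tt)
open import Data.Vec using (Vec; []; _∷_)
import Data.Vec as Vec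
open import Function using (_∘_; id)
open import Function.Bundles using (mk⇔; Equivalence)
open import Level using (0ℓ)
open import Relation.Binary.Definitions using (DecidableEquality; tri<; tri≈; tri>)
open import Relation.Binary.PropositionalEquality
open import Relation.Nullary using (yes; no; Dec; ¬?; ¬_)
open import Relation.Nullary.Decidable using (decidable-stable; T?; from-yes)
open import Relation.Nullary.Negation using (contradiction)

-- Families of base blocks and their development

-- The quadruple of a unit has 4 signed differences of label 0 and 8 of label 1; two pairs inside
-- label 0 supply the 4 that are missing, which fixes the shape of a unit. In a field, signs carry
-- half of the construction: q ≡ 1 mod 8 makes -1 a biquadratic residue, so when m runs over the
-- biquadratic residues up to sign, the products ±m e_j meet every nonzero element once as soon as
-- e_0, ..., e_3 lie in different classes. Points and both kinds of differences are arranged to have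
-- this form, the sign being the first component of a slot. The averaging needs only the sums over x
-- of χ(x - y) χ̄(x - y′), which a substitution evaluates exactly, so no bound of Weil type enters;
-- the price is a threshold as high as 2¹⁷ and tables below it. Only the additive group of 𝔽_q
-- matters, so a component may be cut into smaller groups. If p ≢ 1 mod 8, then q ≡ 1 mod 8 forces
-- an even exponent, and squares of primes p ≥ 5 suffice. For p = 3 the order 9 is excluded, but
-- every even exponent from 4 on is a sum of fours and sixes.

record Ab (A : Set) (_+_ : Op₂ A) : Set where
  field
    0#             : A
    -_             : Op₁ A
    isAbelianGroup : IsAbelianGroup _≡_ _+_ 0# -_
    _≟_            : DecidableEquality A

  abelianGroup : AbelianGroup 0ℓ 0ℓ
  abelianGroup = record { isAbelianGroup = isAbelianGroup }

  open AbelianGroup abelianGroup public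
    using (assoc; comm; identityˡ; identityʳ; inverseˡ; inverseʳ)
  open AbelianGroupProperties abelianGroup public
    using (∙-cancelʳ; ∙-cancelˡ; x∙y⁻¹≈ε⇒x≈y; //-rightDividesˡ; //-rightDividesʳ; x≈z//y; ⁻¹-∙-comm; ⁻¹-involutive)

  infixl 6 _−_
  _−_ : Op₂ A
  x − y = x + (- y)

  +-−-cancel : ∀ x y g → (x + g) − (y + g) ≡ x − y
  +-−-cancel x y g = begin
    (x + g) + (- (y + g))     ≡⟨ cong ((x + g) +_) (sym (⁻¹-∙-comm y g)) ⟩
    (x + g) + ((- y) + (- g)) ≡⟨ cong ((x + g) +_) (comm (- y) (- g)) ⟩
    (x + g) + ((- g) + (- y)) ≡⟨ sym (assoc (x + g) (- g) (- y)) ⟩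
    ((x + g) + (- g)) + (- y) ≡⟨ cong (_− y) (//-rightDividesʳ g x) ⟩
    x + (- y) ∎
    where open ≡-Reasoning

record HitsOnceExcept {A J : Set} (z : A) (f : J → A) : Set where
  field
    avoids : ∀ j → f j ≢ z
    hits   : ∀ x → x ≢ z → ∃!′ λ j → f j ≡ x

  injective : ∀ {j k} → f j ≡ f k → j ≡ k
  injective {j} {k} eq =
    let _ , _ , unique = hits (f k) (avoids k)
    in trans (sym (unique j eq)) (unique k refl)

open HitsOnceExcept

HitsOnceExcept-cong : ∀ {A J : Set} {z : A} {f g : J → A} → (∀ j → f j ≡ g j) →
                      HitsOnceExcept z f → HitsOnceExcept z g
HitsOnceExcept-cong f≗g h .avoids j gj≡z = h .avoids j (trans (f≗g j) gj≡z)
HitsOnceExcept-cong f≗g h .hits x x≢z =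
  let j , fj≡x , unique = h .hits x x≢z
  in j , trans (sym (f≗g j)) fj≡x , λ k gk≡x → unique k (trans (f≗g k) gk≡x)

-- A unit consists of one quadruple, with points (false , 0F), …, (false , 3F),
-- and two pairs, {(true , 0F) , (true , 2F)} and {(true , 1F) , (true , 3F)}.
Slot : Set
Slot = Bool × Fin 4

data Kind : Set where
  quad : Kind
  pair : Bool → Kind

pattern inQ j = (false , j)
pattern inP j = (true , j)

parity : Fin 4 → Bool
parity 0F = false
parity 1F = true
parity 2F = false
parity 3F = true

kind : Slot → Kind
kind (inQ j) = quad
kind (inP j) = pair (parity j)

label : Slot → Fin 2
label (inQ 0F) = 0F
label (inQ 1F) = 0F
label (inQ 2F) = 1F
label (inQ 3F) = 1F
label (inP j)  = 0F

-- The pairs are read backwards, from position 2 to 0 and from 3 to 1, because in a field they carry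
-- -m: then every forward difference is m times a difference of two of a, b, c, d. The edges of
-- label 1 are the four cross pairs of the quadruple.
forward : Fin 2 → Fin 4 → Slot × Slot
forward 0F 0F = inQ 0F , inQ 1F
forward 0F 1F = inQ 2F , inQ 3F
forward 0F 2F = inP 2F , inP 0F
forward 0F 3F = inP 3F , inP 1F
forward 1F 0F = inQ 0F , inQ 2F
forward 1F 1F = inQ 0F , inQ 3F
forward 1F 2F = inQ 1F , inQ 2F
forward 1F 3F = inQ 1F , inQ 3F

-- An index with first component `true` is a reversed edge, so its difference changes sign, just as
-- the points of such slots do in `spread`.
edge : Fin 2 → Slot → Slot × Slot
edge δ (inQ j) = forward δ j
edge δ (inP j) = swap (forward δ j)

source target : Fin 2 → Slot → Slot
source δ e = proj₁ (edge δ e)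
target δ e = proj₂ (edge δ e)

forward-kind : ∀ δ j → kind (proj₁ (forward δ j)) ≡ kind (proj₂ (forward δ j))
forward-kind 0F 0F = refl
forward-kind 0F 1F = refl
forward-kind 0F 2F = refl
forward-kind 0F 3F = refl
forward-kind 1F 0F = refl
forward-kind 1F 1F = refl
forward-kind 1F 2F = refl
forward-kind 1F 3F = refl

edge-kind : ∀ δ e → kind (source δ e) ≡ kind (target δ e)
edge-kind δ (inQ j) = forward-kind δ j
edge-kind δ (inP j) = sym (forward-kind δ j)

edge-label : ∀ δ e → label (source δ e) ≡ addFin δ (label (target δ e))
edge-label 0F (true , 0F)  = refl
edge-label 0F (true , 1F)  = refl
edge-label 0F (true , 2F)  = refl
edge-label 0F (true , 3F)  = refl
edge-label 1F (true , 0F)  = refl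
edge-label 1F (true , 1F)  = refl
edge-label 1F (true , 2F)  = refl
edge-label 1F (true , 3F)  = refl
edge-label 0F (false , 0F) = refl
edge-label 0F (false , 1F) = refl
edge-label 0F (false , 2F) = refl
edge-label 0F (false , 3F) = refl
edge-label 1F (false , 0F) = refl
edge-label 1F (false , 1F) = refl
edge-label 1F (false , 2F) = refl
edge-label 1F (false , 3F) = refl

-- The uniqueness of the block through two points rests on this: any two points of a block are the
-- ends of an edge, so their difference is one of those that `differences` enumerates.
edge-complete : ∀ s t → kind s ≡ kind t → s ≢ t → Σ (Fin 2) λ δ → Σ Slot λ e → edge δ e ≡ (s , t)
edge-complete (inQ 0F) (inQ 0F) _ s≢t = contradiction refl s≢t
edge-complete (inQ 0F) (inQ 1F) _ _ = 0F , inQ 0F , refl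
edge-complete (inQ 0F) (inQ 2F) _ _ = 1F , inQ 0F , refl
edge-complete (inQ 0F) (inQ 3F) _ _ = 1F , inQ 1F , refl
edge-complete (inQ 1F) (inQ 0F) _ _ = 0F , inP 0F , refl
edge-complete (inQ 1F) (inQ 1F) _ s≢t = contradiction refl s≢t
edge-complete (inQ 1F) (inQ 2F) _ _ = 1F , inQ 2F , refl
edge-complete (inQ 1F) (inQ 3F) _ _ = 1F , inQ 3F , refl
edge-complete (inQ 2F) (inQ 0F) _ _ = 1F , inP 0F , refl
edge-complete (inQ 2F) (inQ 1F) _ _ = 1F , inP 2F , refl
edge-complete (inQ 2F) (inQ 2F) _ s≢t = contradiction refl s≢t
edge-complete (inQ 2F) (inQ 3F) _ _ = 0F , inQ 1F , refl
edge-complete (inQ 3F) (inQ 0F) _ _ = 1F , inP 1F , refl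
edge-complete (inQ 3F) (inQ 1F) _ _ = 1F , inP 3F , refl
edge-complete (inQ 3F) (inQ 2F) _ _ = 0F , inP 1F , refl
edge-complete (inQ 3F) (inQ 3F) _ s≢t = contradiction refl s≢t
edge-complete (inP 0F) (inP 0F) _ s≢t = contradiction refl s≢t
edge-complete (inP 0F) (inP 2F) _ _ = 0F , inP 2F , refl
edge-complete (inP 1F) (inP 1F) _ s≢t = contradiction refl s≢t
edge-complete (inP 1F) (inP 3F) _ _ = 0F , inP 3F , refl
edge-complete (inP 2F) (inP 0F) _ _ = 0F , inQ 2F , refl
edge-complete (inP 2F) (inP 2F) _ s≢t = contradiction refl s≢t
edge-complete (inP 3F) (inP 1F) _ _ = 0F , inQ 3F , refl
edge-complete (inP 3F) (inP 3F) _ s≢t = contradiction refl s≢t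
edge-complete (inP 0F) (inP 1F) ()
edge-complete (inP 0F) (inP 3F) ()
edge-complete (inP 1F) (inP 0F) ()
edge-complete (inP 1F) (inP 2F) ()
edge-complete (inP 2F) (inP 1F) ()
edge-complete (inP 2F) (inP 3F) ()
edge-complete (inP 3F) (inP 0F) ()
edge-complete (inP 3F) (inP 2F) ()
edge-complete (inQ _) (inP _) ()
edge-complete (inP _) (inQ _) ()

-- The base blocks of a family developed over ℤ₂ × G: their points cover G ∖ 0 once, and
-- their differences cover each coset of G in ℤ₂ × G once, except for the subgroup ℤ₂ × 0.
record Family {A : Set} {_+_ : Op₂ A} (G : Ab A _+_) : Set₁ where
  open Ab G
  field
    Unit        : Set
    point       : Unit → Slot → A
    points      : HitsOnceExcept 0# (uncurry point)
    differences : ∀ δ → HitsOnceExcept 0#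
                    (uncurry λ u e → point u (source δ e) − point u (target δ e))

_×-add_ : ∀ {A B : Set} → Op₂ A → Op₂ B → Op₂ (A × B)
(_+_ ×-add _⊕_) (a , b) (c , d) = (a + c) , (b ⊕ d)

×-Ab : ∀ {A B : Set} {_+_ : Op₂ A} {_⊕_ : Op₂ B} → Ab A _+_ → Ab B _⊕_ → Ab (A × B) (_+_ ×-add _⊕_)
×-Ab G H = record
  { 0# = G.0# , H.0#
  ; -_ = λ (a , b) → (G.- a) , (H.- b)
  ; isAbelianGroup = record
    { isGroup = record
      { isMonoid = record
        { isSemigroup = record
          { isMagma = record { isEquivalence = isEquivalence ; ∙-cong = cong₂ _ }
          ; assoc = λ (a , b) (c , d) (e , f) → cong₂ _,_ (G.assoc a c e) (H.assoc b d f) }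
        ; identity = (λ (a , b) → cong₂ _,_ (G.identityˡ a) (H.identityˡ b))
                   , (λ (a , b) → cong₂ _,_ (G.identityʳ a) (H.identityʳ b)) }
      ; inverse = (λ (a , b) → cong₂ _,_ (G.inverseˡ a) (H.inverseˡ b))
                , (λ (a , b) → cong₂ _,_ (G.inverseʳ a) (H.inverseʳ b))
      ; ⁻¹-cong = λ { refl → refl } }
    ; comm = λ (a , b) (c , d) → cong₂ _,_ (G.comm a c) (H.comm b d) }
  ; _≟_ = ≡-dec G._≟_ H._≟_ }
  where
  module G = Ab G
  module H = Ab H

module Develop {A : Set} {_+_ : Op₂ A} (G : Ab A _+_) (Z : Ab (Fin 2) addFin) (F : Family G) where

  open Ab G
  open Family F
  private
    module Z = Ab Z
    module Γ = Ab (×-Ab Z G)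

  Γ : Set
  Γ = Fin 2 × A

  _⊕_ : Op₂ Γ
  _⊕_ = addFin ×-add _+_

  -- A block is a formal translate, and equality of blocks is equality of these names. `short` has
  -- no ℤ₂ component, since translation by (1, 0) fixes its block; all other blocks record the full
  -- translation.
  data Block : Set where
    short : A → Block
    long  : Unit → Kind → Γ → Block

  base : Unit → Slot → Γ
  base u s = label s , point u s

  _∈B_ : Γ → Block → Set
  x ∈B short y    = proj₂ x ≡ y
  x ∈B long u k g = Σ Slot λ s → kind s ≡ k × base u s ⊕ g ≡ x

  classOf : Block → A
  classOf (short y)           = y
  classOf (long _ _ (_ , g)) = g

  translate : Γ → Block → Block
  translate (_ , g) (short y)    = short (y + g)
  translate g       (long u k h) = long u k (h ⊕ g)

  translate-∈ : ∀ g b x → x ∈B b → (x ⊕ g) ∈B translate g b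
  translate-∈ g (short y)    x refl            = refl
  translate-∈ g (long u k h) x (s , sk , refl) = s , sk , sym (Γ.assoc (base u s) h g)

  translate-∋ : ∀ g b x → (x ⊕ g) ∈B translate g b → x ∈B b
  translate-∋ (_ , g) (short y) (_ , x) eq = ∙-cancelʳ g x y eq
  translate-∋ g (long u k h) x (s , sk , eq) =
    s , sk , Γ.∙-cancelʳ g _ _ (trans (Γ.assoc (base u s) h g) eq)

  classOf-translate : ∀ g b → classOf (translate g b) ≡ classOf b + proj₂ g
  classOf-translate g (short y)    = refl
  classOf-translate g (long u k h) = refl

  slots : Kind → List Slot
  slots quad         = inQ 0F ∷ inQ 1F ∷ inQ 2F ∷ inQ 3F ∷ []
  slots (pair false) = inP 0F ∷ inP 2F ∷ []
  slots (pair true)  = inP 1F ∷ inP 3F ∷ []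

  ∈-slots : ∀ s → s ∈ slots (kind s)
  ∈-slots (inQ 0F) = here refl
  ∈-slots (inQ 1F) = there (here refl)
  ∈-slots (inQ 2F) = there (there (here refl))
  ∈-slots (inQ 3F) = there (there (there (here refl)))
  ∈-slots (inP 0F) = here refl
  ∈-slots (inP 1F) = here refl
  ∈-slots (inP 2F) = there (here refl)
  ∈-slots (inP 3F) = there (here refl)

  slots-kind : ∀ k {s} → s ∈ slots k → kind s ≡ k
  slots-kind quad         (here refl)                         = refl
  slots-kind quad         (there (here refl))                 = refl
  slots-kind quad         (there (there (here refl)))         = refl
  slots-kind quad         (there (there (there (here refl)))) = refl
  slots-kind (pair false) (here refl)                         = refl
  slots-kind (pair false) (there (here refl))                 = refl
  slots-kind (pair true)  (here refl)                         = refl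
  slots-kind (pair true)  (there (here refl))                 = refl

  slots-unique : ∀ k → Unique (slots k)
  slots-unique quad = ((λ ()) ∷ (λ ()) ∷ (λ ()) ∷ []) ∷ ((λ ()) ∷ (λ ()) ∷ []) ∷ ((λ ()) ∷ []) ∷ [] ∷ []
  slots-unique (pair false) = ((λ ()) ∷ []) ∷ [] ∷ []
  slots-unique (pair true)  = ((λ ()) ∷ []) ∷ [] ∷ []

  slot-unique : ∀ {u s v t} → point u s ≡ point v t → (u , s) ≡ (v , t)
  slot-unique = injective points

  developed : ∀ u g → Slot → Γ
  developed u g s = base u s ⊕ g

  developed-injective : ∀ u g {s t} → developed u g s ≡ developed u g t → s ≡ t
  developed-injective u g eq =
    cong proj₂ (slot-unique (cong proj₂ (Γ.∙-cancelʳ g (base u _) (base u _) eq)))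

  edge-difference : ∀ δ e → label (source δ e) Z.− label (target δ e) ≡ δ
  edge-difference δ e = sym (Z.x≈z//y δ (label (target δ e)) (label (source δ e)) (sym (edge-label δ e)))

  hasSize-long : ∀ u k g n → length (slots k) ≡ n → HasSize _∈B_ (long u k g) n
  hasSize-long u k g n len =
    map (developed u g) (slots k) ,
    trans (length-map (developed u g) (slots k)) len ,
    Unique.map⁺ (developed-injective u g) (slots-unique k) ,
    λ x → mk⇔
      (λ { (s , refl , refl) → ∈-map⁺ (developed u g) (∈-slots s) })
      (λ x∈ → let s , s∈ , eq = ∈-map⁻ (developed u g) x∈ in s , slots-kind k s∈ , sym eq)

  hasSize-short : ∀ y → HasSize _∈B_ (short y) 2
  hasSize-short y =
    (0F , y) ∷ (1F , y) ∷ [] , refl , ((λ ()) ∷ []) ∷ [] ∷ [] ,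
    λ { (0F , x) → mk⇔ (λ { refl → here refl })
                       (λ { (here refl) → refl ; (there (here ())) ; (there (there ())) })
      ; (1F , x) → mk⇔ (λ { refl → there (here refl) })
                       (λ { (here ()) ; (there (here refl)) → refl ; (there (there ())) }) }

  blockSizes : ∀ b → Σ ℕ λ k → K24 k × HasSize _∈B_ b k
  blockSizes (short y)             = 2 , inj₁ refl , hasSize-short y
  blockSizes (long u quad g)         = 4 , inj₂ refl , hasSize-long u quad g 4 refl
  blockSizes (long u (pair false) g) = 2 , inj₁ refl , hasSize-long u (pair false) g 2 refl
  blockSizes (long u (pair true) g)  = 2 , inj₁ refl , hasSize-long u (pair true) g 2 refl

  parallel : ∀ c x → ∃!′ λ b → classOf b ≡ c × x ∈B b
  parallel c (δ , x) with x ≟ c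
  ... | yes refl = short x , (refl , refl) , λ
        { (short y)    (_ , refl) → refl
        ; (long u k (_ , h)) (refl , s , _ , eq) →
            contradiction (∙-cancelʳ h _ _ (trans (cong proj₂ eq) (sym (identityˡ h))))
                          (points .avoids (u , s)) }
  ... | no x≢c =
    let (u , s) , pt≡ , unique = points .hits (x − c) (λ eq → x≢c (x∙y⁻¹≈ε⇒x≈y x c eq))
        -- The class fixes the second component of the translation. Of the two ℤ₂-translates of the
        -- block in this class, exactly one takes `label s` to `δ`.
        g = (δ Z.− label s) , c
        covers = cong₂ _,_
          (trans (Z.comm (label s) (δ Z.− label s)) (Z.//-rightDividesˡ (label s) δ))
          (trans (cong (_+ c) pt≡) (//-rightDividesˡ c x))
    in long u (kind s) g , (refl , s , refl , covers) , λ
        { (short y) (refl , eq) → contradiction eq x≢c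
        ; (long v k (ε , h)) (refl , t , refl , eq) →
            same-block (unique (v , t) (x≈z//y _ h x (cong proj₂ eq))) (cong proj₁ eq) }
    where
    same-block : ∀ {u s v t h ε} → (u , s) ≡ (v , t) → addFin (label t) ε ≡ δ →
                 long u (kind s) ((δ Z.− label s) , h) ≡ long v (kind t) (ε , h)
    same-block {s = s} {h = h} {ε = ε} refl eq =
      cong (λ ε′ → long _ _ (ε′ , h)) (sym (Z.x≈z//y ε (label s) δ (trans (Z.comm ε (label s)) eq)))

  pairs : ∀ x y → x ≢ y → ∃!′ λ b → x ∈B b × y ∈B b
  pairs (δ , x) (ε , y) x≢y with x ≟ y
  ... | yes refl = short x , (refl , refl) , λ
        { (short z)    (refl , _) → refl
        ; (long u k g) ((s , _ , seq) , (t , _ , teq)) →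
            contradiction (twins {u} {g} {s} {t} seq teq) x≢y }
    where
    twins : ∀ {u g s t} → base u s ⊕ g ≡ (δ , x) → base u t ⊕ g ≡ (ε , x) → (δ , x) ≡ (ε , x)
    twins {u} {_ , g} {s} {t} seq teq
      with slot-unique {u} {s} {u} {t} (∙-cancelʳ g _ _ (trans (cong proj₂ seq) (sym (cong proj₂ teq))))
    ... | refl = trans (sym seq) teq
  ... | no x≢y′ =
    let (u , e) , d≡ , unique = differences (δ Z.− ε) .hits (x − y) (λ eq → x≢y′ (x∙y⁻¹≈ε⇒x≈y x y eq))
        s = source (δ Z.− ε) e
        t = target (δ Z.− ε) e
        g = (δ , x) Γ.− base u s
        through-x = trans (Γ.comm (base u s) g) (Γ.//-rightDividesˡ (base u s) (δ , x))
        difference = cong₂ _,_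
          (edge-difference (δ Z.− ε) e)
          d≡
    in long u (kind s) g ,
       ((s , refl , through-x) , (t , sym (edge-kind (δ Z.− ε) e) ,
         through-y (base u s) (base u t) g through-x difference)) , λ
        { (short z)    (xz , yz) → contradiction (trans xz (sym yz)) x≢y′
        ; (long v k h) ((s′ , refl , seq) , (t′ , tk , teq)) →
            same-block unique s′ t′ (sym tk) seq teq }
    where
    through-y : ∀ a b g → a ⊕ g ≡ (δ , x) → a Γ.− b ≡ (δ Z.− ε , x − y) → b ⊕ g ≡ (ε , y)
    through-y a b g a+g≡x a-b≡x-y = begin
      b ⊕ g
        ≡⟨ sym (Γ.⁻¹-involutive (b ⊕ g)) ⟩
      Γ.- (Γ.- (b ⊕ g))
        ≡⟨ cong Γ.-_ (Γ.∙-cancelˡ (δ , x) _ _ (begin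
             (δ , x) Γ.− (b ⊕ g) ≡⟨ cong (Γ._− (b ⊕ g)) (sym a+g≡x) ⟩
             (a ⊕ g) Γ.− (b ⊕ g) ≡⟨ Γ.+-−-cancel a b g ⟩
             a Γ.− b             ≡⟨ a-b≡x-y ⟩
             (δ , x) Γ.− (ε , y) ∎)) ⟩
      Γ.- (Γ.- (ε , y))
        ≡⟨ Γ.⁻¹-involutive (ε , y) ⟩
      (ε , y) ∎
      where open ≡-Reasoning

    same-block : ∀ {u e v h} →
      (∀ ve → point (proj₁ ve) (source (δ Z.− ε) (proj₂ ve)) − point (proj₁ ve) (target (δ Z.− ε) (proj₂ ve))
              ≡ x − y → (u , e) ≡ ve) →
      ∀ s t → kind s ≡ kind t → base v s ⊕ h ≡ (δ , x) → base v t ⊕ h ≡ (ε , y) →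
      long u (kind (source (δ Z.− ε) e)) ((δ , x) Γ.− base u (source (δ Z.− ε) e)) ≡ long v (kind s) h
    same-block {v = v} {h} unique s t st seq teq
      with edge-complete s t st (λ { refl → x≢y′ (cong proj₂ (trans (sym seq) teq)) })
    ... | δ′ , e′ , refl
      -- The ℤ₂ component of the difference has to identify `δ′` with `δ − ε` first; only then is
      -- `e′` an edge to which `unique` applies.
      with base-difference ← trans (sym (Γ.+-−-cancel (base v s) (base v t) h)) (cong₂ Γ._−_ seq teq)
      with refl ← trans (sym (edge-difference δ′ e′)) (cong proj₁ base-difference)
      with refl ← unique (v , e′) (cong proj₂ base-difference)
      = cong (long v (kind s)) (sym (Γ.x≈z//y h (base v s) (δ , x) (trans (Γ.comm h (base v s)) seq)))

  -- The given unit provides a block of size 4, as `allSizes` demands.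
  harmonious : Unit → Harmonious Γ _⊕_ K24
  harmonious u = record
    { Block = Block
    ; Class = A
    ; _∈B_ = _∈B_
    ; classOf = classOf
    ; blockSizes = blockSizes
    ; allSizes = λ { k (inj₁ refl) → short 0# , hasSize-short 0#
                   ; k (inj₂ refl) → long u quad Γ.0# , hasSize-long u quad Γ.0# 4 refl }
    ; pairs = pairs
    ; parallel = parallel
    ; τB = translate
    ; τB-spec = λ g b x → mk⇔ (translate-∈ g b x) (translate-∋ g b x)
    ; τC = λ g c → c + proj₂ g
    ; τC-spec = classOf-translate
    ; transitive = λ c c′ → (0F , c′ − c) , trans (comm c (c′ − c)) (//-rightDividesˡ c c′)
    }

-- Composition of families

HitsOnce : {A B : Set} → (A → B) → Set
HitsOnce f = ∀ y → ∃!′ λ x → f x ≡ y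

HitsOnce-× : ∀ {A B C D : Set} {f : A → C} {g : B → D} → HitsOnce f → HitsOnce g →
             HitsOnce λ (x : A × B) → f (proj₁ x) , g (proj₂ x)
HitsOnce-× hf hg (c , d) =
  let a , fa≡c , unique-a = hf c
      b , gb≡d , unique-b = hg d
  in (a , b) , cong₂ _,_ fa≡c gb≡d ,
     λ (a′ , b′) eq → cong₂ _,_ (unique-a a′ (cong proj₁ eq)) (unique-b b′ (cong proj₂ eq))

-- With base families on H and K, the points (h , scale i k) for the slots (_ , i) make a
-- base family on H × K relative to 0 × K.
record Multipliers {A : Set} {_+_ : Op₂ A} (G : Ab A _+_) : Set where
  open Ab G
  field
    scale            : Fin 4 → A → A
    scale-hits       : ∀ i → HitsOnce (scale i)
    difference-hits  : ∀ {i j} → i ≢ j → HitsOnce λ x → scale i x − scale j x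

multipliers-× : ∀ {A B : Set} {_+_ : Op₂ A} {_⊕_ : Op₂ B} {G : Ab A _+_} {H : Ab B _⊕_} →
                Multipliers G → Multipliers H → Multipliers (×-Ab G H)
multipliers-× M N = record
  { scale           = λ i (a , b) → M.scale i a , N.scale i b
  ; scale-hits      = λ i → HitsOnce-× (M.scale-hits i) (N.scale-hits i)
  ; difference-hits = λ i≢j → HitsOnce-× (M.difference-hits i≢j) (N.difference-hits i≢j)
  }
  where
  module M = Multipliers M
  module N = Multipliers N

forward-≢ : ∀ δ j → proj₂ (proj₁ (forward δ j)) ≢ proj₂ (proj₂ (forward δ j))
forward-≢ 0F 0F ()
forward-≢ 0F 1F ()
forward-≢ 0F 2F ()
forward-≢ 0F 3F ()
forward-≢ 1F 0F ()
forward-≢ 1F 1F ()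
forward-≢ 1F 2F ()
forward-≢ 1F 3F ()

-- In a product the multiplier depends on the position only, not on the sign. The ends of an edge
-- thus carry different multipliers, whose difference is bijective.
edge-≢ : ∀ δ e → proj₂ (source δ e) ≢ proj₂ (target δ e)
edge-≢ δ (inQ j) = forward-≢ δ j
edge-≢ δ (inP j) = forward-≢ δ j ∘ sym

-- Composition uses up the multipliers of the second factor, and those of both factors together make
-- the product composable again; hence they travel with the family.
record Nice (A : Set) (_+_ : Op₂ A) : Set₁ where
  field
    group       : Ab A _+_
    family      : Family group
    multipliers : Multipliers group

module Product {A B : Set} {_+_ : Op₂ A} {_⊕_ : Op₂ B} (M : Nice A _+_) (N : Nice B _⊕_) where

  private
    module M = Nice M
    module N = Nice N
    module G = Ab M.group
    module H = Ab N.group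
    module FM = Family M.family
    module FN = Family N.family
    module SN = Multipliers N.multipliers

  combined : ∀ {I J : Set} → (I × Slot → A) → (J × Slot → B) → (Slot → B → B) →
             (I × B ⊎ J) × Slot → A × B
  combined f g φ (inj₁ (i , b) , s) = f (i , s) , φ s b
  combined f g φ (inj₂ j , s)       = G.0# , g (j , s)

  -- One argument for the points and for both kinds of differences: the fibre over a nonzero a is
  -- swept by the bijection `φ s`, where s is the slot at which `f` hits a, and the fibre over 0 is
  -- covered by `g`.
  combined-hits : ∀ {I J : Set} {f : I × Slot → A} {g : J × Slot → B} {φ : Slot → B → B} →
                  HitsOnceExcept G.0# f → HitsOnceExcept H.0# g → (∀ s → HitsOnce (φ s)) →
                  HitsOnceExcept (G.0# , H.0#) (combined f g φ)
  combined-hits hf hg hφ .avoids (inj₁ (i , b) , s) eq = hf .avoids (i , s) (cong proj₁ eq)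
  combined-hits hf hg hφ .avoids (inj₂ j , s)       eq = hg .avoids (j , s) (cong proj₂ eq)
  combined-hits {f = f} hf hg hφ .hits (a , b) ab≢0 with a G.≟ G.0#
  ... | yes refl =
    let (j , s) , g≡b , unique = hg .hits b (λ b≡0 → ab≢0 (cong (G.0# ,_) b≡0))
    in (inj₂ j , s) , cong (G.0# ,_) g≡b , λ
        { (inj₁ (i , _) , t) eq → contradiction (cong proj₁ eq) (hf .avoids (i , t))
        ; (inj₂ k , t)       eq → cong (λ (j , s) → inj₂ j , s) (unique (k , t) (cong proj₂ eq)) }
  ... | no a≢0 =
    let (i , s) , f≡a , unique-i = hf .hits a a≢0
        y , φ≡b , unique-y = hφ s b
    in (inj₁ (i , y) , s) , cong₂ _,_ f≡a φ≡b , λ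
        { (inj₁ (k , z) , t) eq → same-index (unique-i (k , t) (cong proj₁ eq)) (cong proj₂ eq) unique-y
        ; (inj₂ _ , _)       eq → contradiction (sym (cong proj₁ eq)) a≢0 }
    where
    same-index : ∀ {i k s t y z} {φ : Slot → B → B} → (i , s) ≡ (k , t) → φ t z ≡ b →
                 (∀ y′ → φ s y′ ≡ b → y ≡ y′) → (inj₁ (i , y) , s) ≡ (inj₁ (k , z) , t)
    same-index {i} {s = s} {z = z} refl eq unique = cong (λ y → inj₁ (i , y) , s) (unique z eq)

  point : FM.Unit × B ⊎ FN.Unit → Slot → A × B
  point (inj₁ (i , b)) s = FM.point i s , SN.scale (proj₂ s) b
  point (inj₂ j)       s = G.0# , FN.point j s

  nice-× : Nice (A × B) (_+_ ×-add _⊕_)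
  nice-× = record
    { group  = ×-Ab M.group N.group
    ; family = record
      { Unit   = FM.Unit × B ⊎ FN.Unit
      ; point  = point
      ; points = HitsOnceExcept-cong
          (λ { (inj₁ _ , _) → refl ; (inj₂ _ , _) → refl })
          (combined-hits FM.points FN.points (SN.scale-hits ∘ proj₂))
      ; differences = λ δ → HitsOnceExcept-cong
          (λ { (inj₁ _ , _) → refl
             ; (inj₂ j , e) → cong (_, FN.point j (source δ e) H.− FN.point j (target δ e))
                                   (sym (G.inverseʳ G.0#)) })
          (combined-hits (FM.differences δ) (FN.differences δ) (λ e → SN.difference-hits (edge-≢ δ e)))
      }
    ; multipliers = multipliers-× M.multipliers N.multipliers
    }

record _≅_ {A B : Set} (_+_ : Op₂ A) (_⊕_ : Op₂ B) : Set where
  field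
    to      : A → B
    from    : B → A
    to-from : ∀ b → to (from b) ≡ b
    from-to : ∀ a → from (to a) ≡ a
    to-+    : ∀ x y → to (x + y) ≡ to x ⊕ to y

module Transport {A B : Set} {_+_ : Op₂ A} {_⊕_ : Op₂ B} (iso : _+_ ≅ _⊕_) (N : Nice A _+_) where

  open _≅_ iso
  open Nice N
  open Ab group
  open Family family
  open Multipliers multipliers

  from-⊕ : ∀ x y → from (x ⊕ y) ≡ from x + from y
  from-⊕ x y = begin
    from (x ⊕ y)                     ≡⟨ cong from (sym (cong₂ _⊕_ (to-from x) (to-from y))) ⟩
    from (to (from x) ⊕ to (from y)) ≡⟨ cong from (sym (to-+ (from x) (from y))) ⟩
    from (to (from x + from y))      ≡⟨ from-to _ ⟩
    from x + from y                  ∎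
    where open ≡-Reasoning

  from-injective : ∀ {x y} → from x ≡ from y → x ≡ y
  from-injective {x} {y} eq = trans (sym (to-from x)) (trans (cong to eq) (to-from y))

  neg : Op₁ B
  neg b = to (- from b)

  transported-isAbelianGroup : IsAbelianGroup _≡_ _⊕_ (to 0#) neg
  transported-isAbelianGroup = record
    { isGroup = record
      { isMonoid = record
        { isSemigroup = record
          { isMagma = record { isEquivalence = isEquivalence ; ∙-cong = cong₂ _ }
          ; assoc = λ x y z → from-injective (begin
              from ((x ⊕ y) ⊕ z)         ≡⟨ trans (from-⊕ (x ⊕ y) z) (cong (_+ from z) (from-⊕ x y)) ⟩
              (from x + from y) + from z ≡⟨ assoc (from x) (from y) (from z) ⟩
              from x + (from y + from z) ≡⟨ sym (trans (from-⊕ x (y ⊕ z)) (cong (from x +_) (from-⊕ y z))) ⟩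
              from (x ⊕ (y ⊕ z))         ∎) }
        ; identity = (λ x → from-injective (begin
                         from (to 0# ⊕ x) ≡⟨ trans (from-⊕ (to 0#) x) (cong (_+ from x) (from-to 0#)) ⟩
                         0# + from x      ≡⟨ identityˡ (from x) ⟩
                         from x           ∎))
                   , (λ x → from-injective (begin
                         from (x ⊕ to 0#) ≡⟨ trans (from-⊕ x (to 0#)) (cong (from x +_) (from-to 0#)) ⟩
                         from x + 0#      ≡⟨ identityʳ (from x) ⟩
                         from x           ∎)) }
      ; inverse = (λ x → from-injective (begin
                         from (neg x ⊕ x)      ≡⟨ trans (from-⊕ (neg x) x) (cong (_+ from x) (from-to _)) ⟩
                         (- from x) + from x   ≡⟨ inverseˡ (from x) ⟩
                         0#                    ≡⟨ sym (from-to 0#) ⟩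
                         from (to 0#)          ∎))
                , (λ x → from-injective (begin
                         from (x ⊕ neg x)      ≡⟨ trans (from-⊕ x (neg x)) (cong (from x +_) (from-to _)) ⟩
                         from x + (- from x)   ≡⟨ inverseʳ (from x) ⟩
                         0#                    ≡⟨ sym (from-to 0#) ⟩
                         from (to 0#)          ∎))
      ; ⁻¹-cong = λ { refl → refl } }
    ; comm = λ x y → from-injective
        (trans (from-⊕ x y) (trans (comm (from x) (from y)) (sym (from-⊕ y x)))) }
    where open ≡-Reasoning

  transported : Ab B _⊕_
  transported = record
    { isAbelianGroup = transported-isAbelianGroup
    ; _≟_ = λ x y → dec x y (from x ≟ from y) }
    where
    open import Relation.Nullary using (Dec)
    dec : ∀ x y → Dec (from x ≡ from y) → Dec (x ≡ y)
    dec x y (yes eq) = yes (from-injective eq)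
    dec x y (no neq) = no (neq ∘ cong from)

  private
    module T = Ab transported

  to-− : ∀ x y → to (x − y) ≡ to x T.− to y
  to-− x y = trans (to-+ x (- y)) (cong (λ z → to x ⊕ to (- z)) (sym (from-to y)))

  to-hitsExcept : ∀ {J : Set} {f : J → A} → HitsOnceExcept 0# f → HitsOnceExcept (to 0#) (to ∘ f)
  to-hitsExcept {f = f} h .avoids j eq =
    h .avoids j (trans (sym (from-to (f j))) (trans (cong from eq) (from-to 0#)))
  to-hitsExcept {f = f} h .hits b b≢0 =
    let j , fj≡ , unique = h .hits (from b) (λ eq → b≢0 (trans (sym (to-from b)) (cong to eq)))
    in j , trans (cong to fj≡) (to-from b) ,
       λ k eq → unique k (trans (sym (from-to (f k))) (cong from eq))

  conj-hits : ∀ {f : A → A} {g : B → B} → (∀ b → g b ≡ to (f (from b))) → HitsOnce f → HitsOnce g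
  conj-hits {f} {g} g≗ h b =
    let a , fa≡ , unique = h (from b)
    in to a , trans (g≗ (to a)) (trans (cong (to ∘ f) (from-to a)) (trans (cong to fa≡) (to-from b))) ,
       λ b′ eq → trans (cong to (unique (from b′) (trans (sym (from-to _)) (cong from (trans (sym (g≗ b′)) eq)))))
                       (to-from b′)

  transport : Nice B _⊕_
  transport = record
    { group  = transported
    ; family = record
      { Unit        = Unit
      ; point       = λ u s → to (point u s)
      ; points      = to-hitsExcept points
      ; differences = λ δ → HitsOnceExcept-cong (λ (u , e) → to-− _ _) (to-hitsExcept (differences δ))
      }
    ; multipliers = record
      { scale           = λ i b → to (scale i (from b))
      ; scale-hits      = λ i → conj-hits (λ _ → refl) (scale-hits i)
      ; difference-hits = λ i≢j → conj-hits (λ b → sym (to-− _ _)) (difference-hits i≢j)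
      }
    }

NiceTuple : List ℕ → Set₁
NiceTuple ms = Nice (Tuple ms) (addTuple ms)

-- The trivial group has no nonzero element to cover, so there is no unit. This is the starting
-- point of every composition.
nice-[] : NiceTuple []
nice-[] = record
  { group = record
    { isAbelianGroup = record
      { isGroup = record
        { isMonoid = record
          { isSemigroup = record
            { isMagma = record { isEquivalence = isEquivalence ; ∙-cong = cong₂ _ }
            ; assoc = λ _ _ _ → refl }
          ; identity = (λ _ → refl) , (λ _ → refl) }
        ; inverse = (λ _ → refl) , (λ _ → refl)
        ; ⁻¹-cong = λ _ → refl }
      ; comm = λ _ _ → refl }
    ; -_ = λ _ → tt
    ; _≟_ = λ _ _ → yes refl }
  ; family = record
    { Unit        = ⊥
    ; point       = λ ()
    ; points      = record { avoids = λ () ; hits = λ _ ≢tt → contradiction refl ≢tt }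
    ; differences = λ _ → record { avoids = λ () ; hits = λ _ ≢tt → contradiction refl ≢tt }
    }
  ; multipliers = record
    { scale           = λ _ _ → tt
    ; scale-hits      = λ _ _ → tt , refl , λ _ _ → refl
    ; difference-hits = λ _ _ → tt , refl , λ _ _ → refl
    }
  }

++-≅ : ∀ ms ns → (addTuple ms ×-add addTuple ns) ≅ addTuple (ms ++ ns)
++-≅ [] ns = record
  { to      = proj₂
  ; from    = tt ,_
  ; to-from = λ _ → refl
  ; from-to = λ _ → refl
  ; to-+    = λ _ _ → refl
  }
++-≅ (m ∷ ms) ns = record
  { to      = λ ((x , xs) , ys) → x , E.to (xs , ys)
  ; from    = λ (x , zs) → (x , proj₁ (E.from zs)) , proj₂ (E.from zs)
  ; to-from = λ (x , zs) → cong (x ,_) (E.to-from zs)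
  ; from-to = λ ((x , xs) , ys) → cong (λ (xs , ys) → (x , xs) , ys) (E.from-to (xs , ys))
  ; to-+    = λ ((x , xs) , ys) ((x′ , xs′) , ys′) → cong (addFin x x′ ,_) (E.to-+ (xs , ys) (xs′ , ys′))
  }
  where module E = _≅_ (++-≅ ms ns)

nice-++ : ∀ {ms ns} → NiceTuple ms → NiceTuple ns → NiceTuple (ms ++ ns)
nice-++ {ms} {ns} M N = Transport.transport (++-≅ ms ns) (Product.nice-× M N)

-- Sums and finite fields

-- The source of every change of variables below: a bijection of the field maps its list of elements
-- to a list of the same members, hence to a permutation of it.
unique-↭ : ∀ {A : Set} {xs ys : List A} → Unique xs → Unique ys →
           (∀ {x} → x ∈ xs → x ∈ ys) → (∀ {x} → x ∈ ys → x ∈ xs) → xs ↭ ys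
unique-↭ ux uy to from = ∼bag⇒↭ (unique∧set⇒bag ux uy (mk⇔ to from))

∑ : ∀ {A : Set} → List A → (A → ℤ) → ℤ
∑ xs f = foldr ℤ._+_ 0ℤ (map f xs)

private variable
  A B : Set

∑-cong : ∀ (xs : List A) {f g : A → ℤ} → (∀ {x} → x ∈ xs → f x ≡ g x) → ∑ xs f ≡ ∑ xs g
∑-cong []       f≗g = refl
∑-cong (x ∷ xs) f≗g = cong₂ ℤ._+_ (f≗g (here refl)) (∑-cong xs (f≗g ∘ there))

∑-↭ : ∀ {xs ys : List A} (f : A → ℤ) → xs ↭ ys → ∑ xs f ≡ ∑ ys f
∑-↭ f p = ↭ₛ.foldr-commMonoid M.setoid M.isCommutativeMonoid (↭⇒↭ₛ (map⁺ f p))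
  where module M = CommutativeMonoid ℤ.+-0-commutativeMonoid

∑-map : ∀ (g : A → B) (xs : List A) (f : B → ℤ) → ∑ (map g xs) f ≡ ∑ xs (f ∘ g)
∑-map g xs f = cong (foldr ℤ._+_ 0ℤ) (sym (map-∘ xs))

∑-+ : ∀ (xs : List A) (f g : A → ℤ) → ∑ xs (λ x → f x ℤ.+ g x) ≡ ∑ xs f ℤ.+ ∑ xs g
∑-+ []       f g = refl
∑-+ (x ∷ xs) f g = trans (cong (ℤ._+_ (f x ℤ.+ g x)) (∑-+ xs f g)) (interchange (f x) (g x) (∑ xs f) (∑ xs g))
  where open CommutativeSemigroupProperties (CommutativeMonoid.commutativeSemigroup ℤ.+-0-commutativeMonoid)

∑-*ˡ : ∀ (xs : List A) c (f : A → ℤ) → ∑ xs (λ x → c ℤ.* f x) ≡ c ℤ.* ∑ xs f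
∑-*ˡ []       c f = sym (ℤ.*-zeroʳ c)
∑-*ˡ (x ∷ xs) c f = trans (cong (ℤ._+_ (c ℤ.* f x)) (∑-*ˡ xs c f)) (sym (ℤ.*-distribˡ-+ c (f x) (∑ xs f)))

∑-*ʳ : ∀ (xs : List A) c (f : A → ℤ) → ∑ xs (λ x → f x ℤ.* c) ≡ ∑ xs f ℤ.* c
∑-*ʳ xs c f = trans (∑-cong xs (λ {x} _ → ℤ.*-comm (f x) c)) (trans (∑-*ˡ xs c f) (ℤ.*-comm c (∑ xs f)))

∑-const : ∀ (xs : List A) c → ∑ xs (λ _ → c) ≡ pos (length xs) ℤ.* c
∑-const []       c = sym (ℤ.*-zeroˡ c)
∑-const (x ∷ xs) c = trans (cong (ℤ._+_ c) (∑-const xs c)) (sym (ℤ.suc-* (pos (length xs)) c))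

∑-zero : ∀ (xs : List A) → ∑ xs (λ _ → 0ℤ) ≡ 0ℤ
∑-zero xs = trans (∑-const xs 0ℤ) (ℤ.*-zeroʳ (pos (length xs)))

∑-swap : ∀ (xs : List A) (ys : List B) (f : A → B → ℤ) →
         ∑ xs (λ x → ∑ ys (f x)) ≡ ∑ ys (λ y → ∑ xs (λ x → f x y))
∑-swap []       ys f = sym (∑-zero ys)
∑-swap (x ∷ xs) ys f = trans (cong (ℤ._+_ (∑ ys (f x))) (∑-swap xs ys f))
                             (sym (∑-+ ys (f x) (λ y → ∑ xs (λ x → f x y))))

∑-mono : ∀ (xs : List A) {f g : A → ℤ} → (∀ {x} → x ∈ xs → f x ℤ.≤ g x) → ∑ xs f ℤ.≤ ∑ xs g
∑-mono []       f≤g = ℤ.≤-refl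
∑-mono (x ∷ xs) f≤g = ℤ.+-mono-≤ (f≤g (here refl)) (∑-mono xs (f≤g ∘ there))

∑-nonneg : ∀ (xs : List A) {f : A → ℤ} → (∀ x → 0ℤ ℤ.≤ f x) → 0ℤ ℤ.≤ ∑ xs f
∑-nonneg []       0≤f = ℤ.≤-refl
∑-nonneg (x ∷ xs) 0≤f = ℤ.+-mono-≤ (0≤f x) (∑-nonneg xs 0≤f)

𝟙 : ∀ {P : Set} → Dec P → ℤ
𝟙 (yes _) = 1ℤ
𝟙 (no _)  = 0ℤ

∑-𝟙 : ∀ {P : A → Set} (P? : ∀ x → Dec (P x)) (xs : List A) → ∑ xs (λ x → 𝟙 (P? x)) ≡ pos (length (filter P? xs))
∑-𝟙 P? []       = refl
∑-𝟙 P? (x ∷ xs) with P? x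
... | yes _ = trans (cong (ℤ._+_ 1ℤ) (∑-𝟙 P? xs)) refl
... | no _  = trans (ℤ.+-identityˡ _) (∑-𝟙 P? xs)

∑-filter-≤ : ∀ {P : A → Set} (P? : ∀ x → Dec (P x)) (xs : List A) {f : A → ℤ} → (∀ x → 0ℤ ℤ.≤ f x) →
             ∑ (filter P? xs) f ℤ.≤ ∑ xs f
∑-filter-≤ P? []       0≤f = ℤ.≤-refl
∑-filter-≤ P? (x ∷ xs) {f} 0≤f with P? x
... | yes _ = ℤ.+-monoʳ-≤ (f x) (∑-filter-≤ P? xs 0≤f)
... | no _  = ℤ.≤-trans (∑-filter-≤ P? xs 0≤f)
                (subst (ℤ._≤ f x ℤ.+ ∑ xs f) (ℤ.+-identityˡ _) (ℤ.+-monoˡ-≤ (∑ xs f) (0≤f x)))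

∑-single : (_≟_ : DecidableEquality A) {xs : List A} → Unique xs → ∀ {a} → a ∈ xs →
           ∑ xs (λ x → 𝟙 (x ≟ a)) ≡ 1ℤ
∑-single _≟_ {x ∷ xs} (x∉ ∷ ux) {a} (here refl) with a ≟ a
... | no a≢a = contradiction refl a≢a
... | yes _  = trans (cong (ℤ._+_ 1ℤ) (trans (∑-cong xs (λ y∈ → vanishes y∈)) (∑-zero xs))) refl
  where
  vanishes : ∀ {y} → y ∈ xs → 𝟙 (y ≟ a) ≡ 0ℤ
  vanishes {y} y∈ with y ≟ a
  ... | no _     = refl
  ... | yes refl = contradiction refl (All.lookup x∉ y∈)
∑-single _≟_ {x ∷ xs} (x∉ ∷ ux) {a} (there a∈) with x ≟ a
... | yes refl = contradiction refl (All.lookup x∉ a∈)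
... | no _     = trans (ℤ.+-identityˡ _) (∑-single _≟_ ux a∈)

-- The elements are given as a list, so that sums over the field, counts of roots and searches for
-- an element are all operations on lists.
record FiniteField : Set₁ where
  infixl 6 _+_
  infixl 7 _*_
  field
    Carrier           : Set
    _+_ _*_           : Op₂ Carrier
    -_                : Op₁ Carrier
    0# 1#             : Carrier
    isCommutativeRing : IsCommutativeRing _≡_ _+_ _*_ -_ 0# 1#
    _≟_               : DecidableEquality Carrier
    1≢0               : 1# ≢ 0#
    invert            : ∀ x → x ≢ 0# → Σ Carrier λ y → x * y ≡ 1#
    elements          : List Carrier
    elements-unique   : Unique elements
    ∈-elements        : ∀ x → x ∈ elements

module FieldProperties (𝔽 : FiniteField) where

  open FiniteField 𝔽 public using (Carrier; -_; _≟_; 1≢0; invert; elements; elements-unique; ∈-elements)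

  commutativeRing : CommutativeRing 0ℓ 0ℓ
  commutativeRing = record { isCommutativeRing = FiniteField.isCommutativeRing 𝔽 }

  open CommutativeRing commutativeRing public
    hiding (Carrier; _≈_; refl; sym; trans; reflexive; setoid; isEquivalence; -_; _-_)
  open RingProperties ring public
    using (-‿distribˡ-*; -‿distribʳ-*)
  open AbelianGroupProperties +-abelianGroup public
    using (//-rightDividesʳ; //-rightDividesˡ; x∙y⁻¹≈ε⇒x≈y; ⁻¹-∙-comm; ⁻¹-involutive; ε⁻¹≈ε; inverseˡ-unique)
  open Exp commutativeSemiring public using (_^_; ^-homo-*; ^-assocʳ; ^-distrib-*)

  infixl 6 _−_
  _−_ : Op₂ Carrier
  x − y = x + (- y)

  *-distribˡ-− : ∀ x y z → x * (y − z) ≡ x * y − x * z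
  *-distribˡ-− x y z = trans (distribˡ x y (- z)) (cong (_+_ (x * y)) (sym (-‿distribʳ-* x z)))

  −-swap : ∀ x y → - (x − y) ≡ y − x
  −-swap x y = trans (sym (⁻¹-∙-comm x (- y))) (trans (+-comm (- x) (- (- y))) (cong (_− x) (⁻¹-involutive y)))

  x≢y⇒x−y≢0 : ∀ {x y} → x ≢ y → x − y ≢ 0#
  x≢y⇒x−y≢0 x≢y eq = x≢y (x∙y⁻¹≈ε⇒x≈y _ _ eq)

  *-cancelˡ-nonzero : ∀ {a} → a ≢ 0# → ∀ {x y} → a * x ≡ a * y → x ≡ y
  *-cancelˡ-nonzero {a} a≢0 {x} {y} eq = trans (sym (undo x)) (trans (cong (b *_) eq) (undo y))
    where
    b = proj₁ (invert a a≢0)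
    undo : ∀ z → b * (a * z) ≡ z
    undo z = begin
      b * (a * z) ≡⟨ sym (*-assoc b a z) ⟩
      (b * a) * z ≡⟨ cong (_* z) (trans (*-comm b a) (proj₂ (invert a a≢0))) ⟩
      1# * z      ≡⟨ *-identityˡ z ⟩
      z           ∎
      where open ≡-Reasoning

  *-nonzero : ∀ {a b} → a ≢ 0# → b ≢ 0# → a * b ≢ 0#
  *-nonzero {a} a≢0 b≢0 eq = b≢0 (*-cancelˡ-nonzero a≢0 (trans eq (sym (zeroʳ a))))

  factor-nonzeroˡ : ∀ {a b} → a * b ≢ 0# → a ≢ 0#
  factor-nonzeroˡ {b = b} ab≢0 refl = ab≢0 (zeroˡ b)

  1^n≡1 : ∀ n → 1# ^ n ≡ 1#
  1^n≡1 zero    = refl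
  1^n≡1 (suc n) = trans (*-identityˡ (1# ^ n)) (1^n≡1 n)

  ^-nonzero : ∀ {a} n → a ≢ 0# → a ^ n ≢ 0#
  ^-nonzero zero    a≢0 = 1≢0
  ^-nonzero (suc n) a≢0 = *-nonzero a≢0 (^-nonzero n a≢0)

  0^n≡0 : ∀ n .{{_ : NonZero n}} → 0# ^ n ≡ 0#
  0^n≡0 (suc n) = zeroˡ (0# ^ n)

  ^-2* : ∀ x n → x ^ (2 ℕ.* n) ≡ x ^ n * x ^ n
  ^-2* x n = trans (^-homo-* x n (n ℕ.+ 0)) (cong (λ m → x ^ n * x ^ m) (ℕ.+-identityʳ n))

  -1^2n≡1 : ∀ n → (- 1#) ^ (2 ℕ.* n) ≡ 1#
  -1^2n≡1 n = begin
    (- 1#) ^ (2 ℕ.* n)      ≡⟨ ^-2* (- 1#) n ⟩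
    (- 1#) ^ n * (- 1#) ^ n ≡⟨ sym (^-distrib-* (- 1#) (- 1#) n) ⟩
    ((- 1#) * (- 1#)) ^ n   ≡⟨ cong (_^ n) (begin
        (- 1#) * (- 1#) ≡⟨ sym (-‿distribˡ-* 1# (- 1#)) ⟩
        - (1# * (- 1#)) ≡⟨ cong -_ (*-identityˡ (- 1#)) ⟩
        - (- 1#)        ≡⟨ ⁻¹-involutive 1# ⟩
        1#              ∎) ⟩
    1# ^ n                  ≡⟨ 1^n≡1 n ⟩
    1#                      ∎
    where open ≡-Reasoning

  -- The monic polynomial a₀ + a₁ x + … + aₙ₋₁ xⁿ⁻¹ + xⁿ is given by its vector of lower coefficients.
  eval : ∀ {n} → Vec Carrier n → Carrier → Carrier
  eval []       x = 1#
  eval (a ∷ as) x = a + x * eval as x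

  quotient : ∀ {n} → Vec Carrier (suc n) → Carrier → Vec Carrier n
  quotient {zero}  (a ∷ []) r = []
  quotient {suc n} (a ∷ as) r = eval as r ∷ quotient as r

  -- The factorisation p(x) − p(r) = (x − r) q(x), rearranged to avoid subtraction.
  eval-quotient : ∀ {n} (as : Vec Carrier (suc n)) r x →
                  eval as x + r * eval (quotient as r) x ≡ eval as r + x * eval (quotient as r) x
  eval-quotient {zero} (a ∷ []) r x = begin
    (a + x * 1#) + r * 1# ≡⟨ +-assoc a (x * 1#) (r * 1#) ⟩
    a + (x * 1# + r * 1#) ≡⟨ cong (a +_) (+-comm (x * 1#) (r * 1#)) ⟩
    a + (r * 1# + x * 1#) ≡⟨ sym (+-assoc a (r * 1#) (x * 1#)) ⟩
    (a + r * 1#) + x * 1# ∎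
    where open ≡-Reasoning
  eval-quotient {suc n} (a ∷ as) r x = begin
    (a + x * ex) + r * (er + x * qx)      ≡⟨ +-assoc a _ _ ⟩
    a + (x * ex + r * (er + x * qx))      ≡⟨ cong (λ z → a + (x * ex + z)) (distribˡ r er (x * qx)) ⟩
    a + (x * ex + (r * er + r * (x * qx))) ≡⟨ cong (a +_) (begin
        x * ex + (r * er + r * (x * qx)) ≡⟨ sym (+-assoc _ _ _) ⟩
        (x * ex + r * er) + r * (x * qx) ≡⟨ cong (_+ (r * (x * qx))) (+-comm _ _) ⟩
        (r * er + x * ex) + r * (x * qx) ≡⟨ +-assoc _ _ _ ⟩
        r * er + (x * ex + r * (x * qx)) ≡⟨ cong (λ z → r * er + (x * ex + z)) (begin
            r * (x * qx) ≡⟨ sym (*-assoc r x qx) ⟩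
            (r * x) * qx ≡⟨ cong (_* qx) (*-comm r x) ⟩
            (x * r) * qx ≡⟨ *-assoc x r qx ⟩
            x * (r * qx) ∎) ⟩
        r * er + (x * ex + x * (r * qx)) ≡⟨ cong (_+_ (r * er)) (sym (distribˡ x ex (r * qx))) ⟩
        r * er + x * (ex + r * qx)       ≡⟨ cong (λ z → r * er + x * z) (eval-quotient as r x) ⟩
        r * er + x * (er + x * qx)       ∎) ⟩
    a + (r * er + x * (er + x * qx))      ≡⟨ sym (+-assoc a _ _) ⟩
    (a + r * er) + x * (er + x * qx)      ∎
    where
    open ≡-Reasoning
    ex = eval as x
    er = eval as r
    qx = eval (quotient as r) x

  length-roots : ∀ {n} (as : Vec Carrier n) {rs} → Unique rs → All (λ r → eval as r ≡ 0#) rs →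
                 length rs ℕ.≤ n
  length-roots         as       {[]}     _         _          = z≤n
  length-roots {zero}  []       {r ∷ rs} _         (root ∷ _) = contradiction root 1≢0
  length-roots {suc n} as       {r ∷ rs} (r∉ ∷ ur) (root ∷ roots) =
    s≤s (length-roots (quotient as r) ur (All.zipWith (λ (r≢x , x-root) → quotient-root r≢x x-root) (r∉ , roots)))
    where
    quotient-root : ∀ {x} → r ≢ x → eval as x ≡ 0# → eval (quotient as r) x ≡ 0#
    quotient-root {x} r≢x x-root with eval (quotient as r) x ≟ 0#
    ... | yes qx≡0 = qx≡0
    ... | no qx≢0  = contradiction (*-cancelˡ-nonzero qx≢0 (begin
        qx * r ≡⟨ *-comm qx r ⟩
        r * qx ≡⟨ sym (trans (cong (_+ (r * qx)) x-root) (+-identityˡ (r * qx))) ⟩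
        eval as x + r * qx ≡⟨ eval-quotient as r x ⟩
        eval as r + x * qx ≡⟨ trans (cong (_+ (x * qx)) root) (+-identityˡ (x * qx)) ⟩
        x * qx ≡⟨ *-comm x qx ⟩
        qx * x ∎)) r≢x
      where
      open ≡-Reasoning
      qx = eval (quotient as r) x

  eval-zeros : ∀ n x → eval (Vec.replicate n 0#) x ≡ x ^ n
  eval-zeros zero    x = refl
  eval-zeros (suc n) x = trans (+-identityˡ _) (cong (x *_) (eval-zeros n x))

  length-power-roots : ∀ n .{{_ : NonZero n}} c {rs} → Unique rs → All (λ r → r ^ n ≡ c) rs → length rs ℕ.≤ n
  length-power-roots (suc n) c ur powers = length-roots ((- c) ∷ Vec.replicate n 0#) ur (All.map root powers)
    where
    root : ∀ {r} → r ^ suc n ≡ c → (- c) + r * eval (Vec.replicate n 0#) r ≡ 0#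
    root {r} eq = trans (cong (λ z → (- c) + r * z) (eval-zeros n r)) (trans (cong ((- c) +_) eq) (-‿inverseˡ c))

  nonzero? : ∀ x → Dec (x ≢ 0#)
  nonzero? x = ¬? (x ≟ 0#)

  units : List Carrier
  units = filter nonzero? elements

  units-unique : Unique units
  units-unique = Unique.filter⁺ nonzero? elements-unique

  ∈-units : ∀ {x} → x ≢ 0# → x ∈ units
  ∈-units x≢0 = ∈-filter⁺ nonzero? (∈-elements _) x≢0

  units-nonzero : ∀ {x} → x ∈ units → x ≢ 0#
  units-nonzero x∈ = proj₂ (∈-filter⁻ nonzero? {xs = elements} x∈)

  ∏ : List Carrier → Carrier
  ∏ = foldr _*_ 1#

  ∏-map-* : ∀ a xs → ∏ (map (a *_) xs) ≡ a ^ length xs * ∏ xs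
  ∏-map-* a []       = sym (*-identityˡ 1#)
  ∏-map-* a (x ∷ xs) = begin
    (a * x) * ∏ (map (a *_) xs)       ≡⟨ cong ((a * x) *_) (∏-map-* a xs) ⟩
    (a * x) * (a ^ length xs * ∏ xs)  ≡⟨ *-assoc a x _ ⟩
    a * (x * (a ^ length xs * ∏ xs))  ≡⟨ cong (a *_) (sym (*-assoc x _ _)) ⟩
    a * ((x * a ^ length xs) * ∏ xs)  ≡⟨ cong (λ z → a * (z * ∏ xs)) (*-comm x _) ⟩
    a * ((a ^ length xs * x) * ∏ xs)  ≡⟨ cong (a *_) (*-assoc _ x _) ⟩
    a * (a ^ length xs * (x * ∏ xs))  ≡⟨ sym (*-assoc a _ _) ⟩
    (a * a ^ length xs) * (x * ∏ xs)  ∎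
    where open ≡-Reasoning

  ∏-nonzero : ∀ xs → (∀ {x} → x ∈ xs → x ≢ 0#) → ∏ xs ≢ 0#
  ∏-nonzero []       _   = 1≢0
  ∏-nonzero (x ∷ xs) all = *-nonzero (all (here refl)) (∏-nonzero xs (all ∘ there))

  -- Multiplication by a permutes the units, so their product P satisfies a ^ n * P = P, where n is
  -- their number, and P can be cancelled.
  ^-length-units : ∀ {a} → a ≢ 0# → a ^ length units ≡ 1#
  ^-length-units {a} a≢0 = *-cancelˡ-nonzero (∏-nonzero units units-nonzero) (begin
    ∏ units * a ^ length units ≡⟨ *-comm _ _ ⟩
    a ^ length units * ∏ units ≡⟨ sym (∏-map-* a units) ⟩
    ∏ (map (a *_) units)       ≡⟨ ↭ₛ.foldr-commMonoid M.setoid M.isCommutativeMonoid (↭⇒↭ₛ permuted) ⟩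
    ∏ units                    ≡⟨ sym (*-identityʳ _) ⟩
    ∏ units * 1#               ∎)
    where
    open ≡-Reasoning
    module M = CommutativeMonoid *-commutativeMonoid

    permuted : map (a *_) units ↭ units
    permuted = unique-↭ (Unique.map⁺ (*-cancelˡ-nonzero a≢0) units-unique) units-unique
      (λ x∈ → let y , y∈ , eq = ∈-map⁻ (a *_) x∈
              in subst (_∈ units) (sym eq) (∈-units (*-nonzero a≢0 (units-nonzero y∈))))
      (λ {x} x∈ → let b , ab≡1 = invert a a≢0
                      a[bx]≡x = trans (sym (*-assoc a b x)) (trans (cong (_* x) ab≡1) (*-identityˡ x))
                  in subst (_∈ map (a *_) units) a[bx]≡x
                       (∈-map⁺ (a *_) (∈-units λ bx≡0 →
                         units-nonzero x∈ (trans (sym a[bx]≡x) (trans (cong (a *_) bx≡0) (zeroʳ a))))))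

  elements-↭ : elements ↭ (0# ∷ units)
  elements-↭ = unique-↭ elements-unique
    (All.tabulate (λ x∈ 0≡x → units-nonzero x∈ (sym 0≡x)) ∷ units-unique)
    (λ {x} _ → split x (x ≟ 0#)) (λ _ → ∈-elements _)
    where
    split : ∀ x → Dec (x ≡ 0#) → x ∈ 0# ∷ units
    split x (yes refl) = here refl
    split x (no x≢0)   = there (∈-units x≢0)

  ∑-reindex : ∀ (σ τ : Carrier → Carrier) → (∀ x → σ (τ x) ≡ x) → (∀ x → τ (σ x) ≡ x) →
              ∀ f → ∑ elements (f ∘ σ) ≡ ∑ elements f
  ∑-reindex σ τ στ τσ f = trans (sym (∑-map σ elements f)) (∑-↭ f (unique-↭
    (Unique.map⁺ (λ {x} {y} eq → trans (sym (τσ x)) (trans (cong τ eq) (τσ y))) elements-unique)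
    elements-unique (λ _ → ∈-elements _)
    (λ {x} _ → subst (_∈ map σ elements) (στ x) (∈-map⁺ σ (∈-elements (τ x))))))

  length-elements-units : length elements ≡ suc (length units)
  length-elements-units = ↭-length elements-↭

  -- Otherwise all units would be roots of Xⁿ - 1, more than its degree allows. Such an element
  -- takes the place of a primitive root everywhere below.
  nonroot : ∀ n .{{_ : NonZero n}} → n ℕ.< length units → Σ Carrier λ x → x ≢ 0# × x ^ n ≢ 1#
  nonroot n n< with Any.any? (λ x → ¬? ((x ^ n) ≟ 1#)) units
  ... | yes found = let x , x∈ , xⁿ≢1 = find found in x , units-nonzero x∈ , xⁿ≢1
  ... | no none   = contradiction
    (length-power-roots n 1# units-unique
      (All.tabulate λ {x} x∈ → decidable-stable ((x ^ n) ≟ 1#) λ neq → none (lose x∈ neq)))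
    (ℕ.<⇒≱ n<)

-- Biquadratic classes

<⇒<ᵇ≡true : ∀ {m n} → m < n → (m <ᵇ n) ≡ true
<⇒<ᵇ≡true m<n = Equivalence.to T-≡ (ℕ.<⇒<ᵇ m<n)

≮⇒<ᵇ≡false : ∀ {m n} → ¬ m < n → (m <ᵇ n) ≡ false
≮⇒<ᵇ≡false {m} {n} m≮n with m <ᵇ n in eq
... | true  = contradiction (ℕ.<ᵇ⇒< m n (Equivalence.from T-≡ eq)) m≮n
... | false = refl

not-xor : ∀ b → not b xor b ≡ true
not-xor false = refl
not-xor true  = refl

module Scalings (𝔽 : FiniteField) where

  open FieldProperties 𝔽

  additive : Ab Carrier _+_
  additive = record { isAbelianGroup = +-isAbelianGroup ; _≟_ = _≟_ }

  *-hits : ∀ {a} → a ≢ 0# → HitsOnce (a *_)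
  *-hits {a} a≢0 y =
    let b , ab≡1 = invert a a≢0
        aby≡y = trans (sym (*-assoc a b y)) (trans (cong (_* y) ab≡1) (*-identityˡ y))
    in b * y , aby≡y , λ x ax≡y → *-cancelˡ-nonzero a≢0 (trans aby≡y (sym ax≡y))

  scalings : ∀ {c : Fin 4 → Carrier} → (∀ j → c j ≢ 0#) → (∀ {i j} → c i ≡ c j → i ≡ j) → Multipliers additive
  scalings {c} c≢0 c-injective = record
    { scale           = λ i x → c i * x
    ; scale-hits      = λ i → *-hits (c≢0 i)
    ; difference-hits = λ {i} {j} i≢j y →
        let x , eq , unique = *-hits (x≢y⇒x−y≢0 (λ ci≡cj → i≢j (c-injective ci≡cj))) y
        in x , trans (factor i j x) eq , λ x′ eq′ → unique x′ (trans (sym (factor i j x′)) eq′)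
    }
    where
    factor : ∀ i j x → c i * x − c j * x ≡ (c i − c j) * x
    factor i j x = sym (trans (distribʳ x (c i) (- c j)) (cong (_+_ (c i * x)) (sym (-‿distribˡ-* (c j) x))))

module Classes (𝔽 : FiniteField) (k : ℕ) {{k≢0 : NonZero k}} (size : length (FieldProperties.units 𝔽) ≡ 8 ℕ.* k) where

  open FieldProperties 𝔽
  open Scalings 𝔽

  h : ℕ
  h = 2 ℕ.* k

  instance
    h≢0 : NonZero h
    h≢0 = ℕ.m*n≢0 2 k

    2h≢0 : NonZero (2 ℕ.* h)
    2h≢0 = ℕ.m*n≢0 2 h

  -- The biquadratic residue character, since h = (q − 1) / 4 for q = 8 k + 1.
  cl : Carrier → Carrier
  cl x = x ^ h

  cl-* : ∀ x y → cl (x * y) ≡ cl x * cl y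
  cl-* x y = ^-distrib-* x y h

  cl-1 : cl 1# ≡ 1#
  cl-1 = 1^n≡1 h

  cl-0 : cl 0# ≡ 0#
  cl-0 = 0^n≡0 h

  cl-nonzero : ∀ {x} → x ≢ 0# → cl x ≢ 0#
  cl-nonzero = ^-nonzero h

  -x≡-1*x : ∀ x → - x ≡ (- 1#) * x
  -x≡-1*x x = trans (cong -_ (sym (*-identityˡ x))) (-‿distribˡ-* 1# x)

  -- Here q ≡ 1 mod 8, rather than only mod 4, is used: the exponent h = 2k is even, so -1 is a
  -- biquadratic residue.
  cl-neg : ∀ x → cl (- x) ≡ cl x
  cl-neg x = begin
    cl (- x)          ≡⟨ cong cl (-x≡-1*x x) ⟩
    cl ((- 1#) * x)   ≡⟨ cl-* (- 1#) x ⟩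
    cl (- 1#) * cl x  ≡⟨ cong (_* cl x) (-1^2n≡1 k) ⟩
    1# * cl x         ≡⟨ *-identityˡ (cl x) ⟩
    cl x              ∎
    where open ≡-Reasoning

  cl^4 : ∀ {x} → x ≢ 0# → cl x ^ 4 ≡ 1#
  cl^4 {x} x≢0 = begin
    cl x ^ 4         ≡⟨ ^-assocʳ x h 4 ⟩
    x ^ (h ℕ.* 4)    ≡⟨ cong (x ^_) (trans (ℕ.*-comm h 4) (trans (sym (ℕ.*-assoc 4 2 k)) (sym size))) ⟩
    x ^ length units ≡⟨ ^-length-units x≢0 ⟩
    1#               ∎
    where open ≡-Reasoning

  2h<size : 2 ℕ.* h < length units
  2h<size = subst₂ _<_ (ℕ.*-assoc 2 2 k) (sym size) (ℕ.*-monoˡ-< k {4} {8} (s≤s (s≤s (s≤s (s≤s (s≤s z≤n))))))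

  square≡1 : ∀ {y} → y * y ≡ 1# → y ≢ 1# → y ≡ - 1#
  square≡1 {y} yy≡1 y≢1 with (1# + y) ≟ 0#
  ... | yes 1+y≡0 = inverseˡ-unique y 1# (trans (+-comm y 1#) 1+y≡0)
  ... | no 1+y≢0  = contradiction (*-cancelˡ-nonzero 1+y≢0 (begin
      (1# + y) * y     ≡⟨ distribʳ y 1# y ⟩
      1# * y + y * y   ≡⟨ cong₂ _+_ (*-identityˡ y) yy≡1 ⟩
      y + 1#           ≡⟨ +-comm y 1# ⟩
      1# + y           ≡⟨ sym (*-identityʳ _) ⟩
      (1# + y) * 1#    ∎)) y≢1
    where open ≡-Reasoning

  opaque
    nonresidue : Σ Carrier λ x → x ≢ 0# × cl x * cl x ≢ 1#
    nonresidue = let x , x≢0 , x^2h≢1 = nonroot (2 ℕ.* h) 2h<size in x , x≢0 , λ eq → x^2h≢1 (trans (^-2* x h) eq)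

  -- The character at a nonsquare. From ι⁴ = 1 and ι² ≠ 1 it follows that ι² = -1, so ι is a
  -- primitive fourth root of unity.
  ι : Carrier
  ι = cl (proj₁ nonresidue)

  ι^4≡1 : ι ^ 4 ≡ 1#
  ι^4≡1 = cl^4 (proj₁ (proj₂ nonresidue))

  ι²≡-1 : ι * ι ≡ - 1#
  ι²≡-1 = square≡1 (trans (trans (*-assoc ι ι (ι * ι)) (cong (λ z → ι * (ι * (ι * z))) (sym (*-identityʳ ι)))) ι^4≡1)
                   (proj₂ (proj₂ nonresidue))

  -1≢1 : - 1# ≢ 1#
  -1≢1 eq = proj₂ (proj₂ nonresidue) (trans ι²≡-1 eq)

  x≢-x : ∀ {x} → x ≢ 0# → x ≢ - x
  x≢-x {x} x≢0 eq = -1≢1 (*-cancelˡ-nonzero x≢0 (begin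
    x * (- 1#) ≡⟨ trans (*-comm x (- 1#)) (sym (-x≡-1*x x)) ⟩
    - x        ≡⟨ sym eq ⟩
    x          ≡⟨ sym (*-identityʳ x) ⟩
    x * 1#     ∎))
    where open ≡-Reasoning

  position : Carrier → ℕ
  position x = toℕ (Any.index (∈-elements x))

  position-injective : ∀ {x y} → position x ≡ position y → x ≡ y
  position-injective {x} {y} eq = trans (lookup-index (∈-elements x))
    (trans (cong (lookup elements) (Fin.toℕ-injective eq)) (sym (lookup-index (∈-elements y))))

  -- Selects one of x and - x.
  positive : Carrier → Bool
  positive x = position x <ᵇ position (- x)

  -- Since -1 ≠ 1, the elements x and -x stand at different positions, so exactly one of the two
  -- comparisons holds.
  positive-neg : ∀ {x} → x ≢ 0# → positive (- x) ≡ not (positive x)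
  positive-neg {x} x≢0 rewrite ⁻¹-involutive x with ℕ.<-cmp (position x) (position (- x))
  ... | tri< lt _ gt≮ rewrite <⇒<ᵇ≡true lt | ≮⇒<ᵇ≡false gt≮ = refl
  ... | tri≈ _ eq _   = contradiction (position-injective eq) (x≢-x x≢0)
  ... | tri> lt≮ _ gt rewrite <⇒<ᵇ≡true gt | ≮⇒<ᵇ≡false lt≮ = refl

  Multiplier : Set
  Multiplier = Σ Carrier λ m → cl m ≡ 1# × positive m ≡ true

  multiplier-≡ : ∀ {m n : Multiplier} → proj₁ m ≡ proj₁ n → m ≡ n
  multiplier-≡ {_ , p , q} {_ , p′ , q′} refl = cong₂ (λ p q → _ , p , q) (uip p p′) (uip q q′)
    where
    uip : ∀ {A : Set} {x y : A} (p q : x ≡ y) → p ≡ q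
    uip refl refl = refl

  signed : Bool → Carrier → Carrier
  signed false x = x
  signed true  x = - x

  signed-* : ∀ s x y → signed s (x * y) ≡ signed s x * y
  signed-* false x y = refl
  signed-* true  x y = -‿distribˡ-* x y

  signed-involutive : ∀ s x → signed s (signed s x) ≡ x
  signed-involutive false x = refl
  signed-involutive true  x = ⁻¹-involutive x

  cl-signed : ∀ s x → cl (signed s x) ≡ cl x
  cl-signed false x = refl
  cl-signed true  x = cl-neg x

  positive-signed : ∀ s {x} → x ≢ 0# → positive (signed s x) ≡ s xor positive x
  positive-signed false x≢0 = refl
  positive-signed true  x≢0 = positive-neg x≢0

  index-≡ : ∀ {m n : Multiplier} {s t : Bool} {i j : Fin 4} → s ≡ t → i ≡ j → proj₁ m ≡ proj₁ n →
            (m , (s , i)) ≡ (n , (t , j))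
  index-≡ refl refl eq = cong (_, _) (multiplier-≡ eq)

  spread : (Fin 4 → Carrier) → Multiplier × Slot → Carrier
  spread e ((m , _) , (s , j)) = signed s (m * e j)

  record Transversal (e : Fin 4 → Carrier) : Set where
    field
      nonzero  : ∀ j → e j ≢ 0#
      distinct : ∀ {i j} → cl (e i) ≡ cl (e j) → i ≡ j

    -- The four characters of e already are four roots of X⁴ - 1, which leaves no room for a fifth.
    class : ∀ {x} → x ≢ 0# → Σ (Fin 4) λ j → cl x ≡ cl (e j)
    class {x} x≢0 with Fin.any? (λ j → cl x ≟ cl (e j))
    ... | yes found = found
    ... | no none   = contradiction (length-power-roots 4 1# unique
                        (cl^4 x≢0 ∷ root 0F ∷ root 1F ∷ root 2F ∷ root 3F ∷ []))
                        ℕ.1+n≰n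
      where
      root : ∀ j → cl (e j) ^ 4 ≡ 1#
      root j = cl^4 (nonzero j)
      new : ∀ j → cl x ≢ cl (e j)
      new j eq = none (j , eq)
      apart : ∀ i j → i ≢ j → cl (e i) ≢ cl (e j)
      apart i j i≢j eq = i≢j (distinct eq)
      unique : Unique (cl x ∷ cl (e 0F) ∷ cl (e 1F) ∷ cl (e 2F) ∷ cl (e 3F) ∷ [])
      unique = (new 0F ∷ new 1F ∷ new 2F ∷ new 3F ∷ [])
             ∷ (apart 0F 1F (λ ()) ∷ apart 0F 2F (λ ()) ∷ apart 0F 3F (λ ()) ∷ [])
             ∷ (apart 1F 2F (λ ()) ∷ apart 1F 3F (λ ()) ∷ [])
             ∷ (apart 2F 3F (λ ()) ∷ []) ∷ [] ∷ []

    -- In x = ±m e_j the class of x determines j. Then x / e_j is a biquadratic residue, and so is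
    -- its negative; exactly one of the two is `positive`, which determines m and the sign.
    spread-hits : HitsOnceExcept 0# (spread e)
    spread-hits .avoids ((m , cl-m , _) , (s , j)) eq =
      cl-nonzero (nonzero j) (begin
        cl (e j)                ≡⟨ sym (*-identityˡ _) ⟩
        1# * cl (e j)           ≡⟨ cong (_* cl (e j)) (sym cl-m) ⟩
        cl m * cl (e j)         ≡⟨ sym (cl-* m (e j)) ⟩
        cl (m * e j)            ≡⟨ sym (cl-signed s (m * e j)) ⟩
        cl (signed s (m * e j)) ≡⟨ cong cl eq ⟩
        cl 0#                   ≡⟨ cl-0 ⟩
        0#                      ∎)
      where open ≡-Reasoning
    spread-hits .hits x x≢0 = found (positive m₀) refl
      where
      open ≡-Reasoning
      j₀ = proj₁ (class x≢0)
      inverse = invert (e j₀) (nonzero j₀)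
      m₀ = x * proj₁ inverse

      m₀e≡x : m₀ * e j₀ ≡ x
      m₀e≡x = trans (*-assoc x _ _)
        (trans (cong (x *_) (trans (*-comm _ (e j₀)) (proj₂ inverse))) (*-identityʳ x))

      cl-m₀ : cl m₀ ≡ 1#
      cl-m₀ = *-cancelˡ-nonzero (cl-nonzero (nonzero j₀)) (begin
        cl (e j₀) * cl m₀ ≡⟨ trans (*-comm _ _) (sym (cl-* m₀ (e j₀))) ⟩
        cl (m₀ * e j₀)    ≡⟨ cong cl m₀e≡x ⟩
        cl x              ≡⟨ proj₂ (class x≢0) ⟩
        cl (e j₀)         ≡⟨ sym (*-identityʳ _) ⟩
        cl (e j₀) * 1#    ∎)

      m₀≢0 : m₀ ≢ 0#
      m₀≢0 eq = x≢0 (trans (sym m₀e≡x) (trans (cong (_* e j₀) eq) (zeroˡ (e j₀))))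

      module _ {m s j} {cl-m : cl m ≡ 1#} {pos-m : positive m ≡ true} (eq : signed s (m * e j) ≡ x) where

        same-class : j₀ ≡ j
        same-class = distinct (begin
          cl (e j₀)               ≡⟨ sym (proj₂ (class x≢0)) ⟩
          cl x                    ≡⟨ cong cl (sym eq) ⟩
          cl (signed s (m * e j)) ≡⟨ cl-signed s (m * e j) ⟩
          cl (m * e j)            ≡⟨ cl-* m (e j) ⟩
          cl m * cl (e j)         ≡⟨ cong (_* cl (e j)) cl-m ⟩
          1# * cl (e j)           ≡⟨ *-identityˡ _ ⟩
          cl (e j)                ∎)

        signed-m≡m₀ : signed s m ≡ m₀
        signed-m≡m₀ = *-cancelˡ-nonzero (nonzero j₀) (begin
          e j₀ * signed s m    ≡⟨ *-comm _ _ ⟩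
          signed s m * e j₀    ≡⟨ sym (signed-* s m (e j₀)) ⟩
          signed s (m * e j₀)  ≡⟨ cong (λ i → signed s (m * e i)) same-class ⟩
          signed s (m * e j)   ≡⟨ trans eq (sym m₀e≡x) ⟩
          m₀ * e j₀            ≡⟨ *-comm _ _ ⟩
          e j₀ * m₀            ∎)

        m≡signed-m₀ : m ≡ signed s m₀
        m≡signed-m₀ = trans (sym (signed-involutive s m)) (cong (signed s) signed-m≡m₀)

        m≢0 : m ≢ 0#
        m≢0 m≡0 = cl-nonzero {1#} 1≢0 (trans cl-1 (trans (sym cl-m) (trans (cong cl m≡0) cl-0)))

        sign : positive m₀ ≡ not s
        sign = trans (cong positive (sym signed-m≡m₀)) (trans (positive-signed s m≢0) (trans (cong (s xor_) pos-m) (xor-comm s true)))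

      found : ∀ b → positive m₀ ≡ b → ∃!′ λ n → spread e n ≡ x
      found b pos-m₀ = ((signed (not b) m₀ , cl-m , pos-m) , (not b , j₀)) , hit ,
        λ ((m , c , p) , (s , j)) eq → index-≡
          (trans (cong not (trans (sym pos-m₀) (sign {m} {s} {j} {c} {p} eq))) (not-involutive s))
          (same-class {m} {s} {j} {c} {p} eq)
          (trans (cong (λ b → signed (not b) m₀) (trans (sym pos-m₀) (sign {m} {s} {j} {c} {p} eq)))
            (trans (cong (λ b → signed b m₀) (not-involutive s)) (sym (m≡signed-m₀ {m} {s} {j} {c} {p} eq))))
        where
        cl-m = trans (cl-signed (not b) m₀) cl-m₀
        pos-m = trans (positive-signed (not b) m₀≢0) (trans (cong (not b xor_) pos-m₀) (not-xor b))
        hit = trans (signed-* (not b) (signed (not b) m₀) (e j₀))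
          (trans (cong (_* e j₀) (signed-involutive (not b) m₀)) m₀e≡x)

  open Transversal

  -- The differences along the edges `forward δ j`, where the pairs are − {a , c} and − {b , d}.
  differencesAlong : (a b c d : Carrier) → Fin 2 → Fin 4 → Carrier
  differencesAlong a b c d 0F 0F = a − b
  differencesAlong a b c d 0F 1F = c − d
  differencesAlong a b c d 0F 2F = a − c
  differencesAlong a b c d 0F 3F = b − d
  differencesAlong a b c d 1F 0F = a − c
  differencesAlong a b c d 1F 1F = a − d
  differencesAlong a b c d 1F 2F = b − c
  differencesAlong a b c d 1F 3F = b − d

  quadruple : (a b c d : Carrier) → Fin 4 → Carrier
  quadruple a b c d 0F = a
  quadruple a b c d 1F = b
  quadruple a b c d 2F = c
  quadruple a b c d 3F = d

  -- The quadruple serves twice: since a, b, c, d lie in different classes, they are also four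
  -- distinct nonzero scalars, as multipliers require.
  nice-field : ∀ a b c d → Transversal (quadruple a b c d) → (∀ δ → Transversal (differencesAlong a b c d δ)) →
               Nice Carrier _+_
  nice-field a b c d T D = record
    { group       = additive
    ; family      = record
      { Unit        = Multiplier
      ; point       = λ u s → spread e (u , s)
      ; points      = spread-hits T
      ; differences = λ δ → HitsOnceExcept-cong (λ ((m , _) , s) → sym (difference δ s m)) (spread-hits (D δ))
      }
    ; multipliers = scalings (nonzero T) (λ eq → distinct T (cong cl eq))
    }
    where
    e = quadruple a b c d
    value : Carrier → Slot → Carrier
    value m (s , j) = signed s (m * e j)

    backward : ∀ m x y → (- (m * y)) − (- (m * x)) ≡ m * (x − y)
    backward m x y = trans (cong (_+_ (- (m * y))) (⁻¹-involutive (m * x)))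
      (trans (+-comm (- (m * y)) (m * x)) (sym (*-distribˡ-− m x y)))

    forward-difference : ∀ δ j m →
      value m (proj₁ (forward δ j)) − value m (proj₂ (forward δ j)) ≡ m * differencesAlong a b c d δ j
    forward-difference 0F 0F m = sym (*-distribˡ-− m a b)
    forward-difference 0F 1F m = sym (*-distribˡ-− m c d)
    forward-difference 0F 2F m = backward m a c
    forward-difference 0F 3F m = backward m b d
    forward-difference 1F 0F m = sym (*-distribˡ-− m a c)
    forward-difference 1F 1F m = sym (*-distribˡ-− m a d)
    forward-difference 1F 2F m = sym (*-distribˡ-− m b c)
    forward-difference 1F 3F m = sym (*-distribˡ-− m b d)

    difference : ∀ δ s m → value m (source δ s) − value m (target δ s) ≡
                 signed (proj₁ s) (m * differencesAlong a b c d δ (proj₂ s))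
    difference δ (inQ j) m = forward-difference δ j m
    difference δ (inP j) m = trans (sym (−-swap _ _)) (cong -_ (forward-difference δ j m))

-- Distribution of differences among the classes

colours : List (Fin 4)
colours = 0F ∷ 1F ∷ 2F ∷ 3F ∷ []

∑-square : ∀ {A : Set} (xs : List A) (f : A → ℤ) → ∑ xs f ℤ.* ∑ xs f ≡ ∑ xs λ x → ∑ xs λ y → f x ℤ.* f y
∑-square xs f = trans (sym (∑-*ʳ xs (∑ xs f) f)) (∑-cong xs λ {x} _ → sym (∑-*ˡ xs (f x) f))

0≤square : ∀ z → 0ℤ ℤ.≤ z ℤ.* z
0≤square (pos n)    = subst (0ℤ ℤ.≤_) (ℤ.pos-* n n) (ℤ.+≤+ ℕ.z≤n)
0≤square (-[1+ n ]) = ℤ.+≤+ ℕ.z≤n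

minimum : ∀ {A : Set} (f : A → ℤ) x xs → Σ A λ m → m ∈ x ∷ xs × (∀ {y} → y ∈ x ∷ xs → f m ℤ.≤ f y)
minimum f x [] = x , here refl , λ { (here refl) → ℤ.≤-refl }
minimum f x (y ∷ ys) with minimum f y ys
... | m , m∈ , least with ℤ.≤-total (f x) (f m)
...   | inj₁ fx≤fm = x , here refl , λ { (here refl) → ℤ.≤-refl ; (there z∈) → ℤ.≤-trans fx≤fm (least z∈) }
  where open import Data.Sum using (inj₁)
...   | inj₂ fm≤fx = m , there m∈ , λ { (here refl) → fm≤fx ; (there z∈) → least z∈ }
  where open import Data.Sum using (inj₂)

below-average : ∀ {A : Set} (f : A → ℤ) xs → 0 ℕ.< length xs →
                Σ A λ m → m ∈ xs × pos (length xs) ℤ.* f m ℤ.≤ ∑ xs f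
below-average f (x ∷ xs) _ =
  let m , m∈ , least = minimum f x xs
  in m , m∈ , subst (ℤ._≤ ∑ (x ∷ xs) f) (∑-const (x ∷ xs) (f m)) (∑-mono (x ∷ xs) least)

module Spectral (𝔽 : FiniteField) (k : ℕ) {{k≢0 : NonZero k}} (size : length (FieldProperties.units 𝔽) ≡ 8 ℕ.* k) where

  open FieldProperties 𝔽
  open Classes 𝔽 k size
  open Transversal

  g : Carrier
  g = proj₁ nonresidue

  g≢0 : g ≢ 0#
  g≢0 = proj₁ (proj₂ nonresidue)

  κ : Fin 4 → Carrier
  κ j = ι ^ toℕ j

  κ-injective : ∀ {i j} → κ i ≡ κ j → i ≡ j
  κ-injective {i} {j} = go i j
    where
    ι≢0 : ι ≢ 0#
    ι≢0 = cl-nonzero g≢0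
    cancel : ∀ m n → ι ^ suc m ≡ ι ^ suc n → ι ^ m ≡ ι ^ n
    cancel m n = *-cancelˡ-nonzero ι≢0
    ι²≢1 : ι ^ 2 ≢ 1#
    ι²≢1 eq = proj₂ (proj₂ nonresidue) (trans (cong (ι *_) (sym (*-identityʳ ι))) eq)
    ι¹≢1 : ι ^ 1 ≢ 1#
    ι¹≢1 eq = ι²≢1 (trans (cong (ι *_) eq) eq)
    ι³≢1 : ι ^ 3 ≢ 1#
    ι³≢1 eq = ι¹≢1 (trans (cong (ι *_) (sym eq)) ι^4≡1)
    go : ∀ i j → κ i ≡ κ j → i ≡ j
    go 0F 0F _  = refl
    go 0F 1F eq = contradiction (sym eq) ι¹≢1
    go 0F 2F eq = contradiction (sym eq) ι²≢1
    go 0F 3F eq = contradiction (sym eq) ι³≢1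
    go 1F 0F eq = contradiction eq ι¹≢1
    go 1F 1F _  = refl
    go 1F 2F eq = contradiction (sym (cancel 0 1 eq)) ι¹≢1
    go 1F 3F eq = contradiction (sym (cancel 0 2 eq)) ι²≢1
    go 2F 0F eq = contradiction eq ι²≢1
    go 2F 1F eq = contradiction (cancel 1 0 eq) ι¹≢1
    go 2F 2F _  = refl
    go 2F 3F eq = contradiction (sym (cancel 0 1 (cancel 1 2 eq))) ι¹≢1
    go 3F 0F eq = contradiction eq ι³≢1
    go 3F 1F eq = contradiction (cancel 2 0 eq) ι²≢1
    go 3F 2F eq = contradiction (cancel 1 0 (cancel 2 1 eq)) ι¹≢1
    go 3F 3F _  = refl

  cl-power : ∀ n → cl (g ^ n) ≡ ι ^ n
  cl-power n = begin
    (g ^ n) ^ h       ≡⟨ ^-assocʳ g n h ⟩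
    g ^ (n ℕ.* h)     ≡⟨ cong (g ^_) (ℕ.*-comm n h) ⟩
    g ^ (h ℕ.* n)     ≡⟨ sym (^-assocʳ g h n) ⟩
    (g ^ h) ^ n       ∎
    where open ≡-Reasoning

  -- By `class` for these four representatives, `κ` lists every value of the character on the units.
  powers : Transversal (λ j → g ^ toℕ j)
  powers .nonzero j = ^-nonzero (toℕ j) g≢0
  powers .distinct {i} {j} eq = κ-injective {i} {j} (trans (sym (cl-power (toℕ i))) (trans eq (cl-power (toℕ j))))

  colour : ∀ {x} → x ≢ 0# → Σ (Fin 4) λ j → cl x ≡ κ j
  colour x≢0 = let j , eq = class powers x≢0 in j , trans eq (cl-power (toℕ j))

  κ≢0 : ∀ j → κ j ≢ 0#
  κ≢0 j = ^-nonzero (toℕ j) (cl-nonzero g≢0)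

  cl≡κ⇒≢0 : ∀ {x} j → cl x ≡ κ j → x ≢ 0#
  cl≡κ⇒≢0 j eq refl = κ≢0 j (trans (sym eq) cl-0)

  transversal : ∀ {e} (π : Fin 4 → Fin 4) → (∀ {i j} → π i ≡ π j → i ≡ j) → (∀ j → cl (e j) ≡ κ (π j)) → Transversal e
  transversal π π-injective eqs .nonzero j = cl≡κ⇒≢0 (π j) (eqs j)
  transversal π π-injective eqs .distinct {i} {j} eq =
    π-injective (κ-injective (trans (sym (eqs i)) (trans eq (eqs j))))

  -- The constant value of `w j` on class i, either 3 or -1; it turns the scalar products in
  -- `weights` into closed computations.
  weight : Fin 4 → Fin 4 → ℤ
  weight i j = pos 4 ℤ.* 𝟙 (i Fin.≟ j) ℤ.- 1ℤ

  -- Four times the indicator of the class κ j, balanced to have sum zero over the units.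
  opaque
    w : Fin 4 → Carrier → ℤ
    w j z = pos 4 ℤ.* 𝟙 (cl z ≟ κ j) ℤ.- 𝟙 (nonzero? z)

    w-0 : ∀ j → w j 0# ≡ 0ℤ
    w-0 j with cl 0# ≟ κ j | nonzero? 0#
    ... | yes eq | _      = contradiction refl (cl≡κ⇒≢0 j eq)
    ... | no _   | yes 0≢0 = contradiction refl 0≢0
    ... | no _   | no _   = refl

    w-colour : ∀ {z} i j → cl z ≡ κ i → w j z ≡ weight i j
    w-colour {z} i j eq with cl z ≟ κ j | nonzero? z | i Fin.≟ j
    ... | _     | no ¬≢0 | _        = contradiction (cl≡κ⇒≢0 i eq) ¬≢0
    ... | yes _ | yes _  | yes _    = refl
    ... | no _  | yes _  | no _     = refl
    ... | yes p | yes _  | no i≢j   = contradiction (κ-injective (trans (sym eq) p)) i≢j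
    ... | no ¬p | yes _  | yes refl = contradiction eq ¬p

  opaque
    -- Equal to 4 times the sum of χ(x) χ̄(y) over the three nontrivial characters χ with χ⁴ = 1,
    -- but written in integers: 12 for units of the same class, -4 for units of different classes,
    -- and 0 if x or y is 0.
    correlation : Carrier → Carrier → ℤ
    correlation x y = ∑ colours λ j → w j x ℤ.* w j y

    correlation-0ˡ : ∀ y → correlation 0# y ≡ 0ℤ
    correlation-0ˡ y = trans (∑-cong colours λ {j} _ → trans (cong (ℤ._* w j y) (w-0 j)) (ℤ.*-zeroˡ (w j y))) (∑-zero colours)

    correlation-0ʳ : ∀ x → correlation x 0# ≡ 0ℤ
    correlation-0ʳ x = trans (∑-cong colours λ {j} _ → trans (cong (w j x ℤ.*_) (w-0 j)) (ℤ.*-zeroʳ (w j x))) (∑-zero colours)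

  weights : ∀ i j → ∑ colours (λ c → weight i c ℤ.* weight j c) ≡ pos 16 ℤ.* 𝟙 (i Fin.≟ j) ℤ.- pos 4
  weights 0F 0F = refl
  weights 0F 1F = refl
  weights 0F 2F = refl
  weights 0F 3F = refl
  weights 1F 0F = refl
  weights 1F 1F = refl
  weights 1F 2F = refl
  weights 1F 3F = refl
  weights 2F 0F = refl
  weights 2F 1F = refl
  weights 2F 2F = refl
  weights 2F 3F = refl
  weights 3F 0F = refl
  weights 3F 1F = refl
  weights 3F 2F = refl
  weights 3F 3F = refl

  opaque
    unfolding correlation

    correlation-weights : ∀ {x y} i j → cl x ≡ κ i → cl y ≡ κ j →
                          correlation x y ≡ ∑ colours λ c → weight i c ℤ.* weight j c
    correlation-weights {x} {y} i j x-colour y-colour =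
      ∑-cong colours λ {c} _ → cong₂ ℤ._*_ (w-colour {x} i c x-colour) (w-colour {y} j c y-colour)

  correlation-units : ∀ {x y} → x ≢ 0# → y ≢ 0# → correlation x y ≡ pos 16 ℤ.* 𝟙 (cl x ≟ cl y) ℤ.- pos 4
  correlation-units {x} {y} x≢0 y≢0 = begin
    correlation x y
      ≡⟨ correlation-weights i j x-colour y-colour ⟩
    ∑ colours (λ c → weight i c ℤ.* weight j c)
      ≡⟨ weights i j ⟩
    pos 16 ℤ.* 𝟙 (i Fin.≟ j) ℤ.- pos 4
      ≡⟨ cong (λ z → pos 16 ℤ.* z ℤ.- pos 4) (same (i Fin.≟ j) (cl x ≟ cl y)) ⟩
    pos 16 ℤ.* 𝟙 (cl x ≟ cl y) ℤ.- pos 4 ∎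
    where
    open ≡-Reasoning
    i = proj₁ (colour x≢0)
    j = proj₁ (colour y≢0)
    x-colour = proj₂ (colour x≢0)
    y-colour = proj₂ (colour y≢0)
    same : (p : Dec (i ≡ j)) (q : Dec (cl x ≡ cl y)) → 𝟙 p ≡ 𝟙 q
    same (yes _)  (yes _)  = refl
    same (no _)   (no _)   = refl
    same (yes eq) (no neq) = contradiction (trans x-colour (trans (cong κ eq) (sym y-colour))) neq
    same (no neq) (yes eq) = contradiction (κ-injective (trans (sym x-colour) (trans eq y-colour))) neq

  correlation-scale : ∀ {a} → a ≢ 0# → ∀ x y → correlation (a * x) (a * y) ≡ correlation x y
  correlation-scale {a} a≢0 x y with x ≟ 0# | y ≟ 0#
  ... | yes refl | _ = trans (cong (λ z → correlation z (a * y)) (zeroʳ a))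
                         (trans (correlation-0ˡ (a * y)) (sym (correlation-0ˡ y)))
  ... | no _ | yes refl = trans (cong (correlation (a * x)) (zeroʳ a))
                            (trans (correlation-0ʳ (a * x)) (sym (correlation-0ʳ x)))
  ... | no x≢0 | no y≢0 = trans (correlation-units (*-nonzero a≢0 x≢0) (*-nonzero a≢0 y≢0))
      (trans (cong (λ z → pos 16 ℤ.* z ℤ.- pos 4) (same (cl (a * x) ≟ cl (a * y)) (cl x ≟ cl y)))
             (sym (correlation-units x≢0 y≢0)))
    where
    same : (p : Dec (cl (a * x) ≡ cl (a * y))) (q : Dec (cl x ≡ cl y)) → 𝟙 p ≡ 𝟙 q
    same (yes _)  (yes _)  = refl
    same (no _)   (no _)   = refl
    same (yes eq) (no neq) = contradiction
      (*-cancelˡ-nonzero (cl-nonzero a≢0) (trans (sym (cl-* a x)) (trans eq (cl-* a y)))) neq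
    same (no neq) (yes eq) = contradiction (trans (cl-* a x) (trans (cong (cl a *_) eq) (sym (cl-* a y)))) neq

  classOf : Fin 4 → List Carrier
  classOf j = filter (λ x → cl x ≟ κ j) elements

  ∈-class : ∀ {x} j → x ∈ classOf j → cl x ≡ κ j
  ∈-class j x∈ = proj₂ (∈-filter⁻ (λ x → cl x ≟ κ j) {xs = elements} x∈)

  class-unique : ∀ j → Unique (classOf j)
  class-unique j = Unique.filter⁺ (λ x → cl x ≟ κ j) elements-unique

  length-class-≤ : ∀ j → length (classOf j) ℕ.≤ h
  length-class-≤ j = length-power-roots h (κ j) (class-unique j) (All.tabulate (∈-class j))

  length-classes : ∑ colours (λ j → pos (length (classOf j))) ≡ pos (length units)
  length-classes = begin
    ∑ colours (λ j → pos (length (classOf j)))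
      ≡⟨ ∑-cong colours (λ {j} _ → sym (∑-𝟙 (λ x → cl x ≟ κ j) elements)) ⟩
    ∑ colours (λ j → ∑ elements λ x → 𝟙 (cl x ≟ κ j))
      ≡⟨ ∑-swap colours elements (λ j x → 𝟙 (cl x ≟ κ j)) ⟩
    ∑ elements (λ x → ∑ colours λ j → 𝟙 (cl x ≟ κ j))
      ≡⟨ ∑-cong elements (λ {x} _ → one-colour x) ⟩
    ∑ elements (λ x → 𝟙 (nonzero? x))
      ≡⟨ ∑-𝟙 nonzero? elements ⟩
    pos (length units) ∎
    where
    open ≡-Reasoning
    indicator : ∀ {x i} → cl x ≡ κ i → ∀ j → 𝟙 (cl x ≟ κ j) ≡ 𝟙 (j Fin.≟ i)
    indicator {x} {i} eq j with cl x ≟ κ j | j Fin.≟ i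
    ... | yes _ | yes _    = refl
    ... | no _  | no _     = refl
    ... | yes p | no j≢i   = contradiction (κ-injective (trans (sym p) eq)) j≢i
    ... | no ¬p | yes refl = contradiction eq ¬p
    indicator-0 : ∀ j → 𝟙 (cl 0# ≟ κ j) ≡ 0ℤ
    indicator-0 j with cl 0# ≟ κ j
    ... | yes eq = contradiction refl (cl≡κ⇒≢0 j eq)
    ... | no _   = refl
    count : ∀ i → ∑ colours (λ j → 𝟙 (j Fin.≟ i)) ≡ 1ℤ
    count 0F = refl
    count 1F = refl
    count 2F = refl
    count 3F = refl
    one-colour : ∀ x → ∑ colours (λ j → 𝟙 (cl x ≟ κ j)) ≡ 𝟙 (nonzero? x)
    one-colour x with nonzero? x
    ... | yes x≢0 = let i , eq = colour x≢0
                    in trans (∑-cong colours (λ {j} _ → indicator {x} {i} eq j)) (count i)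
    ... | no ¬x≢0 with x ≟ 0#
    ...   | yes refl = trans (∑-cong colours (λ {j} _ → indicator-0 j)) (∑-zero colours)
    ...   | no x≢0   = contradiction x≢0 ¬x≢0

  -- Each class consists of roots of X ^ h - κ j and has at most h elements. Together the four have
  -- 4h, so none falls short.
  length-class : ∀ j → length (classOf j) ≡ h
  length-class j = ℕ.≤-antisym (length-class-≤ j) (all-≥ j)
    where
    N = λ j → length (classOf j)
    total : N 0F ℕ.+ (N 1F ℕ.+ (N 2F ℕ.+ (N 3F ℕ.+ 0))) ≡ h ℕ.+ (h ℕ.+ (h ℕ.+ (h ℕ.+ 0)))
    total = trans (ℤ.+-injective length-classes) (trans size (ℕ.*-assoc 4 2 k))
    lower : ∀ {a b c d : ℕ} → a ℕ.+ b ≡ c ℕ.+ d → b ℕ.≤ d → c ℕ.≤ a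
    lower {a} {b} {c} {d} eq b≤d = ℕ.+-cancelʳ-≤ d c a (ℕ.≤-trans (ℕ.≤-reflexive (sym eq)) (ℕ.+-monoʳ-≤ a b≤d))
    upper : ∀ {a b c d : ℕ} → a ℕ.≤ c → b ℕ.≤ d → a ℕ.+ b ≡ c ℕ.+ d → b ≡ d
    upper {a} {b} {c} {d} a≤c b≤d eq = ℕ.≤-antisym b≤d
      (ℕ.+-cancelˡ-≤ c d b (ℕ.≤-trans (ℕ.≤-reflexive (sym eq)) (ℕ.+-monoˡ-≤ b a≤c)))
    bound₃ = ℕ.+-monoˡ-≤ 0 (length-class-≤ 3F)
    bound₂ = ℕ.+-mono-≤ (length-class-≤ 2F) bound₃
    bound₁ = ℕ.+-mono-≤ (length-class-≤ 1F) bound₂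
    tail₁ = upper (length-class-≤ 0F) bound₁ total
    tail₂ = upper (length-class-≤ 1F) bound₂ tail₁
    tail₃ = upper (length-class-≤ 2F) bound₃ tail₂
    all-≥ : ∀ j → h ℕ.≤ N j
    all-≥ 0F = lower total bound₁
    all-≥ 1F = lower tail₁ bound₂
    all-≥ 2F = lower tail₂ bound₃
    all-≥ 3F = lower tail₃ ℕ.≤-refl

  shift-sum : ∀ y f → ∑ elements (λ x → f (x − y)) ≡ ∑ elements f
  shift-sum y f = ∑-reindex (_− y) (_+ y) (λ x → //-rightDividesʳ y x) (λ x → //-rightDividesˡ y x) f

  -- The class of 1 contributes 16 · 2k, and the constant -4 on all units takes away 4 · 8k.
  ∑-correlation-1 : ∑ elements (λ u → correlation u 1#) ≡ 0ℤ
  ∑-correlation-1 = begin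
    ∑ elements (λ u → correlation u 1#)
      ≡⟨ ∑-cong elements (λ {u} _ → indicators u (u ≟ 0#)) ⟩
    ∑ elements (λ u → pos 16 ℤ.* 𝟙 (cl u ≟ κ 0F) ℤ.+ (ℤ.- pos 4) ℤ.* 𝟙 (nonzero? u))
      ≡⟨ ∑-+ elements (λ u → pos 16 ℤ.* 𝟙 (cl u ≟ κ 0F)) (λ u → (ℤ.- pos 4) ℤ.* 𝟙 (nonzero? u)) ⟩
    ∑ elements (λ u → pos 16 ℤ.* 𝟙 (cl u ≟ κ 0F)) ℤ.+ ∑ elements (λ u → (ℤ.- pos 4) ℤ.* 𝟙 (nonzero? u))
      ≡⟨ cong₂ ℤ._+_
           (trans (∑-*ˡ elements (pos 16) (λ u → 𝟙 (cl u ≟ κ 0F))) (cong (pos 16 ℤ.*_) (∑-𝟙 (λ u → cl u ≟ κ 0F) elements)))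
           (trans (∑-*ˡ elements (ℤ.- pos 4) (λ u → 𝟙 (nonzero? u))) (cong ((ℤ.- pos 4) ℤ.*_) (∑-𝟙 nonzero? elements))) ⟩
    pos 16 ℤ.* pos (length (classOf 0F)) ℤ.+ (ℤ.- pos 4) ℤ.* pos (length units)
      ≡⟨ cong₂ (λ m n → pos 16 ℤ.* m ℤ.+ (ℤ.- pos 4) ℤ.* n)
           (trans (cong pos (length-class 0F)) (ℤ.pos-* 2 k)) (trans (cong pos size) (ℤ.pos-* 8 k)) ⟩
    pos 16 ℤ.* (pos 2 ℤ.* pos k) ℤ.+ (ℤ.- pos 4) ℤ.* (pos 8 ℤ.* pos k)
      ≡⟨ cancel (pos k) ⟩
    0ℤ ∎
    where
    open ≡-Reasoning
    cancel : ∀ k → pos 16 ℤ.* (pos 2 ℤ.* k) ℤ.+ (ℤ.- pos 4) ℤ.* (pos 8 ℤ.* k) ≡ 0ℤ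
    cancel = ℤ-Solver.solve-∀
    same : ∀ u → (p : Dec (cl u ≡ cl 1#)) (q : Dec (cl u ≡ κ 0F)) → 𝟙 p ≡ 𝟙 q
    same u (yes _)  (yes _)  = refl
    same u (no _)   (no _)   = refl
    same u (yes eq) (no neq) = contradiction (trans eq cl-1) neq
    same u (no neq) (yes eq) = contradiction (trans eq (sym cl-1)) neq
    nonzero-1 : ∀ {u} → u ≢ 0# → (p : Dec (u ≢ 0#)) → 𝟙 p ≡ 1ℤ
    nonzero-1 _   (yes _)  = refl
    nonzero-1 u≢0 (no ¬≢0) = contradiction u≢0 ¬≢0
    nonzero-0 : (p : Dec (0# ≢ 0#)) → 𝟙 p ≡ 0ℤ
    nonzero-0 (yes ≢0) = contradiction refl ≢0
    nonzero-0 (no _)   = refl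
    class-0 : (p : Dec (cl 0# ≡ κ 0F)) → 𝟙 p ≡ 0ℤ
    class-0 (yes eq) = contradiction refl (cl≡κ⇒≢0 0F eq)
    class-0 (no _)   = refl
    indicators : ∀ u → Dec (u ≡ 0#) →
                 correlation u 1# ≡ pos 16 ℤ.* 𝟙 (cl u ≟ κ 0F) ℤ.+ (ℤ.- pos 4) ℤ.* 𝟙 (nonzero? u)
    indicators u (yes refl) = trans (correlation-0ˡ 1#) (sym (cong₂ (λ m n → pos 16 ℤ.* m ℤ.+ (ℤ.- pos 4) ℤ.* n)
      (class-0 (cl 0# ≟ κ 0F)) (nonzero-0 (nonzero? 0#))))
    indicators u (no u≢0) = trans (correlation-units u≢0 1≢0) (cong₂ (λ m n → pos 16 ℤ.* m ℤ.+ (ℤ.- pos 4) ℤ.* n)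
      (same u (cl u ≟ cl 1#) (cl u ≟ κ 0F)) (sym (nonzero-1 u≢0 (nonzero? u))))

  correlation-self : ∀ {x} → x ≢ 0# → correlation x x ≡ pos 12
  correlation-self {x} x≢0 = trans (correlation-units x≢0 x≢0) (cong (λ z → pos 16 ℤ.* z ℤ.- pos 4) (same (cl x ≟ cl x)))
    where
    same : (p : Dec (cl x ≡ cl x)) → 𝟙 p ≡ 1ℤ
    same (yes _)  = refl
    same (no neq) = contradiction refl neq

  -- Total inversion, with 0 ⁻¹ = 0.
  recip : Carrier → Carrier
  recip x with x ≟ 0#
  ... | yes _  = 0#
  ... | no x≢0 = proj₁ (invert x x≢0)

  recip-0 : recip 0# ≡ 0#
  recip-0 with 0# ≟ 0#
  ... | yes _   = refl
  ... | no 0≢0 = contradiction refl 0≢0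

  *-recip : ∀ {x} → x ≢ 0# → x * recip x ≡ 1#
  *-recip {x} x≢0 with x ≟ 0#
  ... | yes x≡0 = contradiction x≡0 x≢0
  ... | no x≢0′ = proj₂ (invert x x≢0′)

  recip-nonzero : ∀ {x} → x ≢ 0# → recip x ≢ 0#
  recip-nonzero {x} x≢0 eq = 1≢0 (trans (sym (*-recip x≢0)) (trans (cong (x *_) eq) (zeroʳ x)))

  recip-involutive : ∀ x → recip (recip x) ≡ x
  recip-involutive x = by-cases (x ≟ 0#)
    where
    by-cases : Dec (x ≡ 0#) → recip (recip x) ≡ x
    by-cases (yes refl) = trans (cong recip recip-0) recip-0
    by-cases (no x≢0)   = *-cancelˡ-nonzero (recip-nonzero x≢0)
      (trans (*-recip (recip-nonzero x≢0)) (sym (trans (*-comm (recip x) x) (*-recip x≢0))))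

  -- The substitution x = y′ + (y′ − y) t reduces the sum to one over correlation (1 + t) t.
  ∑-correlation-≢ : ∀ {y y′} → y ≢ y′ → ∑ elements (λ x → correlation (x − y) (x − y′)) ≡ ℤ.- pos 12
  ∑-correlation-≢ {y} {y′} y≢y′ = begin
    ∑ elements (λ x → correlation (x − y) (x − y′))
      ≡⟨ ∑-cong elements (λ {x} _ → cong (λ z → correlation z (x − y′)) (split x)) ⟩
    ∑ elements (λ x → correlation (d + (x − y′)) (x − y′))
      ≡⟨ shift-sum y′ (λ x → correlation (d + x) x) ⟩
    ∑ elements (λ x → correlation (d + x) x)
      ≡⟨ sym (∑-reindex (d *_) (recip d *_) (undo (*-recip d≢0)) (undo (trans (*-comm _ _) (*-recip d≢0)))
               (λ x → correlation (d + x) x)) ⟩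
    ∑ elements (λ t → correlation (d + d * t) (d * t))
      ≡⟨ ∑-cong elements (λ {t} _ → trans (cong (λ z → correlation z (d * t)) (factor t)) (correlation-scale d≢0 (1# + t) t)) ⟩
    ∑ elements (λ t → correlation (1# + t) t)
      ≡⟨ sym (∑-reindex recip recip recip-involutive recip-involutive (λ t → correlation (1# + t) t)) ⟩
    ∑ elements (λ t → correlation (1# + recip t) (recip t))
      ≡⟨ ∑-cong elements (λ {t} _ → by-cases t (t ≟ 0#)) ⟩
    -- Scaling by t clears the reciprocals when t ≠ 0. At t = 0 the old summand vanishes because
    -- `recip 0#` is 0, while `correlation 1# 1#` is 12; the correction accounts for the whole
    -- result.
    ∑ elements (λ t → correlation (t + 1#) 1# ℤ.+ (ℤ.- pos 12) ℤ.* 𝟙 (t ≟ 0#))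
      ≡⟨ ∑-+ elements (λ t → correlation (t + 1#) 1#) (λ t → (ℤ.- pos 12) ℤ.* 𝟙 (t ≟ 0#)) ⟩
    ∑ elements (λ t → correlation (t + 1#) 1#) ℤ.+ ∑ elements (λ t → (ℤ.- pos 12) ℤ.* 𝟙 (t ≟ 0#))
      ≡⟨ cong₂ ℤ._+_
           (trans (∑-reindex (_+ 1#) (_− 1#) (λ x → //-rightDividesˡ 1# x) (λ x → //-rightDividesʳ 1# x) (λ u → correlation u 1#))
                  ∑-correlation-1)
           (trans (∑-*ˡ elements (ℤ.- pos 12) (λ t → 𝟙 (t ≟ 0#)))
                  (cong ((ℤ.- pos 12) ℤ.*_) (∑-single _≟_ elements-unique (∈-elements 0#)))) ⟩
    ℤ.- pos 12 ∎
    where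
    open ≡-Reasoning
    d = y′ − y
    d≢0 : d ≢ 0#
    d≢0 = x≢y⇒x−y≢0 (y≢y′ ∘ sym)
    split : ∀ x → x − y ≡ d + (x − y′)
    split x = begin
      x − y                 ≡⟨ cong (_− y) (sym (//-rightDividesˡ y′ x)) ⟩
      ((x − y′) + y′) − y   ≡⟨ +-assoc (x − y′) y′ (- y) ⟩
      (x − y′) + d          ≡⟨ +-comm (x − y′) d ⟩
      d + (x − y′)          ∎
    undo : ∀ {a b} → a * b ≡ 1# → ∀ t → a * (b * t) ≡ t
    undo {a} {b} ab≡1 t = trans (sym (*-assoc a b t)) (trans (cong (_* t) ab≡1) (*-identityˡ t))
    factor : ∀ t → d + d * t ≡ d * (1# + t)
    factor t = sym (trans (distribˡ d 1# t) (cong (_+ (d * t)) (*-identityʳ d)))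
    by-cases : ∀ t → (t? : Dec (t ≡ 0#)) →
               correlation (1# + recip t) (recip t) ≡ correlation (t + 1#) 1# ℤ.+ (ℤ.- pos 12) ℤ.* 𝟙 t?
    by-cases t (yes refl) = trans
      (trans (cong (correlation (1# + recip 0#)) recip-0) (correlation-0ʳ _))
      (sym (cong (ℤ._+ (ℤ.- pos 12)) (trans (cong (λ z → correlation z 1#) (+-identityˡ 1#)) (correlation-self 1≢0))))
    by-cases t (no t≢0) = trans
      (trans (sym (correlation-scale t≢0 (1# + recip t) (recip t)))
             (cong₂ correlation
               (trans (distribˡ t 1# (recip t)) (cong₂ _+_ (*-identityʳ t) (*-recip t≢0)))
               (*-recip t≢0)))
      (sym (ℤ.+-identityʳ _))

  order : ℤ
  order = 1ℤ ℤ.+ pos 8 ℤ.* pos k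

  -- The diagonal value 12 (q - 1) and the value -12 elsewhere differ by 12 q, so a single formula
  -- covers both and can be summed over pairs from Y.
  ∑-correlation : ∀ y y′ → ∑ elements (λ x → correlation (x − y) (x − y′)) ≡
                  pos 12 ℤ.* order ℤ.* 𝟙 (y′ ≟ y) ℤ.- pos 12
  ∑-correlation y y′ = by-cases (y′ ≟ y)
    where
    on-units : ∀ u → Dec (u ≡ 0#) → correlation u u ≡ pos 12 ℤ.* 𝟙 (nonzero? u)
    on-units u (yes refl) with nonzero? 0#
    ... | yes 0≢0 = contradiction refl 0≢0
    ... | no _    = correlation-0ˡ 0#
    on-units u (no u≢0) with nonzero? u
    ... | yes _   = correlation-self u≢0
    ... | no ¬≢0  = contradiction u≢0 ¬≢0
    expand : ∀ k → pos 12 ℤ.* (pos 8 ℤ.* k) ≡ pos 12 ℤ.* (1ℤ ℤ.+ pos 8 ℤ.* k) ℤ.* 1ℤ ℤ.- pos 12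
    expand = ℤ-Solver.solve-∀
    drop : ∀ m → ℤ.- pos 12 ≡ m ℤ.* 0ℤ ℤ.- pos 12
    drop = ℤ-Solver.solve-∀
    by-cases : (y? : Dec (y′ ≡ y)) → ∑ elements (λ x → correlation (x − y) (x − y′)) ≡
               pos 12 ℤ.* order ℤ.* 𝟙 y? ℤ.- pos 12
    by-cases (no y′≢y) = trans (∑-correlation-≢ (y′≢y ∘ sym)) (drop (pos 12 ℤ.* order))
    by-cases (yes refl) = begin
      ∑ elements (λ x → correlation (x − y) (x − y)) ≡⟨ shift-sum y (λ x → correlation x x) ⟩
      ∑ elements (λ u → correlation u u)             ≡⟨ ∑-cong elements (λ {u} _ → on-units u (u ≟ 0#)) ⟩
      ∑ elements (λ u → pos 12 ℤ.* 𝟙 (nonzero? u))   ≡⟨ ∑-*ˡ elements (pos 12) (λ u → 𝟙 (nonzero? u)) ⟩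
      pos 12 ℤ.* ∑ elements (λ u → 𝟙 (nonzero? u))   ≡⟨ cong (pos 12 ℤ.*_) (∑-𝟙 nonzero? elements) ⟩
      pos 12 ℤ.* pos (length units)                  ≡⟨ cong (pos 12 ℤ.*_) (trans (cong pos size) (ℤ.pos-* 8 k)) ⟩
      pos 12 ℤ.* (pos 8 ℤ.* pos k)                   ≡⟨ expand (pos k) ⟩
      pos 12 ℤ.* order ℤ.* 1ℤ ℤ.- pos 12             ∎
      where open ≡-Reasoning

  -- Four times the excess, over its expected value, of the number of y in Y with x − y in class j.
  bias : List Carrier → Fin 4 → Carrier → ℤ
  bias Y j x = ∑ Y λ y → w j (x − y)

  bias² : List Carrier → Fin 4 → Carrier → ℤ
  bias² Y j x = bias Y j x ℤ.* bias Y j x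

  opaque
    unfolding correlation

    ∑-bias² : ∀ {Y} → Unique Y → ∑ elements (λ x → ∑ colours λ j → bias² Y j x) ≡
              pos (length Y) ℤ.* (pos 12 ℤ.* order ℤ.- pos (length Y) ℤ.* pos 12)
    ∑-bias² {Y} uY = begin
      ∑ elements (λ x → ∑ colours λ j → bias² Y j x)
        ≡⟨ ∑-cong elements (λ {x} _ → ∑-cong colours λ {j} _ → ∑-square Y (λ y → w j (x − y))) ⟩
      ∑ elements (λ x → ∑ colours λ j → ∑ Y λ y → ∑ Y λ y′ → w j (x − y) ℤ.* w j (x − y′))
        ≡⟨ ∑-cong elements (λ {x} _ → trans
             (∑-swap colours Y (λ j y → ∑ Y λ y′ → w j (x − y) ℤ.* w j (x − y′)))
             (∑-cong Y λ {y} _ → ∑-swap colours Y (λ j y′ → w j (x − y) ℤ.* w j (x − y′)))) ⟩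
      ∑ elements (λ x → ∑ Y λ y → ∑ Y λ y′ → correlation (x − y) (x − y′))
        ≡⟨ trans (∑-swap elements Y (λ x y → ∑ Y λ y′ → correlation (x − y) (x − y′)))
                 (∑-cong Y λ {y} _ → ∑-swap elements Y (λ x y′ → correlation (x − y) (x − y′))) ⟩
      ∑ Y (λ y → ∑ Y λ y′ → ∑ elements λ x → correlation (x − y) (x − y′))
        ≡⟨ ∑-cong Y (λ {y} _ → ∑-cong Y λ {y′} _ → ∑-correlation y y′) ⟩
      ∑ Y (λ y → ∑ Y λ y′ → pos 12 ℤ.* order ℤ.* 𝟙 (y′ ≟ y) ℤ.- pos 12)
        ≡⟨ ∑-cong Y row ⟩
      ∑ Y (λ _ → pos 12 ℤ.* order ℤ.- pos (length Y) ℤ.* pos 12)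
        ≡⟨ ∑-const Y _ ⟩
      pos (length Y) ℤ.* (pos 12 ℤ.* order ℤ.- pos (length Y) ℤ.* pos 12) ∎
      where
      open ≡-Reasoning
      row : ∀ {y} → y ∈ Y → ∑ Y (λ y′ → pos 12 ℤ.* order ℤ.* 𝟙 (y′ ≟ y) ℤ.- pos 12) ≡
            pos 12 ℤ.* order ℤ.- pos (length Y) ℤ.* pos 12
      row {y} y∈ = begin
        ∑ Y (λ y′ → pos 12 ℤ.* order ℤ.* 𝟙 (y′ ≟ y) ℤ.- pos 12)
          ≡⟨ ∑-+ Y (λ y′ → pos 12 ℤ.* order ℤ.* 𝟙 (y′ ≟ y)) (λ _ → ℤ.- pos 12) ⟩
        ∑ Y (λ y′ → pos 12 ℤ.* order ℤ.* 𝟙 (y′ ≟ y)) ℤ.+ ∑ Y (λ _ → ℤ.- pos 12)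
          ≡⟨ cong₂ ℤ._+_
               (trans (∑-*ˡ Y (pos 12 ℤ.* order) (λ y′ → 𝟙 (y′ ≟ y)))
                 (trans (cong (pos 12 ℤ.* order ℤ.*_) (∑-single _≟_ uY y∈)) (ℤ.*-identityʳ (pos 12 ℤ.* order))))
               (trans (∑-const Y (ℤ.- pos 12)) (sym (ℤ.neg-distribʳ-* (pos (length Y)) (pos 12)))) ⟩
        pos 12 ℤ.* order ℤ.- pos (length Y) ℤ.* pos 12 ∎

  -- The squares for the other three classes and the term -12 |Y|² are dropped; a bound linear in
  -- |Y| is easy to add up over several targets.
  ∑-bias²-≤ : ∀ {Y} → Unique Y → ∀ j → ∑ elements (bias² Y j) ℤ.≤ pos 12 ℤ.* order ℤ.* pos (length Y)
  ∑-bias²-≤ {Y} uY j = ℤ.≤-trans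
    (∑-mono elements (λ {x} _ → one-colour x j))
    (subst (ℤ._≤ pos 12 ℤ.* order ℤ.* n) (sym (∑-bias² uY))
      (subst₂ ℤ._≤_ (rearrange n (pos 12 ℤ.* order)) (ℤ.+-identityʳ _)
        (ℤ.+-monoʳ-≤ (pos 12 ℤ.* order ℤ.* n) (ℤ.neg-mono-≤ (0≤12n² (length Y))))))
    where
    n = pos (length Y)
    0≤12n² : ∀ n → 0ℤ ℤ.≤ pos n ℤ.* pos n ℤ.* pos 12
    0≤12n² n = ℤ.*-monoʳ-≤-nonNeg (pos 12) (0≤square (pos n))
    rearrange : ∀ n q → q ℤ.* n ℤ.+ (ℤ.- (n ℤ.* n ℤ.* pos 12)) ≡ n ℤ.* (q ℤ.- n ℤ.* pos 12)
    rearrange = ℤ-Solver.solve-∀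
    one-colour : ∀ x j → bias² Y j x ℤ.≤ ∑ colours λ j → bias² Y j x
    one-colour x j = go (∈-colours j)
      where
      ∈-colours : ∀ j → j ∈ colours
      ∈-colours 0F = here refl
      ∈-colours 1F = there (here refl)
      ∈-colours 2F = there (there (here refl))
      ∈-colours 3F = there (there (there (here refl)))
      square = λ i → bias² Y i x
      go : ∀ {xs} → j ∈ xs → square j ℤ.≤ ∑ xs square
      go {_ ∷ xs} (here refl) = subst (ℤ._≤ ∑ (j ∷ xs) square) (ℤ.+-identityʳ _)
        (ℤ.+-monoʳ-≤ (square j) (∑-nonneg xs λ i → 0≤square (bias Y i x)))
      go {i ∷ xs} (there j∈) = ℤ.≤-trans (go j∈) (subst (ℤ._≤ ∑ (i ∷ xs) square) (ℤ.+-identityˡ _)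
        (ℤ.+-monoˡ-≤ (∑ xs square) (0≤square (bias Y i x))))

-- Numerical estimates for the successive choices

module Inequalities where

  open import Data.Nat
  open import Data.Nat.Properties
  open import Data.Nat.Tactic.RingSolver using (solve-∀)

  *-*-comm : ∀ a b c → a * b * c ≡ a * c * b
  *-*-comm = solve-∀

  *-*-* : ∀ a b c d → a * b * (c * d) ≡ a * c * (b * d)
  *-*-* = solve-∀

  square-cancel-≤ : ∀ {m n} → m * m ≤ n * n → m ≤ n
  square-cancel-≤ mm≤nn = ≮⇒≥ λ n<m → <⇒≱ (*-mono-< n<m n<m) mm≤nn

  -- Numerals stand on the right of products, since _*_ unfolds along its left argument.
  module Estimates (h : ℕ) (large : 32768 ≤ h) where

    open ≤-Reasoning

    order : ℕ
    order = h * 4 + 1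

    instance
      h≢0 : NonZero h
      h≢0 = >-nonZero (<-≤-trans (<ᵇ⇒< 0 32768 tt) large)

    order≤ : ∀ c d e → c ≤ 32768 → c * 4 + 1 ≡ d → d ≤ 32768 * e → order * c ≤ h * h * e
    order≤ c d e c≤ refl d≤ = begin
      (h * 4 + 1) * c       ≡⟨ *-distribʳ-+ c (h * 4) 1 ⟩
      h * 4 * c + 1 * c     ≡⟨ cong₂ _+_ (trans (*-assoc h 4 c) (cong (h *_) (*-comm 4 c))) (*-identityˡ c) ⟩
      h * (c * 4) + c       ≤⟨ +-monoʳ-≤ (h * (c * 4)) (≤-trans c≤ large) ⟩
      h * (c * 4) + h       ≡⟨ trans (cong (h * (c * 4) +_) (sym (*-identityʳ h))) (sym (*-distribˡ-+ h (c * 4) 1)) ⟩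
      h * (c * 4 + 1)       ≤⟨ *-monoʳ-≤ h (≤-trans d≤ (*-monoˡ-≤ e large)) ⟩
      h * (h * e)           ≡⟨ sym (*-assoc h h e) ⟩
      h * h * e             ∎

    -- For the choice of a among h elements with three targets of size h. The premise gives f² ≤ 36
    -- q, so (15 f)² ≤ 8100 (4h + 1) ≤ 32401 h. Of all the estimates this is the one closest to the
    -- threshold 32768.
    first-deviation : ∀ f → h * (f * f) ≤ order * 12 * (h * 3) → f * 15 ≤ h
    first-deviation f bound = square-cancel-≤ (begin
      f * 15 * (f * 15)  ≡⟨ *-*-* f 15 f 15 ⟩
      f * f * 225        ≤⟨ *-monoˡ-≤ 225 ff≤ ⟩
      order * 36 * 225   ≡⟨ *-assoc order 36 225 ⟩
      order * 8100       ≤⟨ order≤ 8100 32401 1 (≤ᵇ⇒≤ 8100 32768 tt) refl (≤ᵇ⇒≤ 32401 32768 tt) ⟩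
      h * h * 1          ≡⟨ *-identityʳ (h * h) ⟩
      h * h              ∎)
      where
      ff≤ : f * f ≤ order * 36
      ff≤ = *-cancelˡ-≤ h (begin
        h * (f * f)            ≤⟨ bound ⟩
        order * 12 * (h * 3)   ≡⟨ *-*-* order 12 h 3 ⟩
        order * h * 36         ≡⟨ trans (cong (_* 36) (*-comm order h)) (*-assoc h order 36) ⟩
        h * (order * 36)       ∎)

    -- With f ≤ h / 15, a count n with 4n within f of h lies between 14h / 60 and 16h / 60; this is
    -- the lower end.
    window-lower : ∀ {n f} → h ≤ n * 4 + f → f * 15 ≤ h → h * 14 ≤ n * 60
    window-lower {n} {f} h≤ f≤ = +-cancelʳ-≤ h (h * 14) (n * 60) (begin
      h * 14 + h           ≡⟨ trans (cong (h * 14 +_) (sym (*-identityʳ h))) (sym (*-distribˡ-+ h 14 1)) ⟩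
      h * 15               ≤⟨ *-monoˡ-≤ 15 h≤ ⟩
      (n * 4 + f) * 15     ≡⟨ trans (*-distribʳ-+ 15 (n * 4) f) (cong (_+ f * 15) (*-assoc n 4 15)) ⟩
      n * 60 + f * 15      ≤⟨ +-monoʳ-≤ (n * 60) f≤ ⟩
      n * 60 + h           ∎)

    window-upper : ∀ {n f} → n * 4 ≤ h + f → f * 15 ≤ h → n * 60 ≤ h * 16
    window-upper {n} {f} ≤h+f f≤ = begin
      n * 60            ≡⟨ sym (*-assoc n 4 15) ⟩
      n * 4 * 15        ≤⟨ *-monoˡ-≤ 15 ≤h+f ⟩
      (h + f) * 15      ≡⟨ *-distribʳ-+ 15 h f ⟩
      h * 15 + f * 15   ≤⟨ +-monoʳ-≤ (h * 15) f≤ ⟩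
      h * 15 + h        ≡⟨ trans (cong (h * 15 +_) (sym (*-identityʳ h))) (sym (*-distribˡ-+ h 15 1)) ⟩
      h * 16            ∎

    -- For the choice of b among at least 14h / 60 elements, with two targets of at most 16h / 60
    -- elements each: 14 f² ≤ 12 · 32 q = 384 q, about 1536 h.
    second-deviation : ∀ {b c d f} → h * 14 ≤ b * 60 → c * 60 ≤ h * 16 → d * 60 ≤ h * 16 →
                       b * (f * f) ≤ order * 12 * (c + d) → f * 17 ≤ h
    second-deviation {b} {c} {d} {f} b≥ c≤ d≤ bound = square-cancel-≤ (*-cancelʳ-≤ _ _ 14 (begin
      f * 17 * (f * 17) * 14   ≡⟨ trans (cong (_* 14) (*-*-* f 17 f 17)) (*-*-comm (f * f) 289 14) ⟩
      f * f * 14 * 289         ≤⟨ *-monoˡ-≤ 289 ff≤ ⟩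
      -- Here 384 · 289 = 27744 · 4. The factor 4 is set aside because the 1 in q = 4h + 1
      -- contributes the remaining factor, which has to stay below h.
      order * 384 * 289        ≡⟨ trans (*-assoc order 384 289) (sym (*-assoc order 27744 4)) ⟩
      order * 27744 * 4        ≤⟨ *-monoˡ-≤ 4 (order≤′) ⟩
      h * 110977 * 4           ≡⟨ *-assoc h 110977 4 ⟩
      h * 443908               ≤⟨ *-monoʳ-≤ h (≤-trans (≤ᵇ⇒≤ 443908 458752 tt) (*-monoˡ-≤ 14 large)) ⟩
      h * (h * 14)             ≡⟨ sym (*-assoc h h 14) ⟩
      h * h * 14               ∎))
      where
      order≤′ : order * 27744 ≤ h * 110977
      order≤′ = begin
        (h * 4 + 1) * 27744       ≡⟨ trans (*-distribʳ-+ 27744 (h * 4) 1) (cong₂ _+_ (*-assoc h 4 27744) refl) ⟩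
        h * 110976 + 27744        ≤⟨ +-monoʳ-≤ (h * 110976) (≤-trans (≤ᵇ⇒≤ 27744 32768 tt) large) ⟩
        h * 110976 + h            ≡⟨ trans (cong (h * 110976 +_) (sym (*-identityʳ h))) (sym (*-distribˡ-+ h 110976 1)) ⟩
        h * 110977                ∎
      ff≤ : f * f * 14 ≤ order * 384
      ff≤ = *-cancelˡ-≤ h (begin
        h * (f * f * 14)                  ≡⟨ trans (sym (*-assoc h (f * f) 14)) (*-*-comm h (f * f) 14) ⟩
        h * 14 * (f * f)                  ≤⟨ *-monoˡ-≤ (f * f) b≥ ⟩
        b * 60 * (f * f)                  ≡⟨ *-*-comm b 60 (f * f) ⟩
        b * (f * f) * 60                  ≤⟨ *-monoˡ-≤ 60 bound ⟩
        order * 12 * (c + d) * 60         ≡⟨ trans (*-assoc (order * 12) (c + d) 60) (cong (order * 12 *_) (*-distribʳ-+ 60 c d)) ⟩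
        order * 12 * (c * 60 + d * 60)    ≤⟨ *-monoʳ-≤ (order * 12) (+-mono-≤ c≤ d≤) ⟩
        order * 12 * (h * 16 + h * 16)    ≡⟨ cong (order * 12 *_) (sym (*-distribˡ-+ h 16 16)) ⟩
        order * 12 * (h * 32)             ≡⟨ *-*-* order 12 h 32 ⟩
        order * h * 384                   ≡⟨ trans (cong (_* 384) (*-comm order h)) (*-assoc h order 384) ⟩
        h * (order * 384)                 ∎)

    -- The constant is (14 / 60 - 1 / 17) / 4 = 178 / 4080.
    second-lower : ∀ {c n f} → h * 14 ≤ c * 60 → c ≤ n * 4 + f → f * 17 ≤ h → h * 178 ≤ n * 4080
    second-lower {c} {n} {f} c≥ c≤ f≤ = +-cancelʳ-≤ (h * 60) (h * 178) (n * 4080) (begin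
      h * 178 + h * 60          ≡⟨ trans (sym (*-distribˡ-+ h 178 60)) (sym (*-assoc h 14 17)) ⟩
      h * 14 * 17               ≤⟨ *-monoˡ-≤ 17 (≤-trans c≥ (*-monoˡ-≤ 60 c≤)) ⟩
      (n * 4 + f) * 60 * 17     ≡⟨ trans (*-assoc (n * 4 + f) 60 17) (*-distribʳ-+ 1020 (n * 4) f) ⟩
      n * 4 * 1020 + f * 1020   ≡⟨ cong₂ _+_ (*-assoc n 4 1020) (sym (*-assoc f 17 60)) ⟩
      n * 4080 + f * 17 * 60    ≤⟨ +-monoʳ-≤ (n * 4080) (*-monoˡ-≤ 60 f≤) ⟩
      n * 4080 + h * 60         ∎)

    -- If d ≤ f, the last premise gives c d ≤ 12 q, which is linear in h, whereas c d is at least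
    -- (178 / 4080)² h².
    third-deviation : ∀ {c d f} → h * 178 ≤ c * 4080 → h * 178 ≤ d * 4080 → c * (f * f) ≤ order * 12 * d → ¬ d ≤ f
    third-deviation {c} {zero} c≥ d≥ bound d≤f = <⇒≱ (*-monoˡ-< 178 (>-nonZero⁻¹ h)) d≥
    third-deviation {c} {d@(suc _)} {f} c≥ d≥ bound d≤f = <⇒≱ too-large (begin
      h * 178 * (h * 178)       ≤⟨ *-mono-≤ c≥ d≥ ⟩
      c * 4080 * (d * 4080)     ≡⟨ *-*-* c 4080 d 4080 ⟩
      c * d * 16646400          ≤⟨ *-monoˡ-≤ 16646400 cd≤ ⟩
      order * 12 * 16646400     ≡⟨ *-assoc order 12 16646400 ⟩
      order * 199756800         ∎)
      where
      cd≤ : c * d ≤ order * 12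
      cd≤ = *-cancelʳ-≤ (c * d) (order * 12) d (begin
        c * d * d                ≡⟨ *-assoc c d d ⟩
        c * (d * d)              ≤⟨ *-monoʳ-≤ c (*-mono-≤ d≤f d≤f) ⟩
        c * (f * f)              ≤⟨ bound ⟩
        order * 12 * d           ∎)
      too-large : order * 199756800 < h * 178 * (h * 178)
      too-large = begin-strict
        (h * 4 + 1) * 199756800            ≡⟨ *-distribʳ-+ 199756800 (h * 4) 1 ⟩
        h * 4 * 199756800 + 1 * 199756800  ≡⟨ cong₂ _+_ (*-assoc h 4 199756800) refl ⟩
        h * 799027200 + 199756800          <⟨ +-monoʳ-< (h * 799027200) (<-≤-trans (<ᵇ⇒< 199756800 268435456 tt) (*-monoˡ-≤ 8192 large)) ⟩
        h * 799027200 + h * 8192           ≡⟨ sym (*-distribˡ-+ h 799027200 8192) ⟩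
        h * 799035392                      ≤⟨ *-monoʳ-≤ h (≤-trans (≤ᵇ⇒≤ 799035392 1038221312 tt) (*-monoˡ-≤ 31684 large)) ⟩
        h * (h * 31684)                    ≡⟨ sym (*-assoc h h 31684) ⟩
        h * h * 31684                      ≡⟨ sym (*-*-* h 178 h 178) ⟩
        h * 178 * (h * 178)                ∎

open Inequalities

-- Large fields

square-∣∣ : ∀ i → i ℤ.* i ≡ pos (∣ i ∣ ℕ.* ∣ i ∣)
square-∣∣ (pos n)    = sym (ℤ.pos-* n n)
square-∣∣ (-[1+ n ]) = refl

distance-bounds : ∀ m n → n ℕ.≤ m ℕ.+ ∣ pos m ℤ.- pos n ∣ × m ℕ.≤ n ℕ.+ ∣ pos m ℤ.- pos n ∣
distance-bounds m n = bound m n , subst (λ d → m ℕ.≤ n ℕ.+ d) (ℤ.∣i-j∣≡∣j-i∣ (pos n) (pos m)) (bound n m)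
  where
  bound : ∀ m n → n ℕ.≤ m ℕ.+ ∣ pos m ℤ.- pos n ∣
  bound m n with ℕ.≤-total n m
  ... | inj₁ n≤m = ℕ.≤-trans n≤m (ℕ.m≤m+n m _)
  ... | inj₂ m≤n = subst (λ d → n ℕ.≤ m ℕ.+ d)
    (sym (trans (ℤ.∣i-j∣≡∣j-i∣ (pos m) (pos n)) (trans (cong ∣_∣ (trans (ℤ.m-n≡m⊖n n m) (ℤ.⊖-≥ m≤n))) refl)))
    (ℕ.≤-reflexive (sym (ℕ.m+[n∸m]≡n m≤n)))

module Selection (𝔽 : FiniteField) (k : ℕ) {{k≢0 : NonZero k}} (size : length (FieldProperties.units 𝔽) ≡ 8 ℕ.* k)
                 (large : 32768 ℕ.≤ 2 ℕ.* k) where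

  open FieldProperties 𝔽
  open Classes 𝔽 k size
  open Spectral 𝔽 k size renaming (order to orderℤ)
  module E = Estimates (2 ℕ.* k) large
  open E using (order)

  order≡ : orderℤ ≡ pos order
  order≡ = begin
    pos 1 ℤ.+ pos 8 ℤ.* pos k   ≡⟨ cong (ℤ._+_ (pos 1)) (sym (ℤ.pos-* 8 k)) ⟩
    pos (1 ℕ.+ 8 ℕ.* k)         ≡⟨ cong pos (trans (ℕ.+-comm 1 (8 ℕ.* k)) (cong (ℕ._+ 1)
                                     (trans (ℕ.*-assoc 4 2 k) (ℕ.*-comm 4 (2 ℕ.* k))))) ⟩
    pos order                   ∎
    where open ≡-Reasoning

  opaque
    count : List Carrier → Fin 4 → Carrier → List Carrier
    count Y j x = filter (λ y → cl (x − y) ≟ κ j) Y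

    deviation : List Carrier → Fin 4 → Carrier → ℕ
    deviation Y j x = ∣ bias Y j x ∣

    count-unique : ∀ {Y} j x → Unique Y → Unique (count Y j x)
    count-unique j x = Unique.filter⁺ (λ y → cl (x − y) ≟ κ j)

    ∈-count : ∀ {Y j x y} → y ∈ count Y j x → y ∈ Y × cl (x − y) ≡ κ j
    ∈-count {Y} {j} {x} = ∈-filter⁻ (λ y → cl (x − y) ≟ κ j) {xs = Y}

  opaque
    unfolding w count

    -- That x is outside Y matters: `w` vanishes at 0, so y = x would contribute 0 to the bias, but
    -- -1 to the right-hand side.
    bias-count : ∀ {x} j Y → (∀ {y} → y ∈ Y → x ≢ y) →
                 bias Y j x ≡ pos 4 ℤ.* pos (length (count Y j x)) ℤ.- pos (length Y)
    bias-count {x} j Y x∉Y = begin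
      ∑ Y (λ y → pos 4 ℤ.* 𝟙 (cl (x − y) ≟ κ j) ℤ.- 𝟙 (nonzero? (x − y)))
        ≡⟨ ∑-cong Y (λ {y} y∈ → cong (λ z → pos 4 ℤ.* 𝟙 (cl (x − y) ≟ κ j) ℤ.- z) (nonzero (x≢y⇒x−y≢0 (x∉Y y∈)) (nonzero? (x − y)))) ⟩
      ∑ Y (λ y → pos 4 ℤ.* 𝟙 (cl (x − y) ≟ κ j) ℤ.- 1ℤ)
        ≡⟨ ∑-+ Y (λ y → pos 4 ℤ.* 𝟙 (cl (x − y) ≟ κ j)) (λ _ → ℤ.- 1ℤ) ⟩
      ∑ Y (λ y → pos 4 ℤ.* 𝟙 (cl (x − y) ≟ κ j)) ℤ.+ ∑ Y (λ _ → ℤ.- 1ℤ)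
        ≡⟨ cong₂ ℤ._+_
             (trans (∑-*ˡ Y (pos 4) (λ y → 𝟙 (cl (x − y) ≟ κ j))) (cong (pos 4 ℤ.*_) (∑-𝟙 (λ y → cl (x − y) ≟ κ j) Y)))
             (trans (∑-const Y (ℤ.- 1ℤ)) (trans (sym (ℤ.neg-distribʳ-* (pos (length Y)) 1ℤ)) (cong ℤ.-_ (ℤ.*-identityʳ (pos (length Y)))))) ⟩
      pos 4 ℤ.* pos (length (count Y j x)) ℤ.- pos (length Y) ∎
      where
      open ≡-Reasoning
      nonzero : ∀ {z} → z ≢ 0# → (p : Dec (z ≢ 0#)) → 𝟙 p ≡ 1ℤ
      nonzero _   (yes _)  = refl
      nonzero z≢0 (no ¬≢0) = contradiction z≢0 ¬≢0

  opaque
    unfolding deviation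

    count-bounds : ∀ {x} j Y → (∀ {y} → y ∈ Y → x ≢ y) →
                   length Y ℕ.≤ length (count Y j x) ℕ.* 4 ℕ.+ deviation Y j x ×
                   length (count Y j x) ℕ.* 4 ℕ.≤ length Y ℕ.+ deviation Y j x
    count-bounds {x} j Y x∉Y =
      subst (λ d → length Y ℕ.≤ n ℕ.* 4 ℕ.+ d × n ℕ.* 4 ℕ.≤ length Y ℕ.+ d)
        (cong ∣_∣ (sym (trans (bias-count j Y x∉Y)
          (cong (ℤ._- pos (length Y)) (trans (sym (ℤ.pos-* 4 n)) (cong pos (ℕ.*-comm 4 n)))))))
        (distance-bounds (n ℕ.* 4) (length Y))
      where
      n : ℕ
      n = length (count Y j x)

    square-deviation : ∀ Y j x → pos (deviation Y j x ℕ.* deviation Y j x) ≡ bias² Y j x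
    square-deviation Y j x = sym (square-∣∣ (bias Y j x))

  ∑-unique-≤ : ∀ {X} → Unique X → ∀ {f} → (∀ x → 0ℤ ℤ.≤ f x) → ∑ X f ℤ.≤ ∑ elements f
  ∑-unique-≤ {X} uX {f} 0≤f = subst (ℤ._≤ ∑ elements f) (sym (∑-↭ f (unique-↭ uX (Unique.filter⁺ (_∈? X) elements-unique)
      (λ x∈ → ∈-filter⁺ (_∈? X) (∈-elements _) x∈)
      (λ x∈ → proj₂ (∈-filter⁻ (_∈? X) {xs = elements} x∈)))))
    (∑-filter-≤ (_∈? X) elements 0≤f)
    where open DecMembership _≟_ using (_∈?_)

  Target : Set
  Target = List Carrier × Fin 4

  total : List Target → ℕ
  total []              = 0
  total ((Y , _) ∷ ts) = length Y ℕ.+ total ts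

  -- The element x minimises over X the sum of the squared biases of all targets. That minimum is at
  -- most the average over X, the sum over X is at most the sum over the field, and each square is
  -- at most the sum of all: a single x serves every target.
  select : ∀ {X} → Unique X → 0 ℕ.< length X → (ts : List Target) → All (Unique ∘ proj₁) ts →
           Σ Carrier λ x → x ∈ X × All (λ (Y , j) → length X ℕ.* (deviation Y j x ℕ.* deviation Y j x) ℕ.≤
                                                    order ℕ.* 12 ℕ.* total ts) ts
  select {X} uX nonempty ts unique =
    let x , x∈ , small = below-average energy X nonempty
    in x , x∈ , All.tabulate λ {(Y , j)} t∈ → ℤ.drop‿+≤+ (begin
      pos (length X ℕ.* (deviation Y j x ℕ.* deviation Y j x))
        ≡⟨ trans (ℤ.pos-* (length X) _) (cong (pos (length X) ℤ.*_) (square-deviation Y j x)) ⟩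
      pos (length X) ℤ.* bias² Y j x
        ≤⟨ ℤ.*-monoˡ-≤-nonNeg (pos (length X)) (part x t∈) ⟩
      pos (length X) ℤ.* energy x
        ≤⟨ small ⟩
      ∑ X energy
        ≤⟨ all-energy ts unique ⟩
      pos (order ℕ.* 12 ℕ.* total ts) ∎)
    where
    open ℤ.≤-Reasoning
    term : Carrier → Target → ℤ
    term x (Y , j) = bias² Y j x
    energy : Carrier → ℤ
    energy x = ∑ ts (term x)
    part : ∀ x {t} → t ∈ ts → term x t ℤ.≤ energy x
    part x t∈ = go t∈
      where
      go : ∀ {t us} → t ∈ us → term x t ℤ.≤ ∑ us (term x)
      go {t} {_ ∷ us} (here refl) = subst (ℤ._≤ ∑ (t ∷ us) (term x)) (ℤ.+-identityʳ _)
        (ℤ.+-monoʳ-≤ (term x t) (∑-nonneg us λ (Y , j) → 0≤square (bias Y j x)))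
      go {t} {u ∷ us} (there t∈) = ℤ.≤-trans (go t∈) (subst (ℤ._≤ ∑ (u ∷ us) (term x)) (ℤ.+-identityˡ _)
        (ℤ.+-monoˡ-≤ (∑ us (term x)) (0≤square (bias (proj₁ u) (proj₂ u) x))))
    all-energy : ∀ us → All (Unique ∘ proj₁) us → ∑ X (λ x → ∑ us (term x)) ℤ.≤ pos (order ℕ.* 12 ℕ.* total us)
    all-energy [] [] = subst₂ ℤ._≤_ (sym (∑-zero X)) (cong pos (sym (ℕ.*-zeroʳ (order ℕ.* 12)))) ℤ.≤-refl
    all-energy ((Y , j) ∷ us) (uY ∷ uus) = begin
      ∑ X (λ x → bias² Y j x ℤ.+ ∑ us (term x))
        ≡⟨ ∑-+ X (bias² Y j) (λ x → ∑ us (term x)) ⟩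
      ∑ X (bias² Y j) ℤ.+ ∑ X (λ x → ∑ us (term x))
        ≤⟨ ℤ.+-mono-≤ (ℤ.≤-trans (∑-unique-≤ uX (λ x → 0≤square (bias Y j x))) (∑-bias²-≤ uY j)) (all-energy us uus) ⟩
      pos 12 ℤ.* orderℤ ℤ.* pos (length Y) ℤ.+ pos (order ℕ.* 12 ℕ.* total us)
        ≡⟨ cong (ℤ._+ pos (order ℕ.* 12 ℕ.* total us)) (trans (cong (λ q → pos 12 ℤ.* q ℤ.* pos (length Y)) order≡)
             (trans (cong (ℤ._* pos (length Y)) (trans (sym (ℤ.pos-* 12 order)) (cong pos (ℕ.*-comm 12 order))))
                    (sym (ℤ.pos-* (order ℕ.* 12) (length Y))))) ⟩
      pos (order ℕ.* 12 ℕ.* length Y ℕ.+ order ℕ.* 12 ℕ.* total us)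
        ≡⟨ cong pos (sym (ℕ.*-distribˡ-+ (order ℕ.* 12) (length Y) (total us))) ⟩
      pos (order ℕ.* 12 ℕ.* (length Y ℕ.+ total us)) ∎

  apart : ∀ i j {x y} → i ≢ j → cl x ≡ κ i → cl y ≡ κ j → x ≢ y
  apart i j i≢j xi yj x≡y = i≢j (κ-injective {i} {j} (trans (sym xi) (trans (cong cl x≡y) yj)))

  0<-of : ∀ {m n} a b .{{_ : NonZero a}} → h ℕ.* a ℕ.≤ n ℕ.* b → m ≡ n → 0 ℕ.< m
  0<-of {n = zero}  a b ha≤ refl = contradiction ha≤ (ℕ.<⇒≱ (ℕ.>-nonZero⁻¹ (h ℕ.* a) {{ℕ.m*n≢0 h a}}))
  0<-of {n = suc n} a b ha≤ refl = ℕ.s≤s ℕ.z≤n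

  -- The differences a - c and b - d belong to both transversals of differences. With classes 0 and
  -- 1 given to them, {a - b, c - d} and {a - d, b - c} must each take the classes 2 and 3.
  record Quadruple : Set where
    field
      a b c d : Carrier
      a-colour : cl a ≡ κ 0F
      b-colour : cl b ≡ κ 1F
      c-colour : cl c ≡ κ 2F
      d-colour : cl d ≡ κ 3F
      ab : cl (a − b) ≡ κ 2F
      ac : cl (a − c) ≡ κ 0F
      ad : cl (a − d) ≡ κ 2F
      bc : cl (b − c) ≡ κ 3F
      bd : cl (b − d) ≡ κ 1F
      cd : cl (c − d) ≡ κ 3F

  opaque
    -- Each of a, b, c, d gets a class of its own to be chosen from, so an element chosen earlier is
    -- never a candidate later. Every choice thins out the candidates for the remaining letters by
    -- the class prescribed for their difference.
    choose : Quadruple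
    choose = from-a (select (class-unique 0F) (subst (0 ℕ.<_) (sym (length-class 0F)) (ℕ.>-nonZero⁻¹ h)) targets-a
                      (class-unique 1F ∷ class-unique 2F ∷ class-unique 3F ∷ []))
      where
      targets-a : List Target
      targets-a = (classOf 1F , 2F) ∷ (classOf 2F , 0F) ∷ (classOf 3F , 2F) ∷ []

      total-a : total targets-a ≡ h ℕ.* 3
      total-a = trans (cong₂ ℕ._+_ (length-class 1F) (cong₂ ℕ._+_ (length-class 2F) (cong (ℕ._+ 0) (length-class 3F)))) (ℕ.*-comm 3 h)

      module _ {a} (a∈ : a ∈ classOf 0F) where
        Bs Cs Ds : List Carrier
        Bs = count (classOf 1F) 2F a
        Cs = count (classOf 2F) 0F a
        Ds = count (classOf 3F) 2F a
        a-colour : cl a ≡ κ 0F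
        a-colour = ∈-class 0F a∈

        small-a : ∀ {i j} → length (classOf 0F) ℕ.* (deviation (classOf i) j a ℕ.* deviation (classOf i) j a) ℕ.≤ order ℕ.* 12 ℕ.* total targets-a →
                  deviation (classOf i) j a ℕ.* 15 ℕ.≤ h
        small-a {i} {j} bound = E.first-deviation (deviation (classOf i) j a)
          (subst₂ (λ m n → m ℕ.* (deviation (classOf i) j a ℕ.* deviation (classOf i) j a) ℕ.≤ order ℕ.* 12 ℕ.* n) (length-class 0F) total-a bound)

        size-a : ∀ i j → 0F ≢ i →
                 length (classOf 0F) ℕ.* (deviation (classOf i) j a ℕ.* deviation (classOf i) j a) ℕ.≤ order ℕ.* 12 ℕ.* total targets-a →
                 h ℕ.* 14 ℕ.≤ length (count (classOf i) j a) ℕ.* 60 × length (count (classOf i) j a) ℕ.* 60 ℕ.≤ h ℕ.* 16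
        size-a i j 0≢i bound =
          let lower , upper = count-bounds j (classOf i) (λ y∈ → apart 0F i 0≢i a-colour (∈-class i y∈))
          in E.window-lower {length (count (classOf i) j a)} {deviation (classOf i) j a}
               (subst (ℕ._≤ length (count (classOf i) j a) ℕ.* 4 ℕ.+ deviation (classOf i) j a) (length-class i) lower) (small-a {i} {j} bound) ,
             E.window-upper {length (count (classOf i) j a)} {deviation (classOf i) j a}
               (subst (λ n → length (count (classOf i) j a) ℕ.* 4 ℕ.≤ n ℕ.+ deviation (classOf i) j a) (length-class i) upper) (small-a {i} {j} bound)

        from-b : h ℕ.* 14 ℕ.≤ length Cs ℕ.* 60 → h ℕ.* 14 ℕ.≤ length Ds ℕ.* 60 →
                 (∀ {f} → length Bs ℕ.* (f ℕ.* f) ℕ.≤ order ℕ.* 12 ℕ.* (length Cs ℕ.+ (length Ds ℕ.+ 0)) → f ℕ.* 17 ℕ.≤ h) →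
                 (Σ Carrier λ b → b ∈ Bs × All (λ (Y , j) → length Bs ℕ.* (deviation Y j b ℕ.* deviation Y j b) ℕ.≤
                                               order ℕ.* 12 ℕ.* (length Cs ℕ.+ (length Ds ℕ.+ 0))) ((Cs , 3F) ∷ (Ds , 1F) ∷ [])) → Quadruple
        from-b C≥ D≥ small (b , b∈ , b-C ∷ b-D ∷ []) = from-c
            (select (count-unique 3F b (count-unique 0F a (class-unique 2F))) (0<-of 178 4080 Cs′≥ refl)
              ((Ds′ , 3F) ∷ []) (count-unique 1F b (count-unique 2F a (class-unique 3F)) ∷ []))
          where
          Cs′ = count Cs 3F b
          Ds′ = count Ds 1F b
          b-colour : cl b ≡ κ 1F
          b-colour = ∈-class 1F (proj₁ (∈-count {j = 2F} b∈))
          C-colour : ∀ {c} → c ∈ Cs → cl c ≡ κ 2F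
          C-colour c∈ = ∈-class 2F (proj₁ (∈-count {j = 0F} c∈))
          D-colour : ∀ {d} → d ∈ Ds → cl d ≡ κ 3F
          D-colour d∈ = ∈-class 3F (proj₁ (∈-count {j = 2F} d∈))
          Cs′≥ : h ℕ.* 178 ℕ.≤ length Cs′ ℕ.* 4080
          Cs′≥ = E.second-lower {length Cs} {length Cs′} {deviation Cs 3F b} C≥ (proj₁ (count-bounds 3F Cs λ c∈ → apart 1F 2F (λ ()) b-colour (C-colour c∈))) (small {deviation Cs 3F b} b-C)
          Ds′≥ : h ℕ.* 178 ℕ.≤ length Ds′ ℕ.* 4080
          Ds′≥ = E.second-lower {length Ds} {length Ds′} {deviation Ds 1F b} D≥ (proj₁ (count-bounds 1F Ds λ d∈ → apart 1F 3F (λ ()) b-colour (D-colour d∈))) (small {deviation Ds 1F b} b-D)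

          from-c : (Σ Carrier λ c → c ∈ Cs′ × All (λ (Y , j) → length Cs′ ℕ.* (deviation Y j c ℕ.* deviation Y j c) ℕ.≤
                                                  order ℕ.* 12 ℕ.* (length Ds′ ℕ.+ 0)) ((Ds′ , 3F) ∷ [])) → Quadruple
          from-c (c , c∈ , c-D ∷ []) = from-d (count Ds′ 3F c) refl
            where
            c∈C = proj₁ (∈-count {j = 3F} c∈)
            from-d : ∀ E → E ≡ count Ds′ 3F c → Quadruple
            -- With no candidate left for d, the count is 0 and the deviation reaches the size of
            -- `Ds′`, which `third-deviation` rules out.
            from-d [] empty = contradiction
              (subst (λ n → length Ds′ ℕ.≤ n ℕ.* 4 ℕ.+ deviation Ds′ 3F c) (cong length (sym empty))
                (proj₁ (count-bounds 3F Ds′ λ d∈ → apart 2F 3F (λ ()) (C-colour c∈C) (D-colour (proj₁ (∈-count {j = 1F} d∈))))))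
              (E.third-deviation {length Cs′} {length Ds′} {deviation Ds′ 3F c} Cs′≥ Ds′≥
                (subst (λ n → length Cs′ ℕ.* (deviation Ds′ 3F c ℕ.* deviation Ds′ 3F c) ℕ.≤ order ℕ.* 12 ℕ.* n) (ℕ.+-identityʳ (length Ds′)) c-D))
            from-d (d ∷ _) found = record
              { a = a ; b = b ; c = c ; d = d
              ; a-colour = a-colour ; b-colour = b-colour ; c-colour = C-colour c∈C ; d-colour = D-colour d∈D
              ; ab = proj₂ (∈-count {j = 2F} b∈)
              ; ac = proj₂ (∈-count {j = 0F} c∈C)
              ; ad = proj₂ (∈-count {j = 2F} d∈D)
              ; bc = proj₂ (∈-count {j = 3F} c∈)
              ; bd = proj₂ (∈-count {j = 1F} (proj₁ d∈))
              ; cd = proj₂ d∈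
              }
              where
              d∈ = ∈-count {j = 3F} (subst (d ∈_) found (here refl))
              d∈D = proj₁ (∈-count {j = 1F} (proj₁ d∈))

      from-a : (Σ Carrier λ a → a ∈ classOf 0F × All (λ (Y , j) → length (classOf 0F) ℕ.* (deviation Y j a ℕ.* deviation Y j a) ℕ.≤
                                                     order ℕ.* 12 ℕ.* total targets-a) targets-a) → Quadruple
      from-a (a , a∈ , a-B ∷ a-C ∷ a-D ∷ []) =
        let B≥ , _  = size-a a∈ 1F 2F (λ ()) a-B
            C≥ , C≤ = size-a a∈ 2F 0F (λ ()) a-C
            D≥ , D≤ = size-a a∈ 3F 2F (λ ()) a-D
        in from-b a∈ C≥ D≥
             (λ {f} bound → E.second-deviation {length (Bs a∈)} {length (Cs a∈)} {length (Ds a∈)} {f} B≥ C≤ D≤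
               (subst (λ n → length (Bs a∈) ℕ.* (f ℕ.* f) ℕ.≤ order ℕ.* 12 ℕ.* (length (Cs a∈) ℕ.+ n)) (ℕ.+-identityʳ (length (Ds a∈))) bound))
             (select (count-unique 2F a (class-unique 1F)) (0<-of 14 60 B≥ refl) ((Cs a∈ , 3F) ∷ (Ds a∈ , 1F) ∷ [])
               (count-unique 0F a (class-unique 2F) ∷ count-unique 2F a (class-unique 3F) ∷ []))

  nice-large : Nice Carrier _+_
  nice-large = nice-field a b c d
    (transversal id id λ { 0F → a-colour ; 1F → b-colour ; 2F → c-colour ; 3F → d-colour })
    λ { 0F → transversal π₀ (λ {i} {j} → π₀-injective i j) λ { 0F → ab ; 1F → cd ; 2F → ac ; 3F → bd }
      ; 1F → transversal π₁ (λ {i} {j} → π₁-injective i j) λ { 0F → ac ; 1F → ad ; 2F → bc ; 3F → bd } }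
    where
    open Quadruple choose
    π₀ π₁ : Fin 4 → Fin 4
    π₀ 0F = 2F
    π₀ 1F = 3F
    π₀ 2F = 0F
    π₀ 3F = 1F
    π₁ 0F = 0F
    π₁ 1F = 2F
    π₁ 2F = 3F
    π₁ 3F = 1F
    retraction : ∀ (π ρ : Fin 4 → Fin 4) → (∀ i → ρ (π i) ≡ i) → ∀ i j → π i ≡ π j → i ≡ j
    retraction π ρ ρπ i j eq = trans (sym (ρπ i)) (trans (cong ρ eq) (ρπ j))
    π₀-injective : ∀ i j → π₀ i ≡ π₀ j → i ≡ j
    π₀-injective = retraction π₀ π₀ λ { 0F → refl ; 1F → refl ; 2F → refl ; 3F → refl }
    π₁-injective : ∀ i j → π₁ i ≡ π₁ j → i ≡ j
    π₁-injective = retraction π₁ (π₁ ∘ π₁) λ { 0F → refl ; 1F → refl ; 2F → refl ; 3F → refl }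

-- Prime fields and quadratic extensions

module Residues (m : ℕ) where

  p : ℕ
  p = suc m

  infixl 7 _*ₚ_
  infixl 6 _+ₚ_

  _+ₚ_ _*ₚ_ : Op₂ (Fin p)
  _+ₚ_ = addFin
  x *ₚ y = (toℕ x ℕ.* toℕ y) mod p

  residue : ℕ → Fin p
  residue a = a mod p

  -ₚ_ : Op₁ (Fin p)
  -ₚ x = residue (p ∸ toℕ x)

  toℕ-residue : ∀ a → toℕ (residue a) ≡ a % p
  toℕ-residue a = Fin.toℕ-fromℕ< (m%n<n a p)

  residue-cong : ∀ a b → a % p ≡ b % p → residue a ≡ residue b
  residue-cong a b eq = Fin.toℕ-injective (trans (toℕ-residue a) (trans eq (sym (toℕ-residue b))))

  residue-injective : ∀ a b → residue a ≡ residue b → a % p ≡ b % p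
  residue-injective a b eq = trans (sym (toℕ-residue a)) (trans (cong toℕ eq) (toℕ-residue b))

  residue-toℕ : ∀ x → residue (toℕ x) ≡ x
  residue-toℕ x = Fin.toℕ-injective (trans (toℕ-residue (toℕ x)) (m<n⇒m%n≡m (Fin.toℕ<n x)))

  residue-+ : ∀ a b → residue a +ₚ residue b ≡ residue (a ℕ.+ b)
  residue-+ a b = residue-cong (toℕ (residue a) ℕ.+ toℕ (residue b)) (a ℕ.+ b) (trans (cong₂ (λ x y → (x ℕ.+ y) % p) (toℕ-residue a) (toℕ-residue b)) (sym (%-distribˡ-+ a b p)))

  residue-* : ∀ a b → residue a *ₚ residue b ≡ residue (a ℕ.* b)
  residue-* a b = residue-cong (toℕ (residue a) ℕ.* toℕ (residue b)) (a ℕ.* b) (trans (cong₂ (λ x y → (x ℕ.* y) % p) (toℕ-residue a) (toℕ-residue b)) (sym (%-distribˡ-* a b p)))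

  residue-p : residue p ≡ residue 0
  residue-p = residue-cong p 0 (n%n≡0 p)

  -- As `residue` is a surjective homomorphism, this lets each ring law descend from the same law in
  -- ℕ.
  on-representatives : ∀ {P : Fin p → Set} → (∀ a → P (residue a)) → ∀ x → P x
  on-representatives {P} f x = subst P (residue-toℕ x) (f (toℕ x))

  +-commₚ : ∀ x y → x +ₚ y ≡ y +ₚ x
  +-commₚ x y = cong residue (ℕ.+-comm (toℕ x) (toℕ y))

  *-commₚ : ∀ x y → x *ₚ y ≡ y *ₚ x
  *-commₚ x y = cong residue (ℕ.*-comm (toℕ x) (toℕ y))

  +-assocₚ : ∀ x y z → (x +ₚ y) +ₚ z ≡ x +ₚ (y +ₚ z)
  +-assocₚ = on-representatives λ a → on-representatives λ b → on-representatives λ c → begin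
    (residue a +ₚ residue b) +ₚ residue c ≡⟨ trans (cong (_+ₚ residue c) (residue-+ a b)) (residue-+ (a ℕ.+ b) c) ⟩
    residue ((a ℕ.+ b) ℕ.+ c)             ≡⟨ cong residue (ℕ.+-assoc a b c) ⟩
    residue (a ℕ.+ (b ℕ.+ c))             ≡⟨ sym (trans (cong (residue a +ₚ_) (residue-+ b c)) (residue-+ a (b ℕ.+ c))) ⟩
    residue a +ₚ (residue b +ₚ residue c) ∎
    where open ≡-Reasoning

  *-assocₚ : ∀ x y z → (x *ₚ y) *ₚ z ≡ x *ₚ (y *ₚ z)
  *-assocₚ = on-representatives λ a → on-representatives λ b → on-representatives λ c → begin
    (residue a *ₚ residue b) *ₚ residue c ≡⟨ trans (cong (_*ₚ residue c) (residue-* a b)) (residue-* (a ℕ.* b) c) ⟩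
    residue ((a ℕ.* b) ℕ.* c)             ≡⟨ cong residue (ℕ.*-assoc a b c) ⟩
    residue (a ℕ.* (b ℕ.* c))             ≡⟨ sym (trans (cong (residue a *ₚ_) (residue-* b c)) (residue-* a (b ℕ.* c))) ⟩
    residue a *ₚ (residue b *ₚ residue c) ∎
    where open ≡-Reasoning

  distribˡₚ : ∀ x y z → x *ₚ (y +ₚ z) ≡ x *ₚ y +ₚ x *ₚ z
  distribˡₚ = on-representatives λ a → on-representatives λ b → on-representatives λ c → begin
    residue a *ₚ (residue b +ₚ residue c)              ≡⟨ trans (cong (residue a *ₚ_) (residue-+ b c)) (residue-* a (b ℕ.+ c)) ⟩
    residue (a ℕ.* (b ℕ.+ c))                          ≡⟨ cong residue (ℕ.*-distribˡ-+ a b c) ⟩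
    residue (a ℕ.* b ℕ.+ a ℕ.* c)                      ≡⟨ sym (trans (cong₂ _+ₚ_ (residue-* a b) (residue-* a c)) (residue-+ (a ℕ.* b) (a ℕ.* c))) ⟩
    residue a *ₚ residue b +ₚ residue a *ₚ residue c   ∎
    where open ≡-Reasoning

  +-identityˡₚ : ∀ x → residue 0 +ₚ x ≡ x
  +-identityˡₚ = on-representatives (residue-+ 0)

  *-identityˡₚ : ∀ x → residue 1 *ₚ x ≡ x
  *-identityˡₚ = on-representatives λ a → trans (residue-* 1 a) (cong residue (ℕ.*-identityˡ a))

  -‿inverseʳₚ : ∀ x → x +ₚ (-ₚ x) ≡ residue 0
  -‿inverseʳₚ x = begin
    x +ₚ residue (p ∸ toℕ x)                  ≡⟨ cong (_+ₚ residue (p ∸ toℕ x)) (sym (residue-toℕ x)) ⟩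
    residue (toℕ x) +ₚ residue (p ∸ toℕ x)    ≡⟨ residue-+ (toℕ x) (p ∸ toℕ x) ⟩
    residue (toℕ x ℕ.+ (p ∸ toℕ x))           ≡⟨ cong residue (ℕ.m+[n∸m]≡n (ℕ.<⇒≤ (Fin.toℕ<n x))) ⟩
    residue p                                 ≡⟨ residue-p ⟩
    residue 0                                 ∎
    where open ≡-Reasoning

  +-isAbelianGroupₚ : IsAbelianGroup _≡_ _+ₚ_ (residue 0) -ₚ_
  +-isAbelianGroupₚ = record
    { isGroup = record
      { isMonoid = record
        { isSemigroup = record
          { isMagma = record { isEquivalence = isEquivalence ; ∙-cong = cong₂ _ }
          ; assoc = +-assocₚ }
        ; identity = +-identityˡₚ , λ x → trans (+-commₚ x (residue 0)) (+-identityˡₚ x) }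
      ; inverse = (λ x → trans (+-commₚ (-ₚ x) x) (-‿inverseʳₚ x)) , -‿inverseʳₚ
      ; ⁻¹-cong = cong -ₚ_ }
    ; comm = +-commₚ }

  isCommutativeRingₚ : IsCommutativeRing _≡_ _+ₚ_ _*ₚ_ -ₚ_ (residue 0) (residue 1)
  isCommutativeRingₚ = record
    { isRing = record
      { +-isAbelianGroup = +-isAbelianGroupₚ
      ; *-cong     = cong₂ _
      ; *-assoc    = *-assocₚ
      ; *-identity = *-identityˡₚ , λ x → trans (*-commₚ x (residue 1)) (*-identityˡₚ x)
      ; distrib    = distribˡₚ , λ x y z → trans (*-commₚ (y +ₚ z) x)
                       (trans (distribˡₚ x y z) (cong₂ _+ₚ_ (*-commₚ x y) (*-commₚ x z)))
      }
    ; *-comm = *-commₚ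
    }

  commutativeRingₚ : CommutativeRing 0ℓ 0ℓ
  commutativeRingₚ = record { isCommutativeRing = isCommutativeRingₚ }

  ℤₚ-group : Ab (Fin p) addFin
  ℤₚ-group = record { isAbelianGroup = +-isAbelianGroupₚ ; _≟_ = Fin._≟_ }

module PrimeField (m : ℕ) (prime-p : Prime (suc m)) where

  open Residues m

  invertₚ : ∀ x → x ≢ residue 0 → Σ (Fin p) λ y → x *ₚ y ≡ residue 1
  invertₚ zero      x≢0 = contradiction refl x≢0
  invertₚ x@(suc _) x≢0 with coprime-Bézout (prime⇒coprime prime-p (Fin.toℕ<n x))
  -- In this case 1 + v x = u p, so the inverse is -v; in the other case v x = 1 + u p and it is v.
  ... | Bézout.+- u v eq = (-ₚ residue v) , (begin
      x *ₚ (-ₚ residue v)  ≡⟨ sym (-‿distribʳ-* x (residue v)) ⟩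
      -ₚ (x *ₚ residue v)  ≡⟨ sym (inverseˡ-unique (residue 1) (x *ₚ residue v) 1+xv≡0) ⟩
      residue 1            ∎)
    where
    open ≡-Reasoning
    open RingProperties (CommutativeRing.ring commutativeRingₚ) using (-‿distribʳ-*)
    open AbelianGroupProperties (Ab.abelianGroup ℤₚ-group) using (inverseˡ-unique)
    1+xv≡0 : residue 1 +ₚ x *ₚ residue v ≡ residue 0
    1+xv≡0 = begin
      residue 1 +ₚ x *ₚ residue v                  ≡⟨ cong (λ y → residue 1 +ₚ y *ₚ residue v) (sym (residue-toℕ x)) ⟩
      residue 1 +ₚ residue (toℕ x) *ₚ residue v    ≡⟨ cong (residue 1 +ₚ_) (trans (residue-* (toℕ x) v) (cong residue (ℕ.*-comm (toℕ x) v))) ⟩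
      residue 1 +ₚ residue (v ℕ.* toℕ x)           ≡⟨ residue-+ 1 (v ℕ.* toℕ x) ⟩
      residue (1 ℕ.+ v ℕ.* toℕ x)                  ≡⟨ cong residue eq ⟩
      residue (u ℕ.* p)                            ≡⟨ residue-cong (u ℕ.* p) 0 ([m+kn]%n≡m%n 0 u p) ⟩
      residue 0                                    ∎
  ... | Bézout.-+ u v eq = residue v , (begin
      x *ₚ residue v                       ≡⟨ cong (_*ₚ residue v) (sym (residue-toℕ x)) ⟩
      residue (toℕ x) *ₚ residue v         ≡⟨ residue-* (toℕ x) v ⟩
      residue (toℕ x ℕ.* v)                ≡⟨ cong residue (trans (ℕ.*-comm (toℕ x) v) (sym eq)) ⟩
      residue (1 ℕ.+ u ℕ.* p)              ≡⟨ residue-cong (1 ℕ.+ u ℕ.* p) 1 ([m+kn]%n≡m%n 1 u p) ⟩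
      residue 1                            ∎)
    where open ≡-Reasoning

  1≢0ₚ : residue 1 ≢ residue 0
  1≢0ₚ eq = contradiction (trans (sym (m<n⇒m%n≡m {n = p} (ℕ.nonTrivial⇒n>1 p {{prime⇒nonTrivial prime-p}})))
                                 (residue-injective 1 0 eq)) λ ()

  𝔽ₚ : FiniteField
  𝔽ₚ = record
    { Carrier           = Fin p
    ; _+_               = _+ₚ_
    ; _*_               = _*ₚ_
    ; isCommutativeRing = isCommutativeRingₚ
    ; _≟_               = Fin._≟_
    ; 1≢0               = 1≢0ₚ
    ; invert            = invertₚ
    ; elements          = allFin p
    ; elements-unique   = Unique.allFin⁺ p
    ; ∈-elements        = ∈-allFin
    }

-- Mostly the two coordinates of the ring laws for numbers a + b √n. No negation occurs in them, so
-- they are identities of semirings.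
module CommutativeSemiringIdentities (R : CommutativeSemiring 0ℓ 0ℓ) where

  open CommutativeSemiring R hiding (refl)
  open SemiringSolver R
  open CommutativeSemiring R using () renaming (refl to ≈-refl)

  *-assoc-re : ∀ n a b c d e f → (a * c + n * (b * d)) * e + n * ((a * d + b * c) * f) ≈
                                 a * (c * e + n * (d * f)) + n * (b * (c * f + d * e))
  *-assoc-re = solve 7 (λ n a b c d e f →
    (a :* c :+ n :* (b :* d)) :* e :+ n :* ((a :* d :+ b :* c) :* f) :=
    a :* (c :* e :+ n :* (d :* f)) :+ n :* (b :* (c :* f :+ d :* e))) ≈-refl

  *-assoc-im : ∀ n a b c d e f → (a * c + n * (b * d)) * f + (a * d + b * c) * e ≈
                                 a * (c * f + d * e) + b * (c * e + n * (d * f))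
  *-assoc-im = solve 7 (λ n a b c d e f →
    (a :* c :+ n :* (b :* d)) :* f :+ (a :* d :+ b :* c) :* e :=
    a :* (c :* f :+ d :* e) :+ b :* (c :* e :+ n :* (d :* f))) ≈-refl

  distribˡ-re : ∀ n a b c d e f → a * (c + e) + n * (b * (d + f)) ≈ (a * c + n * (b * d)) + (a * e + n * (b * f))
  distribˡ-re = solve 7 (λ n a b c d e f →
    a :* (c :+ e) :+ n :* (b :* (d :+ f)) := (a :* c :+ n :* (b :* d)) :+ (a :* e :+ n :* (b :* f))) ≈-refl

  distribˡ-im : ∀ a b c d e f → a * (d + f) + b * (c + e) ≈ (a * d + b * c) + (a * f + b * e)
  distribˡ-im = solve 6 (λ a b c d e f →
    a :* (d :+ f) :+ b :* (c :+ e) := (a :* d :+ b :* c) :+ (a :* f :+ b :* e)) ≈-refl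

  *-interchange : ∀ a c → (a * c) * (a * c) ≈ (a * a) * (c * c)
  *-interchange = solve 2 (λ a c → (a :* c) :* (a :* c) := (a :* a) :* (c :* c)) ≈-refl

  *-swapˡ : ∀ b a c → b * (a * c) ≈ a * (b * c)
  *-swapˡ = solve 3 (λ b a c → b :* (a :* c) := a :* (b :* c)) ≈-refl

-- The pair (a , b) stands for a + b √n.
module Quadratic (𝔽 : FiniteField) (n : FiniteField.Carrier 𝔽)
                 (nonsquare : ∀ x → FiniteField._*_ 𝔽 x x ≢ n) where

  open FieldProperties 𝔽

  open CommutativeSemiringIdentities commutativeSemiring

  K : Set
  K = Carrier × Carrier

  _*ₖ_ : Op₂ K
  (a , b) *ₖ (c , d) = a * c + n * (b * d) , a * d + b * c

  -ₖ_ : Op₁ K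
  -ₖ (a , b) = - a , - b

  *-commₖ : ∀ x y → x *ₖ y ≡ y *ₖ x
  *-commₖ (a , b) (c , d) = cong₂ _,_ (first a b c d) (second a b c d)
    where
    first : ∀ a b c d → a * c + n * (b * d) ≡ c * a + n * (d * b)
    first a b c d = cong₂ _+_ (*-comm a c) (cong (n *_) (*-comm b d))
    second : ∀ a b c d → a * d + b * c ≡ c * b + d * a
    second a b c d = trans (+-comm (a * d) (b * c)) (cong₂ _+_ (*-comm b c) (*-comm a d))

  *-assocₖ : ∀ x y z → (x *ₖ y) *ₖ z ≡ x *ₖ (y *ₖ z)
  *-assocₖ (a , b) (c , d) (e , f) = cong₂ _,_ (*-assoc-re n a b c d e f) (*-assoc-im n a b c d e f)

  distribˡₖ : ∀ x y z → x *ₖ ((_+_ ×-add _+_) y z) ≡ (_+_ ×-add _+_) (x *ₖ y) (x *ₖ z)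
  distribˡₖ (a , b) (c , d) (e , f) = cong₂ _,_ (distribˡ-re n a b c d e f) (distribˡ-im a b c d e f)

  *-identityˡₖ : ∀ x → (1# , 0#) *ₖ x ≡ x
  *-identityˡₖ (a , b) = cong₂ _,_
    (trans (cong₂ _+_ (*-identityˡ a) (trans (cong (n *_) (zeroˡ b)) (zeroʳ n))) (+-identityʳ a))
    (trans (cong₂ _+_ (*-identityˡ b) (zeroˡ a)) (+-identityʳ b))

  field-group : Ab Carrier _+_
  field-group = record { isAbelianGroup = +-isAbelianGroup ; _≟_ = _≟_ }

  isCommutativeRingₖ : IsCommutativeRing _≡_ (_+_ ×-add _+_) _*ₖ_ -ₖ_ (0# , 0#) (1# , 0#)
  isCommutativeRingₖ = record
    { isRing = record
      { +-isAbelianGroup = Ab.isAbelianGroup (×-Ab field-group field-group)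
      ; *-cong     = cong₂ _
      ; *-assoc    = *-assocₖ
      ; *-identity = *-identityˡₖ , λ x → trans (*-commₖ x (1# , 0#)) (*-identityˡₖ x)
      ; distrib    = distribˡₖ , λ x y z → trans (*-commₖ ((_+_ ×-add _+_) y z) x)
                       (trans (distribˡₖ x y z) (cong₂ (_+_ ×-add _+_) (*-commₖ x y) (*-commₖ x z)))
      }
    ; *-comm = *-commₖ
    }

  norm : K → Carrier
  norm (a , b) = a * a − n * (b * b)

  -- From a² = n b² with b ≠ 0, n would be the square of a / b; with b = 0 also a = 0.
  norm-nonzero : ∀ {x} → x ≢ (0# , 0#) → norm x ≢ 0#
  norm-nonzero {a , b} x≢0 norm≡0 with b ≟ 0#
  ... | yes refl = a²≢0 (a ≟ 0#)
    where
    a²≢0 : ¬ Dec (a ≡ 0#)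
    a²≢0 (yes refl) = x≢0 refl
    a²≢0 (no a≢0)   = *-nonzero a≢0 a≢0 (trans (x∙y⁻¹≈ε⇒x≈y _ _ norm≡0) (trans (cong (n *_) (zeroˡ 0#)) (zeroʳ n)))
  ... | no b≢0 = nonsquare (a * c) (begin
      (a * c) * (a * c)        ≡⟨ *-interchange a c ⟩
      (a * a) * (c * c)        ≡⟨ cong (_* (c * c)) (x∙y⁻¹≈ε⇒x≈y _ _ norm≡0) ⟩
      (n * (b * b)) * (c * c)  ≡⟨ trans (*-assoc n (b * b) (c * c)) (cong (n *_) (sym (*-interchange b c))) ⟩
      n * ((b * c) * (b * c))  ≡⟨ cong (n *_) (trans (cong₂ _*_ bc≡1 bc≡1) (*-identityˡ 1#)) ⟩
      n * 1#                   ≡⟨ *-identityʳ n ⟩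
      n                        ∎)
    where
    open ≡-Reasoning
    c = proj₁ (invert b b≢0)
    bc≡1 = proj₂ (invert b b≢0)

  invertₖ : ∀ x → x ≢ (0# , 0#) → Σ K λ y → x *ₖ y ≡ (1# , 0#)
  invertₖ (a , b) x≢0 = (a * c , - (b * c)) , cong₂ _,_
    (begin
      a * (a * c) + n * (b * (- (b * c)))  ≡⟨ cong₂ _+_ (sym (*-assoc a a c))
                                               (trans (cong (n *_) (sym (-‿distribʳ-* b (b * c)))) (sym (-‿distribʳ-* n (b * (b * c))))) ⟩
      (a * a) * c − n * (b * (b * c))      ≡⟨ cong (λ z → (a * a) * c − z) (trans (cong (n *_) (sym (*-assoc b b c))) (sym (*-assoc n (b * b) c))) ⟩
      (a * a) * c − (n * (b * b)) * c      ≡⟨ cong (_+_ ((a * a) * c)) (-‿distribˡ-* (n * (b * b)) c) ⟩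
      (a * a) * c + (- (n * (b * b))) * c  ≡⟨ sym (distribʳ c (a * a) (- (n * (b * b)))) ⟩
      norm (a , b) * c                     ≡⟨ proj₂ (invert (norm (a , b)) (norm-nonzero x≢0)) ⟩
      1#                                   ∎)
    (begin
      a * (- (b * c)) + b * (a * c)        ≡⟨ cong₂ _+_ (sym (-‿distribʳ-* a (b * c))) (*-swapˡ b a c) ⟩
      (- (a * (b * c))) + a * (b * c)      ≡⟨ -‿inverseˡ (a * (b * c)) ⟩
      0#                                   ∎)
    where
    open ≡-Reasoning
    c = proj₁ (invert (norm (a , b)) (norm-nonzero x≢0))

  extension : FiniteField
  extension = record
    { Carrier           = K
    ; _+_               = _+_ ×-add _+_
    ; _*_               = _*ₖ_
    ; isCommutativeRing = isCommutativeRingₖ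
    ; _≟_               = ≡-dec _≟_ _≟_
    ; 1≢0               = 1≢0 ∘ cong proj₁
    ; invert            = invertₖ
    ; elements          = cartesianProduct elements elements
    ; elements-unique   = Unique.cartesianProduct⁺ elements-unique elements-unique
    ; ∈-elements        = λ (x , y) → ∈-cartesianProduct⁺ (∈-elements x) (∈-elements y)
    }

length-cartesianProduct : ∀ {A B : Set} (xs : List A) (ys : List B) →
                          length (cartesianProduct xs ys) ≡ length xs ℕ.* length ys
length-cartesianProduct []       ys = refl
length-cartesianProduct (x ∷ xs) ys = trans (length-++ (map (x ,_) ys))
  (cong₂ ℕ._+_ (length-map (x ,_) ys) (length-cartesianProduct xs ys))

-- Certificates

∧-true : ∀ {a b} → (a ∧ b) ≡ true → a ≡ true × b ≡ true
∧-true {true} {true} refl = refl , refl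

not-true : ∀ {b} → not b ≡ true → b ≡ false
not-true {false} refl = refl

all-∈ : ∀ {A : Set} (f : A → Bool) xs → all f xs ≡ true → ∀ {x} → x ∈ xs → f x ≡ true
all-∈ f (x ∷ xs) eq (here refl) = proj₁ (∧-true eq)
all-∈ f (x ∷ xs) eq (there x∈)  = all-∈ f xs (proj₂ (∧-true {f x} eq)) x∈

≡⇒≡ᵇ≡true : ∀ {m n} → m ≡ n → (m ≡ᵇ n) ≡ true
≡⇒≡ᵇ≡true {m} {n} eq = Equivalence.to T-≡ (ℕ.≡⇒≡ᵇ m n eq)

-- Numerals standing for field elements, so that conditions on powers can be evaluated.
record Numerals : Set₁ where
  field
    Code       : Set
    mul sub    : Code → Code → Code
    zeroC oneC : Code
    same       : Code → Code → Bool

  powers : Code → ℕ → Code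
  powers x zero    = oneC
  powers x (suc n) = mul x (powers x n)

  -- Square and multiply; the last argument is fuel, and `powers` is never reached when it exceeds log₂ n.
  power : Code → ℕ → ℕ → Code
  power x n       zero    = powers x n
  power x zero    (suc f) = oneC
  power x (suc n) (suc f) with power (mul x x) (suc n / 2) f
  ... | y = if suc n % 2 ≡ᵇ 0 then y else mul x y

  separated : List Code → Bool
  separated []       = true
  separated (x ∷ xs) = all (λ y → not (same x y)) xs ∧ separated xs

  -- Listing `zeroC` next to the four characters makes the same test show that the elements are
  -- nonzero. The fuel 20 suffices, as all exponents that occur are below 2¹⁵.
  transversal? : ℕ → Code → Code → Code → Code → Bool
  transversal? h a b c d =
    separated (zeroC ∷ power a h 20 ∷ power b h 20 ∷ power c h 20 ∷ power d h 20 ∷ [])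

  certified? : ℕ → Code → Code → Code → Code → Bool
  certified? h a b c d = transversal? h a b c d
    ∧ (transversal? h (sub a b) (sub c d) (sub a c) (sub b d) ∧ transversal? h (sub a c) (sub a d) (sub b c) (sub b d))

-- Certificates assert that values differ, which explains the direction of `same-complete`: equal
-- values are reported as the same, so codes found distinct have distinct values.
record Interpretation (N : Numerals) (𝔽 : FiniteField) : Set where
  open Numerals N
  open FieldProperties 𝔽
  field
    value         : Code → Carrier
    value-mul     : ∀ x y → value (mul x y) ≡ value x * value y
    value-sub     : ∀ x y → value (sub x y) ≡ value x − value y
    value-zero    : value zeroC ≡ 0#
    value-one     : value oneC ≡ 1#
    same-complete : ∀ x y → value x ≡ value y → same x y ≡ true

  value-powers : ∀ x n → value (powers x n) ≡ value x ^ n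
  value-powers x zero    = value-one
  value-powers x (suc n) = trans (value-mul x (powers x n)) (cong (value x *_) (value-powers x n))

  value-power : ∀ x n f → value (power x n f) ≡ value x ^ n
  value-power x n       zero    = value-powers x n
  value-power x zero    (suc f) = value-one
  value-power x (suc n) (suc f) = by-parity (suc n % 2) refl
    where
    y = power (mul x x) (suc n / 2) f
    half = suc n / 2
    value-y : value y ≡ value x ^ (half ℕ.* 2)
    value-y = begin
      value y                          ≡⟨ value-power (mul x x) half f ⟩
      value (mul x x) ^ half           ≡⟨ cong (_^ half) (value-mul x x) ⟩
      (value x * value x) ^ half       ≡⟨ ^-distrib-* (value x) (value x) half ⟩
      value x ^ half * value x ^ half  ≡⟨ sym (^-2* (value x) half) ⟩
      value x ^ (2 ℕ.* half)           ≡⟨ cong (value x ^_) (ℕ.*-comm 2 half) ⟩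
      value x ^ (half ℕ.* 2)           ∎
      where open ≡-Reasoning
    by-parity : ∀ d → suc n % 2 ≡ d → value (if suc n % 2 ≡ᵇ 0 then y else mul x y) ≡ value x ^ suc n
    by-parity zero eq rewrite eq = trans value-y
      (cong (value x ^_) (sym (trans (m≡m%n+[m/n]*n (suc n) 2) (cong (ℕ._+ half ℕ.* 2) eq))))
    by-parity (suc zero) eq rewrite eq = trans (value-mul x y) (trans (cong (value x *_) value-y)
      (cong (value x ^_) (sym (trans (m≡m%n+[m/n]*n (suc n) 2) (cong (ℕ._+ half ℕ.* 2) eq)))))
    by-parity (suc (suc d)) eq = contradiction (subst (ℕ._< 2) eq (m%n<n (suc n) 2)) λ { (ℕ.s≤s (ℕ.s≤s ())) }

  separated-head : ∀ {x xs} → separated (x ∷ xs) ≡ true → ∀ {y} → y ∈ xs → value x ≢ value y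
  separated-head {x} {xs} sep {y} y∈ eq = contradiction (same-complete x y eq)
    (not-¬ (not-true (all-∈ (λ y → not (same x y)) xs (proj₁ (∧-true sep)) y∈)))

  separated-tail : ∀ {x xs} → separated (x ∷ xs) ≡ true → separated xs ≡ true
  separated-tail {x} {xs} sep = proj₂ (∧-true {all (λ y → not (same x y)) xs} sep)

module Certificate {N : Numerals} {𝔽 : FiniteField} (interpretation : Interpretation N 𝔽) where

  open FieldProperties 𝔽
  open Numerals N
  open Interpretation interpretation

  module _ (k : ℕ) {{k≢0 : NonZero k}} (size : length units ≡ 8 ℕ.* k) where

    open Classes 𝔽 k size
    open Transversal

    codes : Code → Code → Code → Code → Fin 4 → Code
    codes a b c d 0F = a
    codes a b c d 1F = b
    codes a b c d 2F = c
    codes a b c d 3F = d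

    transversal-sound : ∀ {e : Fin 4 → Carrier} a b c d → (∀ j → e j ≡ value (codes a b c d j)) →
                        transversal? h a b c d ≡ true → Transversal e
    transversal-sound {e} a b c d e≗ sep = record
      { nonzero  = λ j ej≡0 → zero-apart j (trans value-zero (trans (sym cl-0) (trans (cong cl (sym ej≡0)) (cl-e j))))
      ; distinct = λ {i} {j} eq → same-index i j (trans (sym (cl-e i)) (trans eq (cl-e j)))
      }
      where
      C = λ j → power (codes a b c d j) h 20
      cl-e : ∀ j → cl (e j) ≡ value (C j)
      cl-e j = trans (cong cl (e≗ j)) (sym (value-power (codes a b c d j) h 20))
      sep₁ = separated-tail {zeroC} {C 0F ∷ C 1F ∷ C 2F ∷ C 3F ∷ []} sep
      sep₂ = separated-tail {C 0F} {C 1F ∷ C 2F ∷ C 3F ∷ []} sep₁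
      sep₃ = separated-tail {C 1F} {C 2F ∷ C 3F ∷ []} sep₂
      head₀ = separated-head {zeroC} {C 0F ∷ C 1F ∷ C 2F ∷ C 3F ∷ []} sep
      head₁ = separated-head {C 0F} {C 1F ∷ C 2F ∷ C 3F ∷ []} sep₁
      head₂ = separated-head {C 1F} {C 2F ∷ C 3F ∷ []} sep₂
      head₃ = separated-head {C 2F} {C 3F ∷ []} sep₃
      zero-apart : ∀ j → value zeroC ≢ value (C j)
      zero-apart 0F = head₀ (here refl)
      zero-apart 1F = head₀ (there (here refl))
      zero-apart 2F = head₀ (there (there (here refl)))
      zero-apart 3F = head₀ (there (there (there (here refl))))
      same-index : ∀ i j → value (C i) ≡ value (C j) → i ≡ j
      same-index 0F 0F _  = refl
      same-index 0F 1F eq = contradiction eq (head₁ (here refl))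
      same-index 0F 2F eq = contradiction eq (head₁ (there (here refl)))
      same-index 0F 3F eq = contradiction eq (head₁ (there (there (here refl))))
      same-index 1F 1F _  = refl
      same-index 1F 2F eq = contradiction eq (head₂ (here refl))
      same-index 1F 3F eq = contradiction eq (head₂ (there (here refl)))
      same-index 2F 2F _  = refl
      same-index 2F 3F eq = contradiction eq (head₃ (here refl))
      same-index 3F 3F _  = refl
      same-index 1F 0F eq = contradiction (sym eq) (head₁ (here refl))
      same-index 2F 0F eq = contradiction (sym eq) (head₁ (there (here refl)))
      same-index 3F 0F eq = contradiction (sym eq) (head₁ (there (there (here refl))))
      same-index 2F 1F eq = contradiction (sym eq) (head₂ (here refl))
      same-index 3F 1F eq = contradiction (sym eq) (head₂ (there (here refl)))
      same-index 3F 2F eq = contradiction (sym eq) (head₃ (here refl))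

    nice-certified : ∀ a b c d → certified? h a b c d ≡ true → Nice Carrier _+_
    nice-certified a b c d ok = nice-field (value a) (value b) (value c) (value d)
      (transversal-sound a b c d (λ { 0F → refl ; 1F → refl ; 2F → refl ; 3F → refl }) (proj₁ parts))
      λ { 0F → transversal-sound (sub a b) (sub c d) (sub a c) (sub b d)
                 (λ { 0F → sym (value-sub a b) ; 1F → sym (value-sub c d) ; 2F → sym (value-sub a c) ; 3F → sym (value-sub b d) })
                 (proj₁ differences)
        ; 1F → transversal-sound (sub a c) (sub a d) (sub b c) (sub b d)
                 (λ { 0F → sym (value-sub a c) ; 1F → sym (value-sub a d) ; 2F → sym (value-sub b c) ; 3F → sym (value-sub b d) })
                 (proj₂ differences) }
      where
      parts = ∧-true {transversal? h a b c d} ok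
      differences = ∧-true {transversal? h (sub a b) (sub c d) (sub a c) (sub b d)} (proj₂ parts)

residueNumerals : ℕ → Numerals
residueNumerals m = record
  { Code  = ℕ
  ; mul   = λ x y → (x ℕ.* y) % suc m
  ; sub   = λ x y → x ℕ.+ (suc m ∸ y % suc m)
  ; zeroC = 0
  ; oneC  = 1
  ; same  = λ x y → (x % suc m) ≡ᵇ (y % suc m)
  }

quadraticNumerals : ℕ → ℕ → Numerals
quadraticNumerals m n = record
  { Code  = ℕ × ℕ
  ; mul   = λ (a , b) (c , d) → (a ℕ.* c ℕ.+ n ℕ.* (b ℕ.* d)) % suc m , (a ℕ.* d ℕ.+ b ℕ.* c) % suc m
  ; sub   = λ (a , b) (c , d) → sub a c , sub b d
  ; zeroC = 0 , 0
  ; oneC  = 1 , 0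
  ; same  = λ (a , b) (c , d) → same a c ∧ same b d
  }
  where open Numerals (residueNumerals m)

module PrimeInterpretation (m : ℕ) (prime-p : Prime (suc m)) where

  open Residues m
  open PrimeField m prime-p

  interpretation : Interpretation (residueNumerals m) 𝔽ₚ
  interpretation = record
    { value         = residue
    ; value-mul     = λ x y → trans (residue-cong ((x ℕ.* y) % p) (x ℕ.* y) (m%n%n≡m%n (x ℕ.* y) p)) (sym (residue-* x y))
    ; value-sub     = λ x y → trans (sym (residue-+ x (p ∸ y % p))) (cong (λ z → residue x +ₚ residue (p ∸ z)) (sym (toℕ-residue y)))
    ; value-zero    = refl
    ; value-one     = refl
    ; same-complete = λ x y eq → ≡⇒≡ᵇ≡true (residue-injective x y eq)
    }

  length-elements : length (FieldProperties.elements 𝔽ₚ) ≡ p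
  length-elements = length-tabulate id

module QuadraticInterpretation (m : ℕ) (prime-p : Prime (suc m)) (n : ℕ)
                               (nonsquare : ∀ x → FiniteField._*_ (PrimeField.𝔽ₚ m prime-p) x x ≢ Residues.residue m n) where

  open Residues m
  open PrimeField m prime-p
  open PrimeInterpretation m prime-p
  open Interpretation interpretation
  open Quadratic 𝔽ₚ (residue n) nonsquare

  residue-% : ∀ a → residue (a % p) ≡ residue a
  residue-% a = residue-cong (a % p) a (m%n%n≡m%n a p)

  interpretationₖ : Interpretation (quadraticNumerals m n) extension
  interpretationₖ = record
    { value         = λ (a , b) → residue a , residue b
    ; value-mul     = λ (a , b) (c , d) → cong₂ _,_
        (trans (residue-% (a ℕ.* c ℕ.+ n ℕ.* (b ℕ.* d))) (sym (trans
          (cong₂ _+ₚ_ (residue-* a c) (trans (cong (residue n *ₚ_) (residue-* b d)) (residue-* n (b ℕ.* d))))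
          (residue-+ (a ℕ.* c) (n ℕ.* (b ℕ.* d))))))
        (trans (residue-% (a ℕ.* d ℕ.+ b ℕ.* c)) (sym (trans
          (cong₂ _+ₚ_ (residue-* a d) (residue-* b c)) (residue-+ (a ℕ.* d) (b ℕ.* c)))))
    ; value-sub     = λ (a , b) (c , d) → cong₂ _,_ (value-sub a c) (value-sub b d)
    ; value-zero    = refl
    ; value-one     = refl
    ; same-complete = λ (a , b) (c , d) eq →
        cong₂ _∧_ (same-complete a c (cong proj₁ eq)) (same-complete b d (cong proj₂ eq))
    }

divides? : ℕ → ℕ → Bool
divides? zero    n = false
divides? (suc d) n = (n % suc d) ≡ᵇ 0

properDivisor? : ℕ → ℕ → Bool
properDivisor? n d = (1 <ᵇ d) ∧ ((d <ᵇ n) ∧ divides? d n)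

properDivisor-sound : ∀ n d → properDivisor? n d ≡ true → Composite n
properDivisor-sound n (suc d) eq =
  let 1<d , rest = ∧-true {1 <ᵇ suc d} eq
      d<n , d∣n = ∧-true {suc d <ᵇ n} rest
  in hasNonTrivialDivisor {divisor = suc d} {{ℕ.n>1⇒nonTrivial (ℕ.<ᵇ⇒< 1 (suc d) (Equivalence.from T-≡ 1<d))}}
       (ℕ.<ᵇ⇒< (suc d) n (Equivalence.from T-≡ d<n))
       (m%n≡0⇒n∣m n (suc d) (ℕ.≡ᵇ⇒≡ (n % suc d) 0 (Equivalence.from T-≡ d∣n)))

-- The next prime is 367, and 367² = 134689 exceeds 8 · 16383 + 1 = 131065. Trial division is
-- therefore exact in the range of both scans, and table entries are spent on primes only.
smallPrimes : List ℕ
smallPrimes = 2 ∷ 3 ∷ 5 ∷ 7 ∷ 11 ∷ 13 ∷ 17 ∷ 19 ∷ 23 ∷ 29 ∷ 31 ∷ 37 ∷ 41 ∷ 43 ∷ 47 ∷ 53 ∷ 59 ∷ 61 ∷ 67 ∷ 71 ∷ 73 ∷ 79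
  ∷ 83 ∷ 89 ∷ 97 ∷ 101 ∷ 103 ∷ 107 ∷ 109 ∷ 113 ∷ 127 ∷ 131 ∷ 137 ∷ 139 ∷ 149 ∷ 151 ∷ 157 ∷ 163 ∷ 167 ∷ 173 ∷ 179 ∷ 181
  ∷ 191 ∷ 193 ∷ 197 ∷ 199 ∷ 211 ∷ 223 ∷ 227 ∷ 229 ∷ 233 ∷ 239 ∷ 241 ∷ 251 ∷ 257 ∷ 263 ∷ 269 ∷ 271 ∷ 277 ∷ 281 ∷ 283
  ∷ 293 ∷ 307 ∷ 311 ∷ 313 ∷ 317 ∷ 331 ∷ 337 ∷ 347 ∷ 349 ∷ 353 ∷ 359 ∷ []

composite? : ℕ → Bool
composite? n = any (properDivisor? n) smallPrimes

composite?-sound : ∀ n → Prime n → composite? n ≡ false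
composite?-sound n prime-n = go smallPrimes
  where
  go : ∀ ds → any (properDivisor? n) ds ≡ false
  go []       = refl
  go (d ∷ ds) with properDivisor? n d in eq
  ... | true  = contradiction (properDivisor-sound n d eq) (prime⇒¬composite prime-n)
  ... | false = go ds

-- An entry is consumed only where i is not skipped, so the tables need not name their primes.
-- Entries left over are harmless, such as the zeros with which `digits` fills up the last row of
-- `primeTable`.
scan : (ℕ → Bool) → (ℕ → ℕ → Bool) → ℕ → ℕ → List ℕ → Bool
scan skip check zero    i es = true
scan skip check (suc f) i es with skip i
scan skip check (suc f) i es       | true  = scan skip check f (suc i) es
scan skip check (suc f) i []       | false = false
scan skip check (suc f) i (e ∷ es) | false = check i e ∧ scan skip check f (suc i) es

scan-sound : ∀ skip check f i es → scan skip check f i es ≡ true →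
             ∀ j → i ℕ.≤ j → j ℕ.< i ℕ.+ f → skip j ≡ false → Σ ℕ λ e → check j e ≡ true
scan-sound skip check zero i es eq j i≤j j< _ =
  contradiction i≤j (ℕ.<⇒≱ (subst (j ℕ.<_) (ℕ.+-identityʳ i) j<))
scan-sound skip check (suc f) i es eq j i≤j j< kept with skip i in skip-i
scan-sound skip check (suc f) i es eq j i≤j j< kept | true =
  scan-sound skip check f (suc i) es eq j
    (ℕ.≤∧≢⇒< i≤j λ { refl → contradiction (trans (sym skip-i) kept) λ () })
    (subst (j ℕ.<_) (ℕ.+-suc i f) j<) kept
scan-sound skip check (suc f) i (e ∷ es) eq j i≤j j< kept | false with i ℕ.≟ j
... | yes refl = e , proj₁ (∧-true eq)
... | no i≢j   = scan-sound skip check f (suc i) es (proj₂ (∧-true {check i e} eq)) j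
    (ℕ.≤∧≢⇒< i≤j i≢j) (subst (j ℕ.<_) (ℕ.+-suc i f) j<) kept

-- Small fields

-- For the primes 8 k + 1 ≥ 41 in increasing order: b, c and d, for a = 1, with two decimal digits each.
-- A row covers fourteen primes, the first one in its lowest digits.
primeTable : List ℕ
primeTable =
  192726101215021517060921270625071320060927201114102111031013050810101523061317281720 ∷
  30609052111030706061817143031071811391425030609030609051215030609071114140307030609 ∷
  220721112322071917050712152426112722051015111213054225030609050712060708111214132915 ∷
  153418091322071821031022051114031309030609072226101820181112211214061018132942061018 ∷
  211214030609180513071508061413182837051815401129050712211214093027100207071419232438 ∷
  331822373852341822111213061413051525051015134039152819280814141011230813072215032114 ∷
  100207101215102631030609030508060921192426051215123941091022060921031110030609144339 ∷
  30706101215061018102715030609071514053136072215121415053431030827121926031417061319 ∷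
  30609061413021520220708032030251015192041030723121314105223021507111324071512123413 ∷
  102322071524021215111214112330032215112628390821100207102138050712123429122022223935 ∷
  220315122331201215032009032023030706022313102631060921200619101438111324050615252647 ∷
  143221050615052631301119022112214746191218091215051124081422171824030609061018193540 ∷
  31413092215070824302325061413032009070821273839152928142340030609030508202722151920 ∷
  31922132934051114192024030609030508051215061413111213182827132018050810060708113433 ∷
  123433051015152625071912030508072130102320051210031322113415102333152221152221060708 ∷
  200610301119070833143128050810071220251015331426031518062320031309060708131526061817 ∷
  272830182027052535131826050615031309143029132026071508061833072221031318051015030508 ∷
  280814050615091424385560143029152221192138093027192024032027212649060708050810152221 ∷
  462029100207200610380715113022030609220708031322031013182331121314050810060921180513 ∷
  270609202231061517100207173047031821071312141011071214030706072221291824022313030706 ∷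
  50612190717060708051412123851112028062223061312152221132942072215100207050712051525 ∷
  30609112342071018151920392324071811071514111213030609051215061412252645030609071214 ∷
  31318060708102430182427152221256762111820142521141524072221052111143235053125030609 ∷
  331824051811180711030609051114061018103853052111201318030706061208030609050810143029 ∷
  301317112422030609131434121927100207082310153825193942121817061327082019190717050619 ∷
  371130130612122218122322122015102311113125072021200619192342180513203557030609132022 ∷
  30706113130081114030720032831071508280814030706131415331822122835030609381819121918 ∷
  121422060812052429032008050615031110071508060708301119062230031013060708200610131526 ∷
  210318050615060708030706061208100207031309152221270609021510210318173234030609030508 ∷
  91120192641032215060708071820144425030609111812030609236257143843093039141823083926 ∷
  53125073423222335051015302325050712061420030508202333072037132018071024531142061018 ∷
  51215124241031922190313111233031309070821102423100207100207030706072008215774030609 ∷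
  151824081514212344060708071012060921120608050810021507050612081514051215141821131418 ∷
  55234030609072221220709073015240915133528070822272830030609081519061018172530131432 ∷
  61912142421060927072220100207200617121918251015234249052934070822270609101820051015 ∷
  31518182023115655030609174259082331112628091227071508060812240214102423070822462635 ∷
  142029031309050618081519152025032114421527141523071114032329235761051210030609051419 ∷
  31518071214100207122946201517071508071508031913062221060927021510101512391013071508 ∷
  50810100207111822132726032809091712112022182427343547190618222635092427132426102217 ∷
  272026132026030609102430072221316647030609060921100207030609101512142719131914112423 ∷
  213435030508061912740753071508111433030609061412071912102715091120060812071508030609 ∷
  20719112625032233132026083851101512092027341226071214031322091022200619051435030609 ∷
  71512050615061413392324022921190717141534102344031318063437050712072221101424030706 ∷
  60708030609112322071508030508050810301119021119181013055946051412031309030609223433 ∷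
  31114073929153121050810030706060708220708051015173542030609201215072736030706072035 ∷
  61817060720051412272836101526071508072015071012200617030609051015114833030609030609 ∷
  100207071508174434070821122625101215070821092623143835050712072221073041220319112312 ∷
  223233073833091215081114052111120608112722061413071508271012061523061417101722061413 ∷
  331822101215062018121913112022063427051215131418120608100207032013101215091021061018 ∷
  52926111820151927182023144331030609220708051114032215052715531334072221032831030508 ∷
  30609240717062018060708030609091120182830113830031925132726061208050810233962061114 ∷
  113933152221053028031309031013200610112022102123030706070822051322091322071012396059 ∷
  72221200315031821113412071514051525210318152221132026031333051015061413604750031309 ∷
  172034021119062733071538032114081514111324052310030508200811030609152320141011121422 ∷
  315160124143062221253156280514102333623839052114091227382023220721030609072215020719 ∷
  132726050615303542031821052114073138030706102118402325030609030609082319071918120608 ∷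
  100207152025072924031309131526051015073833102333060708070822020313125243050615050810 ∷
  101215270912260813060708052111031110145251230617030609050810192041280814072426032114 ∷
  174158120608071512230620021215131826386047061413632035172427152221202423242021050615 ∷
  61413060708202827071821111214140307121817121419220721220708030609050712061018072221 ∷
  30609220708052715030609071912031922061018253130206249235852051015101512051215280814 ∷
  60708213938053846031013223837021417030609052631100207061912280814091215020313102127 ∷
  91527051114022343143029031022021435182827051215071214061923030508092215173234030609 ∷
  113117021113050712123433051810052119153834101215192738221819130612022313192256071012 ∷
  502631233842031518112312171823051015030609071508200313152628071514091322051015061018 ∷
  221521053944125229031706050810173546050810200315111918031720152221093024122818120608 ∷
  102720071012182833230320031309092433236243031417050615030609200610031110053417091322 ∷
  50810283035100207100207102715151820190313052111083419071508091527060812151920212224 ∷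
  61918213849051015422629181415030706115150032215050618031309301013030609213840100207 ∷
  30609195141071514061913030706473842220708031518051419151824190912225251071724301119 ∷
  60708220721132426121927072221061018031318060708100207021507202423142933030609051525 ∷
  30508051924021510030609032114343544050810101523628483030706152025132426030609071320 ∷
  91922021417240915233028142019071821102311050810030609131834274033240519051311031309 ∷
  72215061833051322102333122726073037142726262839051015051215030609182831102333113837 ∷
  60921051525204746072215061114112322141929070822071018082331131923061833184647071827 ∷
  221521102520030609071508233431200709132426264355062019122726071917112433261415152820 ∷
  240915071508030508060921051215032009071827143221030609031914381431021510111218122218 ∷
  70821061312071508030706061018072322102621142228051810031318131415031931261415112422 ∷
  260813301227265865051525101512234229062221112628022314182329102641091022051215081519 ∷
  60921192022113422032114111214142539091322152136021113061413051114031821050615143415 ∷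
  111214031417053627220708061817142331030609300318031114054235122317251015123422030706 ∷
  30508212327032730121422021507114037052114032007081519050615151938092229050810062312 ∷
  143120071512211415190714051210051015172330220721060708112422021510152136072021151927 ∷
  31518171851100207192942060921114746051525121527072229060708142915061208200710031409 ∷
  91120384752061114050712032318134426172631135338122218063029032015202231030706081021 ∷
  71821062221101215143029030706121339132431353947051419061918204431091215131415071508 ∷
  174234120608381523382023221213050810072411101830173234091022050810021417133144061114 ∷
  192457064645172451071021112625030609030609102641152221051823062221280814100207030609 ∷
  60708102641121418234760212344113534072021102118051525030706271012152326102641050810 ∷
  31013061817030609022112031413030508223841072221190717416667113428071508030609202827 ∷
  253130030706071912092812031409142019200308050712091912151920144749072221141724100207 ∷
  122218401129182827181013293046060720022217081422181013142726061018030706112312022012 ∷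
  71514031013030609123029071508197057220708061208071318061413200610341819070821190717 ∷
  100207220912132726030609072221061208101512053944123413050810071508030609143433220721 ∷
  103841102621201213030609121314112718121415091126031827131826071821050712091215143530 ∷
  303135050612132726071214030609070821051810071114131826050810061730280814272836052715 ∷
  62619071508521834033423223559060927091021154746051412050712121527030609091021091322 ∷
  183919335644051114071508060708331822075022030609061018061517142035270912051015072215 ∷
  91423021119076138050712051823071214261115280814050615021113031027260813060921031114 ∷
  220708211415112714081119031821072021030508030508030706060708051435061413261415385977 ∷
  30609092623111822050712052310123029133839022111071508060812031114142928054767030609 ∷
  121517081514030609152420101512030508072149031309270609060708142231023831202123072330 ∷
  30609230320050615060708073420193027394792192826132235031013102241243034061327112022 ∷
  52842031913381819061018142228220319021307301113215774061413102621031118060708240717 ∷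
  101222030609092010571426111213152124200614193530030609152625030609784749112117052833 ∷
  50810050612030508240519102621211415120608072422061319030706132235071012031417221521 ∷
  122625213125051311321319130612121817091215100207193238030706122017347462031126030609 ∷
  31520022217100207181931073423061709113830101512060708021417031821141723142029022919 ∷
  31413030609112630030609053028102217030706031110031309220708091120181113050810212940 ∷
  21507060921091912121918051210091215032326513034274035261415132759142726131918431231 ∷
  61018072221233543141011061208200310102621032114050618280814032009113029050712071918 ∷
  131415153819061413051210223435030609234452050615141729050810031518173558081519032008 ∷
  391422030706251015021417132821051525031309071514051015072215112625193027061923072221 ∷
  172724061709100207251015385949091120100207071508070821241122050615200711031320030508 ∷
  60708021119204250031518061413141011132726131415070821392226250320170614051210280814 ∷
  396768111233030508072221151918200610061413111213111214151918062018174259050810072215 ∷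
  203938050712030609052112173234112625071821191218352425030609121927071012526259173036 ∷
  50712343547050615173234427973301317112722060708064039151920180714141011121418082023 ∷
  239043030609112720073934073819031118031110230914030609350617072021030609061918134143 ∷
  72215122322131526521417135351071508112312200610030609132942050810030609100207200610 ∷
  72633142019205847050615091912133226051015200310050712102715060708070822031309240717 ∷
  30609121418100207145029021119031925234244060708142635172926152025061114051812071018 ∷
  144160030508201213031114473037050612070822052111032209033834030609240717050615071012 ∷
  61018174434300318020313091527102520064443143029053831111214072221061418061208251015 ∷
  202423031417301220200614102621131424052328071724030609072338030609152221192022055265 ∷
  30609201115100207032229030706072214221819583847071419190717052715193257051015223435 ∷
  63521051217183029071508260813050623205173060708416894051015050810111214212728060812 ∷
  30508222333031431031013030609030508303537122317121817071324221521031913061817102621 ∷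
  261122252640030508053027391013212327060708070822344071122218050810070821031318072214 ∷
  100207111822050615051015031110533539031114052535031318060921072215030609205261124639 ∷
  213140030609022217122722231418121517152221448382113534052411031114070822030706111218 ∷
  30609220814062357071724030706382021050810242827022017123422050712031309250607031110 ∷
  30609071724071508112022261122062230030508201014290514246251081114272836113022347471 ∷
  134039212728050615061523142221050810051311072221122027030508133028030609081422081114 ∷
  234252141523050615153873200315074035060921030609051419050619072215030609134026533539 ∷
  60708172640113933063029251015193027071508072011093743083834072021050810100207112322 ∷
  31110131415101222273738260813103637051525030508301317331419022112091527234027133520 ∷
  122818072120344741021507221213181013101820200610281221031821071514112628030609071020 ∷
  61208051114030609051215586371030609112322142221071508071214141011143029091527101820 ∷
  60708391226050810223433060708050612102520678486051015156655050810050810021215030508 ∷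
  21219091527062329031309050712081514072221091424100207030706072011201115072221060921 ∷
  30609030609061018030508072030073714192122132726270712052715092430031333244457030609 ∷
  50712061723121339120608173234152221155655031426131826030609060729101512190313172631 ∷
  51215030609030706030508051215205343250607221521190717031413112625111812112625350720 ∷
  22112132726081519030508091930030609100207052631230610062221032114155352064719221521 ∷
  301119030609051015060708051210113440301317182827134039101125063036102423030508232640 ∷
  192826020313053110223233122524152136070822050612133842022111132330032015061817030706 ∷
  30609152341231017147352052111310630061120201517051015220319050612243130051215125239 ∷
  31309050615030706121422156150060927030609343551101512240915030609180513061018254166 ∷
  112312102430192438060921252660085937051015102333081514051324200315050615132426422338 ∷
  31110141011222333051419201215601743171823032114030609091120072221050612071012031110 ∷
  91922201115352428061208051215442631051015121926200609174451071918133120233430071821 ∷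
  142421031706220708060708030718431426061018111822071012121517061913092712113022075045 ∷
  251015032009112322102631072220061833133520072221030508220817030706050712030508071817 ∷
  142024152819050615081422081422030508030609031925051412280814094827143029132426030609 ∷
  31110133526050615102631374271111214450318313848112625122322061413073819031706071508 ∷
  30609132026031426111214071320052111091021060708152136082313061817050618251015241417 ∷
  76269031309244734050712030609052934051015052631020313100207283842050615121415143029 ∷
  280814061018030609231013030706220708030706113837061918261415121918141011052229021113 ∷
  214346111324061413143940062221071508050712031318091023034741051419052112223537031118 ∷
  224244030609240710312728071508031114251015131526062023051215072221172023051311115655 ∷
  91215051525223835101512071917152420030609071514195446050810113412032730061417592044 ∷
  151934050712143321032014111214071822021113021520030508050615132726032318050712071312 ∷
  221218103025100207213840133226133226051015031417221819122015112628060708152641280221 ∷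
  71020061114301317261415081319251015121817061208100207032210030609112722060812190313 ∷
  50618112033102827132726203835030609153127152733072215050615091342100207111812134457 ∷
  30609152221172427072221101118031518071912350629060921192024083926060921050612222733 ∷
  234774032006230813121415233837062219173546030609251015071508030609182827061018265745 ∷
  33826190313122317051015030508091215091912371115190618051215071118020313100207183029 ∷
  62314115768031309200610060921052229030508030609203130072221131918112322030609060708 ∷
  51525021520030609092027021113050615032006113046223433071512050712063837030609021307 ∷
  72221132726021507111822211415121418031913091120223433122015060708152226132426050810 ∷
  30706050712303537285043050612083926060812051015061018060812220708021507194261111213 ∷
  131415141752051525152221172138091912141531270618211214030609146867234754101215263843 ∷
  51015112423031922091322050615031821112625030706223433113830592437032209234340120608 ∷
  31309050712424359072221133423072010030508052328061413300318111213050712301119181112 ∷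
  61413200614270318050712132726173542112330051810072318152024192826051210153435061413 ∷
  230813061413071508115961030609061833220708030609081519220721072221030508100207071508 ∷
  50615051015072218071508061114142928031309113028072149260813131826030609032318173234 ∷
  104757071508031518051525145733100207050810220817053125071508152628233046031821051435 ∷
  111720115226030609121729402935091420100207051217221213182223072414023833071130030609 ∷
  201215201213193920071918072322100207420535051525123422192022101123280814280915101125 ∷
  171823581437051525156246032023071508051311030508072042250607022013073111152221031309 ∷
  50712212634173934031821032742031013100207181114030609072215030706031309204241022919 ∷
  100207021113142019070821062733061018101512051015072221050623121415072215061821073819 ∷
  193027061413210318115655031922072215072215050615021113082319131418021510030609071012 ∷
  22112153819301119021119132235173946102253200717031309233046030706061208091912091423 ∷
  123421030609030508100207140511290610200308051015196853220721270912060708180513031318 ∷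
  134023223555181013061114151927192022121727072221232426220721122015133039130612071508 ∷
  91021031013071924071817100207152221061119063421031922280814132220132726031309142719 ∷
  102631142019021307071523050612294170031309142915030609021307072221060708173828061817 ∷
  71312051015030609082119063423111827132726091322226855050712032215060927030609091912 ∷
  50810031922030508082119051134264053220721021510192826062023427471051217031318132437 ∷
  31409205667144443193438050712112546072220031913052111030609172124030609022219071020 ∷
  142331111822113428031309032015350814030609051015151820061413082629030508051525183424 ∷
  71508300723061709071514240715030609030609131526031839050810152221220912052215030609 ∷
  32015121422300320071508181011173061082319152221142933072021030609401129101222060708 ∷
  133020050810301317070821051925132328182827232426030609354442102827104230051525220708 ∷
  60708051924112312060921050612031013030609071917502037030609072221061018250607050615 ∷
  143831061413030609060927182827431130071724030706143321152136112022051210121926151920 ∷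
  204761273536070821181013030706030609022013030706102523121927102111031318072330238360 ∷
  101527100207143537213438111324061413182324196057071312061018121520030609070822100207 ∷
  50615071514030609301317220708120608156150050615233940030609071912050615022013075973 ∷
  91922181415113430061709133832050615030706101512073017030609051419071320030508151918 ∷
  153121261417142423070821050810122015112322053926051015142915131415111730061114153819 ∷
  61413301119031518051114131418132018030508180513060708174434050712071114200617030706 ∷
  71508030609050623122015152221221218140307061418051810115433071012030508050619071526 ∷
  50712102217261415133528111214051210222333240717283433073029220721060921102661181112 ∷
  53024081114222327051218142726051015071508021307132026061413071312201118050615272830 ∷
  143940274742061023142717251015341219172631100207051311211014031518074026280814061709 ∷
  61219062619112722111213133539021507030609141821031309130612030609071514202430030706 ∷
  414452030609062619071214051812021113131822032225050810191218071012050810061413070822 ∷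
  113028301423240715071512091215391226072226190717031821030508051810032117070821051015 ∷
  60921071020200610145931051015263847060923172926421329021119070822030609052815350629 ∷
  30609082319051015030609034741201215111720155161251012050810072021102641145752100207 ∷
  132942051215091227032007030609354758385871101215030706050810031913050819111822060708 ∷
  232952031821 ∷
  []

-- For the primes p ≢ 1 mod 8 from 5 on: n, b₀, b₁, c₀, c₁, d₀, d₁, with two decimal digits each, describing
-- 𝔽_p [√n], b = b₀ + b₁ √n, c and d likewise, for a = 1.
squareTable : List ℕ
squareTable =
  2010101020201 ∷ 3040103010302 ∷ 2000102020203 ∷ 2000101020101 ∷ 2040101010002 ∷ 5020104040104 ∷
  2000201040102 ∷ 3020204010103 ∷ 2020300020200 ∷ 2000302030301 ∷ 5010402040401 ∷ 2010102010104 ∷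
  2000101030201 ∷ 2010101020201 ∷ 2010302010003 ∷ 7020404020401 ∷ 3030202040303 ∷ 2020201040302 ∷
  2010101020201 ∷ 3040201030301 ∷ 2000103030301 ∷ 2030401020201 ∷ 3030101050402 ∷ 2040101010002 ∷
  2020103030003 ∷ 2000101010003 ∷ 3010102040302 ∷ 2000101020101 ∷ 2000102020203 ∷ 5010103040402 ∷
  2000101020101 ∷ 2000103030301 ∷ 2000101020101 ∷ 7020204010502 ∷ 2000201040301 ∷ 3030502010104 ∷
  2000103030301 ∷ 3020304010105 ∷ 2030400010204 ∷ 2000101020101 ∷ 7040203020303 ∷ 2020201040302 ∷
  5030104040205 ∷ 2000101020101 ∷ 3010202010303 ∷ 2010100020103 ∷ 2020101030303 ∷ 2010101020201 ∷
  2040101010002 ∷ 11020603010501 ∷ 2000402000003 ∷ 2000302030301 ∷ 2000102010303 ∷ 2000101020101 ∷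
  7010402040401 ∷
  []

-- The l lowest digits of n in base b + 1, the lowest first.
digits : ℕ → ℕ → ℕ → List ℕ
digits b zero    n = []
digits b (suc l) n = n % suc b ∷ digits b l (n / suc b)

checkPrime : ℕ → ℕ → Bool
checkPrime k e = Numerals.certified? (residueNumerals (8 ℕ.* k)) (2 ℕ.* k) 1 (e / 10000) (e / 100 % 100) (e % 100)

skipPrime : ℕ → Bool
skipPrime k = composite? (suc (8 ℕ.* k))

-- The range is 3 ≤ k < 3 + 16381 = 16384: it begins beyond 17, which is treated separately, and
-- ends where h = 2k reaches 32768.
primes-certified : scan skipPrime checkPrime 16381 3 (concatMap (digits 999999 14) primeTable) ≡ true
primes-certified = refl

eighth : ℕ → ℕ
eighth m = suc m ℕ.* suc m / 8

-- The Euler criterion shows that n is not a square modulo m + 1.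
nonresidue? : ℕ → ℕ → Bool
nonresidue? m n = not (same n zeroC) ∧ not (same (power n (m / 2) 20) oneC)
  where open Numerals (residueNumerals m)

checkSquareDigits : ℕ → List ℕ → Bool
checkSquareDigits m (d₁ ∷ d₀ ∷ c₁ ∷ c₀ ∷ b₁ ∷ b₀ ∷ n ∷ []) =
  nonresidue? m n ∧ Numerals.certified? (quadraticNumerals m n) (2 ℕ.* eighth m) (1 , 0) (b₀ , b₁) (c₀ , c₁) (d₀ , d₁)
checkSquareDigits m _ = false

checkSquare : ℕ → ℕ → Bool
checkSquare m e = checkSquareDigits m (digits 99 7 e)

skipSquare : ℕ → Bool
skipSquare m = composite? (suc m) ∨ (suc m % 8 ≡ᵇ 1)

-- The range is 4 ≤ m < 362, that is, 5 ≤ p ≤ 362; 363 is the first integer with a square above 2¹⁷.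
squares-certified : scan skipSquare checkSquare 358 4 squareTable ≡ true
squares-certified = refl

nonsquare : ∀ 𝔽 → let open FieldProperties 𝔽 in
            ∀ j {x} → length units ≡ 2 ℕ.* j → x ≢ 0# → x ^ j ≢ 1# → ∀ y → y * y ≢ x
nonsquare 𝔽 j size x≢0 xʲ≢1 y refl = xʲ≢1 (begin
  (y * y) ^ j      ≡⟨ ^-distrib-* y y j ⟩
  y ^ j * y ^ j    ≡⟨ sym (^-2* y j) ⟩
  y ^ (2 ℕ.* j)    ≡⟨ cong (y ^_) (sym size) ⟩
  y ^ length units ≡⟨ ^-length-units (factor-nonzeroˡ x≢0) ⟩
  1#               ∎)
  where
  open FieldProperties 𝔽
  open ≡-Reasoning

module PrimeOrder (k : ℕ) (3≤k : 3 ℕ.≤ k) (prime-p : Prime (suc (8 ℕ.* k))) where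

  open PrimeField (8 ℕ.* k) prime-p
  open PrimeInterpretation (8 ℕ.* k) prime-p
  open FieldProperties 𝔽ₚ using (units)

  private instance
    k≢0 : NonZero k
    k≢0 = ℕ.>-nonZero (ℕ.<-≤-trans (ℕ.s≤s ℕ.z≤n) 3≤k)

  size : length units ≡ 8 ℕ.* k
  size = ℕ.suc-injective (trans (sym (FieldProperties.length-elements-units 𝔽ₚ)) length-elements)

  niceₚ : Dec (k ℕ.< 16384) → Nice (Fin (suc (8 ℕ.* k))) addFin
  niceₚ (no k≮)  = Selection.nice-large 𝔽ₚ k size (ℕ.*-monoʳ-≤ 2 (ℕ.≮⇒≥ k≮))
  niceₚ (yes k<) =
    let e , ok = scan-sound skipPrime checkPrime 16381 3 (concatMap (digits 999999 14) primeTable)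
                   primes-certified k 3≤k k< (composite?-sound (suc (8 ℕ.* k)) prime-p)
    in Certificate.nice-certified interpretation k size 1 (e / 10000) (e / 100 % 100) (e % 100) ok

module SquareOrder (m : ℕ) (4≤m : 4 ℕ.≤ m) (prime-p : Prime (suc m)) (j : ℕ) (even : m ≡ 2 ℕ.* j)
                   (square-mod-8 : suc m ℕ.* suc m % 8 ≡ 1) where

  open Residues m
  open PrimeField m prime-p
  open PrimeInterpretation m prime-p
  open FieldProperties 𝔽ₚ using (units; 0#; 1#; _^_)

  k : ℕ
  k = eighth m

  order≡ : suc m ℕ.* suc m ≡ suc (8 ℕ.* k)
  order≡ = trans (m≡m%n+[m/n]*n (suc m ℕ.* suc m) 8)
    (cong₂ ℕ._+_ square-mod-8 (ℕ.*-comm k 8))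

  size : length units ≡ 2 ℕ.* j
  size = trans (ℕ.suc-injective (trans (sym (FieldProperties.length-elements-units 𝔽ₚ)) length-elements)) even

  private instance
    k≢0 : NonZero k
    k≢0 = ℕ.>-nonZero (ℕ.<-≤-trans (ℕ.s≤s ℕ.z≤n) (/-mono-≤ {o = 8} (ℕ.*-mono-≤ (ℕ.s≤s 4≤m) (ℕ.s≤s 4≤m)) ℕ.≤-refl))

  module _ (x : Fin p) (not-square : ∀ y → y *ₚ y ≢ x) where

    open Quadratic 𝔽ₚ x not-square

    extension-size : length (FieldProperties.units extension) ≡ 8 ℕ.* k
    extension-size = ℕ.suc-injective (begin
      suc (length (FieldProperties.units extension)) ≡⟨ sym (FieldProperties.length-elements-units extension) ⟩
      length (FieldProperties.elements extension)    ≡⟨ length-cartesianProduct (FieldProperties.elements 𝔽ₚ) (FieldProperties.elements 𝔽ₚ) ⟩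
      _                                              ≡⟨ cong₂ ℕ._*_ length-elements length-elements ⟩
      suc m ℕ.* suc m                                ≡⟨ order≡ ⟩
      suc (8 ℕ.* k)                                  ∎)
      where open ≡-Reasoning

  niceₚₚ : Dec (m ℕ.< 362) → suc m % 8 ≢ 1 → Nice (Fin p × Fin p) (addFin ×-add addFin)
  niceₚₚ (no m≮) _ = Selection.nice-large (Quadratic.extension 𝔽ₚ x not-square) k (extension-size x not-square)
      -- The quotient of 363 · 363 by 8 is 16471, while h = 2k has to reach 2 · 16384.
      (ℕ.*-monoʳ-≤ 2 (ℕ.≤-trans (ℕ.≤ᵇ⇒≤ 16384 16471 tt) (/-mono-≤ {o = 8} (ℕ.*-mono-≤ (ℕ.s≤s 362≤m) (ℕ.s≤s 362≤m)) ℕ.≤-refl)))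
    where
    362≤m : 362 ℕ.≤ m
    362≤m = ℕ.≮⇒≥ m≮
    instance
      j≢0 : NonZero j
      j≢0 = ℕ.≢-nonZero λ { refl → contradiction (subst (4 ℕ.≤_) even 4≤m) λ () }
    j<2j : j ℕ.< 2 ℕ.* j
    j<2j = ℕ.m<m+n j (subst (0 ℕ.<_) (sym (ℕ.+-identityʳ j)) (ℕ.>-nonZero⁻¹ j))
    root = FieldProperties.nonroot 𝔽ₚ j (subst (j ℕ.<_) (sym size) j<2j)
    x = proj₁ root
    not-square = nonsquare 𝔽ₚ j size (proj₁ (proj₂ root)) (proj₂ (proj₂ root))
  niceₚₚ (yes m<) p≢1 =
    let e , ok = scan-sound skipSquare checkSquare 358 4 squareTable squares-certified m 4≤m m< not-skipped
    in from-digits (digits 99 7 e) ok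
    where
    not-skipped : skipSquare m ≡ false
    not-skipped with composite? (suc m) | composite?-sound (suc m) prime-p | suc m % 8 ≡ᵇ 1 in eq
    ... | false | refl | false = refl
    ... | false | refl | true  = contradiction (ℕ.≡ᵇ⇒≡ (suc m % 8) 1 (Equivalence.from T-≡ eq)) p≢1

    open Interpretation interpretation using (same-complete; value-power)

    certified-nonsquare : ∀ n → nonresidue? m n ≡ true → ∀ y → y *ₚ y ≢ residue n
    certified-nonsquare n ok = nonsquare 𝔽ₚ j size
      (λ eq → contradiction (same-complete n 0 eq) (not-¬ (not-true (proj₁ parts))))
      (λ eq → contradiction (same-complete (power n (m / 2) 20) 1
                (trans (value-power n (m / 2) 20) (trans (cong (residue n ^_) half) eq)))
              (not-¬ (not-true (proj₂ parts))))
      where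
      open Numerals (residueNumerals m)
      parts = ∧-true {not (same n zeroC)} ok
      half : m / 2 ≡ j
      half = trans (cong (_/ 2) (trans even (ℕ.*-comm 2 j))) (m*n/n≡m j 2)

    from-digits : ∀ ds → checkSquareDigits m ds ≡ true → Nice (Fin p × Fin p) (addFin ×-add addFin)
    from-digits (d₁ ∷ d₀ ∷ c₁ ∷ c₀ ∷ b₁ ∷ b₀ ∷ n ∷ []) ok =
      let nonresidue , certified = ∧-true {nonresidue? m n} ok
          not-square = certified-nonsquare n nonresidue
      in Certificate.nice-certified (QuadraticInterpretation.interpretationₖ m prime-p n not-square)
           k (extension-size (residue n) not-square) (1 , 0) (b₀ , b₁) (c₀ , c₁) (d₀ , d₁) certified

-- Explicit families

-- Two units cover the 16 nonzero residues. The pairs are not the negatives of the quadruples, so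
-- this family is not of the form used for fields.
units17 : List ℕ
units17 =
  14008005010015009001011 ∷ 4016003013006002012007 ∷
  []

-- These do come from a field. Reading a number in base 3 as a polynomial, lowest coefficient first,
-- in 𝔽₃[x] with x⁴ = x³ + 1, the quadruples are x⁴ⁱ (1, x, 2x² + x + 1, x³ + x² + x + 1) for 0 ≤ i
-- < 10, and the pairs are their negatives.
units81 : List ℕ
units81 =
  80017006002040022003001 ∷ 38065062056073046031028 ∷ 79029075025041055042014 ∷ 10039044077020078076043 ∷
  68045048016052063069023 ∷ 57027058037033054035074 ∷ 72067019051036053011066 ∷ 13032024008026061012004 ∷
  15070049034021050071059 ∷ 9060005064018030007047 ∷
  []

-- Likewise with x⁶ = x⁵ + 1: the quadruples are x⁴ⁱ (1, x, x³, x⁵ + x⁴ + 2) for 0 ≤ i < 91.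
units729 : List ℕ
units729 =
  649054006002326027003001 ∷ 391494486162701247243081 ∷ 131485566512232607283256 ∷ 664196723241347140366122 ∷
  392585065588700414046420 ∷ 212542168056151271084028 ∷ 182481269656091611499328 ∷ 430601687229581464402134 ∷
  353139312104703197534178 ∷ 207333037417144666074591 ∷ 506051572514253066412299 ∷ 484489459153608249594198 ∷
  115080521497221040301262 ∷ 341169720240670086360120 ∷ 699350551507390661289258 ∷ 70214725565050149367284 ∷
  573344227642408658127447 ∷ 540457671547270635340275 ∷ 319597471157530465618206 ∷ 119544276092235278543181 ∷
  177643287662102449562349 ∷ 510628690230255437399133 ∷ 79386555185041679291097 ∷ 88211320673167152529338 ∷
  94101200633188172154456 ∷ 95174424303187105578516 ∷ 176267596522106498460315 ∷ 429525463316579321602524 ∷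
  272559116605541281220478 ∷ 692156422707400204589358 ∷ 717011190468372019137612 ∷ 64406099033047569171057 ∷
  87108012004165216024008 ∷ 13503487324026265245648 ∷ 568726647539407363445310 ∷ 135308223479189532113604 ∷
  9442103439018641179626 ∷ 244599336112488466672224 ∷ 364706294098728359552184 ∷ 613387043419470693077592 ∷
  138536329676195313655380 ∷ 252236215638504118148454 ∷ 527183425708322096577354 ∷ 721511677549362257379288 ∷
  632160719563451203373286 ∷ 222335226480111667128609 ∷ 22213590520017147421302 ∷ 83263218639163496109441 ∷
  418201427304593159584518 ∷ 595505110603461254217477 ∷ 382403665545683689346277 ∷ 616615473724476474619368 ∷
  381300438146681519624208 ∷ 535279031415314558062587 ∷ 155042571352199075413704 ∷ 659248378126343493675225 ∷
  716688292259376404557509 ∷ 712393610365371696482727 ∷ 388293383694695556682389 ∷ 617691697394475401395698 ∷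
  462636637374600453455718 ∷ 35546627209058273435145 ∷ 166076305668089044517334 ∷ 107574684228175410396132 ∷
  660621069023348432048016 ∷ 68548492164052274246082 ∷ 411238323674570125526337 ∷ 513345443714297663640375 ∷
  72538680550036311385290 ∷ 250398233644491685130448 ∷ 121210428709242150583356 ∷ 339020191630669010136450 ∷
  537650180060309325090030 ∷ 317472268251523620500490 ∷ 686357606202397705483161 ∷ 231531059586129306034416 ∷
  266560170623502280085433 ∷ 444237431710645123580355 ∷ 32264434711061501622369 ∷ 652282436307332564629533 ∷
  634285598361458561467722 ∷ 384528625370678318440713 ∷ 49073143614071038193469 ∷ 327331657219654653342114 ∷
  53377554508067715295260 ∷ 651452239646330631124446 ∷ 553192426142296141582194 ∷ 158261029576205495055423 ∷
  173039409298100078575515 ∷ 186005351117093007702234 ∷ 25405045015014567063021 ∷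
  []

slots : List Slot
slots = cartesianProduct (false ∷ true ∷ []) (allFin 4)

∈-slots : ∀ s → s ∈ slots
∈-slots (b , j) = ∈-cartesianProduct⁺ (∈-bools b) (∈-allFin j)
  where
  ∈-bools : ∀ b → b ∈ false ∷ true ∷ []
  ∈-bools false = here refl
  ∈-bools true  = there (here refl)

-- Each modulus is stored as its predecessor, so that it is visibly positive and `addFin` reduces.
tupleGroup : ∀ ms → Ab (Tuple (map suc ms)) (addTuple (map suc ms))
tupleGroup []       = Nice.group nice-[]
tupleGroup (m ∷ ms) = ×-Ab (Residues.ℤₚ-group m) (tupleGroup ms)

-- The tuples of residues modulo m₁ + 1, …, mᵣ + 1, numbered in mixed radix.
module Explicit (ms : List ℕ) where

  moduli⁺ : List ℕ
  moduli⁺ = map suc ms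

  open Ab (tupleGroup ms)

  decode : ∀ ms → ℕ → Tuple (map suc ms)
  decode []       n = tt
  decode (m ∷ ms) n = n mod suc m , decode ms (n / suc m)

  encode : ∀ ms → Tuple (map suc ms) → ℕ
  encode []       tt       = 0
  encode (m ∷ ms) (x , xs) = toℕ x ℕ.+ encode ms xs ℕ.* suc m

  encode-injective : ∀ ms {x y} → encode ms x ≡ encode ms y → x ≡ y
  encode-injective []       _  = refl
  encode-injective (m ∷ ms) {x , xs} {y , ys} eq = cong₂ _,_ (Fin.toℕ-injective x≡y)
    (encode-injective ms (ℕ.*-cancelʳ-≡ (encode ms xs) (encode ms ys) (suc m)
      (ℕ.+-cancelˡ-≡ (toℕ x) _ _ (trans eq (cong (ℕ._+ encode ms ys ℕ.* suc m) (sym x≡y))))))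
    where
    low : ∀ (x : Fin (suc m)) e → (toℕ x ℕ.+ e ℕ.* suc m) % suc m ≡ toℕ x
    low x e = trans ([m+kn]%n≡m%n (toℕ x) e (suc m)) (m<n⇒m%n≡m (Fin.toℕ<n x))
    x≡y : toℕ x ≡ toℕ y
    x≡y = trans (sym (low x (encode ms xs))) (trans (cong (_% suc m) eq) (low y (encode ms ys)))

  encode-< : ∀ ms x → encode ms x < product (map suc ms)
  encode-< []       tt       = ℕ.s≤s ℕ.z≤n
  encode-< (m ∷ ms) (x , xs) = ℕ.<-≤-trans (ℕ.+-monoˡ-< (encode ms xs ℕ.* suc m) (Fin.toℕ<n x))
    (subst (suc (encode ms xs) ℕ.* suc m ℕ.≤_) (ℕ.*-comm (product (map suc ms)) (suc m))
      (ℕ.*-monoˡ-≤ (suc m) (encode-< ms xs)))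

  encode-0 : ∀ ms → encode ms (Ab.0# (tupleGroup ms)) ≡ 0
  encode-0 []       = refl
  encode-0 (m ∷ ms) = cong (ℕ._* suc m) (encode-0 ms)

  order : ℕ
  order = product moduli⁺

  module _ {J : Set} (indices : List J) (complete : ∀ j → j ∈ indices) (f : J → Tuple moduli⁺) where

    table : List (J × ℕ)
    table = map (λ j → j , encode ms (f j)) indices

    single : List (J × ℕ) → Bool
    single (_ ∷ []) = true
    single _        = false

    -- The code 0 belongs to the neutral element and must be absent; each of the codes from 1 to
    -- `order ∸ 1` must occur in a single row. The table is an argument so that evaluation can share
    -- it among these tests.
    hitsOnce? : List (J × ℕ) → Bool
    hitsOnce? t = all (λ (_ , c) → 0 <ᵇ c) t ∧ all (λ n → single (filterᵇ (λ (_ , c) → c ≡ᵇ suc n) t)) (upTo (order ∸ 1))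

    ∈-table : ∀ j → (j , encode ms (f j)) ∈ table
    ∈-table j = ∈-map⁺ (λ j → j , encode ms (f j)) (complete j)

    hitsOnce-sound : hitsOnce? table ≡ true → HitsOnceExcept 0# f
    hitsOnce-sound ok = record
      { avoids = λ j fj≡0 → contradiction
          (ℕ.<ᵇ⇒< 0 (encode ms (f j)) (Equivalence.from T-≡ (all-∈ (λ (_ , c) → 0 <ᵇ c) table (proj₁ parts) (∈-table j))))
          (subst (λ c → ¬ (0 < c)) (sym (trans (cong (encode ms) fj≡0) (encode-0 ms))) λ ())
      ; hits = λ x x≢0 → hit x (encode ms x) refl x≢0 }
      where
      parts = ∧-true {all (λ (_ , c) → 0 <ᵇ c) table} ok

      matches : ℕ → J × ℕ → Bool
      matches n (_ , c) = c ≡ᵇ n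

      only : ∀ {a} (t : List (J × ℕ)) → single t ≡ true → a ∈ t → ∀ {b} → b ∈ t → a ≡ b
      only (_ ∷ []) _ (here refl) (here refl) = refl

      some : ∀ (t : List (J × ℕ)) → single t ≡ true → Σ (J × ℕ) (_∈ t)
      some (a ∷ []) _ = a , here refl

      hit : ∀ x n → encode ms x ≡ n → x ≢ 0# → ∃!′ λ j → f j ≡ x
      hit x zero    eq x≢0 = contradiction (encode-injective ms (trans eq (sym (encode-0 ms)))) x≢0
      hit x (suc n) eq x≢0 =
        let (j , c) , jc∈ = some _ one
            jc∈table , c≡ = ∈-filter⁻ (T? ∘ matches (suc n)) {xs = table} jc∈
            i , _ , jc≡ = ∈-map⁻ (λ j → j , encode ms (f j)) jc∈table
        in j , encode-injective ms (trans (trans (cong (encode ms ∘ f) (cong proj₁ jc≡)) (sym (cong proj₂ jc≡)))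
                                          (trans (ℕ.≡ᵇ⇒≡ c (suc n) c≡) (sym eq))) ,
           λ k fk≡x → cong proj₁ (only _ one jc∈ (∈-filter⁺ (T? ∘ matches (suc n)) (∈-table k)
             (ℕ.≡⇒≡ᵇ (encode ms (f k)) (suc n) (trans (cong (encode ms) fk≡x) eq))))
        where
        one : single (filterᵇ (matches (suc n)) table) ≡ true
        one = all-∈ (λ n → single (filterᵇ (matches (suc n)) table)) (upTo (order ∸ 1)) (proj₂ parts)
          (∈-upTo⁺ (ℕ.<-≤-trans (ℕ.n<1+n n) (ℕ.∸-monoˡ-≤ 1 (subst (_< order) eq (encode-< ms x)))))

  -- Each unit is given by the numbers of its eight points, three decimal digits each.
  module _ (units : List ℕ) where

    nth : List ℕ → ℕ → ℕ
    nth []       n       = 0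
    nth (x ∷ xs) zero    = x
    nth (x ∷ xs) (suc n) = nth xs n

    slotNumber : Slot → ℕ
    slotNumber (false , j) = toℕ j
    slotNumber (true  , j) = 4 ℕ.+ toℕ j

    Unit : Set
    Unit = Fin (length units)

    point : Unit → Slot → Tuple moduli⁺
    point u s = decode ms (nth (digits 999 8 (lookup units u)) (slotNumber s))

    difference : Fin 2 → Unit → Slot → Tuple moduli⁺
    difference δ u e = point u (source δ e) − point u (target δ e)

    indices : List (Unit × Slot)
    indices = cartesianProduct (allFin (length units)) slots

    ∈-indices : ∀ j → j ∈ indices
    ∈-indices (u , s) = ∈-cartesianProduct⁺ (∈-allFin u) (∈-slots s)

    family? : Bool
    family? = hitsOnce? indices ∈-indices (uncurry point) (table indices ∈-indices (uncurry point))
      ∧ (hitsOnce? indices ∈-indices (uncurry (difference 0F)) (table indices ∈-indices (uncurry (difference 0F)))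
      ∧ hitsOnce? indices ∈-indices (uncurry (difference 1F)) (table indices ∈-indices (uncurry (difference 1F))))

    explicit-family : family? ≡ true → Family (tupleGroup ms)
    explicit-family ok = record
      { Unit = Unit ; point = point
      ; points = hitsOnce-sound indices ∈-indices (uncurry point) (proj₁ parts)
      ; differences = λ { 0F → hitsOnce-sound indices ∈-indices (uncurry (difference 0F)) (proj₁ parts′)
                        ; 1F → hitsOnce-sound indices ∈-indices (uncurry (difference 1F)) (proj₂ parts′) } }
      where
      parts = ∧-true ok
      parts′ = ∧-true (proj₂ parts)

family17? : Explicit.family? (16 ∷ []) units17 ≡ true
family17? = refl

family81? : Explicit.family? (2 ∷ 2 ∷ 2 ∷ 2 ∷ []) units81 ≡ true
family81? = refl

family729? : Explicit.family? (2 ∷ 2 ∷ 2 ∷ 2 ∷ 2 ∷ 2 ∷ []) units729 ≡ true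
family729? = refl

multipliers-[] : Multipliers (Nice.group nice-[])
multipliers-[] = Nice.multipliers nice-[]

numerals : ∀ m → Fin 4 → Fin (suc m)
numerals m j = Residues.residue m (suc (toℕ j))

module _ (m : ℕ) (4≤m : 4 ℕ.≤ m) (prime-p : Prime (suc m)) where

  open Residues m
  open PrimeField m prime-p

  -- The scalars 1, 2, 3, 4 are distinct and nonzero because p ≥ 5. They serve the listed family for
  -- 17, which brings no scalars of its own.
  prime-multipliers : Multipliers (Scalings.additive 𝔽ₚ)
  prime-multipliers = Scalings.scalings 𝔽ₚ {numerals m} nonzero distinct
    where
    small : ∀ (j : Fin 4) → suc (toℕ j) < p
    small j = ℕ.s≤s (ℕ.≤-trans (Fin.toℕ<n j) 4≤m)
    value : ∀ j → toℕ (numerals m j) ≡ suc (toℕ j)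
    value j = trans (toℕ-residue (suc (toℕ j))) (m<n⇒m%n≡m (small j))
    nonzero : ∀ j → numerals m j ≢ residue 0
    nonzero j eq = contradiction (trans (sym (value j)) (cong toℕ eq)) λ ()
    distinct : ∀ {i j} → numerals m i ≡ numerals m j → i ≡ j
    distinct {i} {j} eq = Fin.toℕ-injective (ℕ.suc-injective (trans (sym (value i)) (trans (cong toℕ eq) (value j))))

prime-3 : Prime 3
prime-3 = from-yes (prime? 3)

prime-17 : Prime 17
prime-17 = from-yes (prime? 17)

nice-17 : NiceTuple (17 ∷ [])
nice-17 = record
  { group       = tupleGroup (16 ∷ [])
  ; family      = Explicit.explicit-family (16 ∷ []) units17 family17?
  ; multipliers = multipliers-× (prime-multipliers 16 (ℕ.≤ᵇ⇒≤ 4 16 tt) prime-17) multipliers-[]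
  }

2-nonsquare : ∀ x → Residues._*ₚ_ 2 x x ≢ Residues.residue 2 2
2-nonsquare 0F ()
2-nonsquare 1F ()
2-nonsquare 2F ()

module 𝔽₉ = Quadratic (PrimeField.𝔽ₚ 2 prime-3) (Residues.residue 2 2) 2-nonsquare

-- Multiplication by 1, −1, i and −i in 𝔽₉ = 𝔽₃[i].
multipliers-9 : Multipliers (Scalings.additive 𝔽₉.extension)
multipliers-9 = Scalings.scalings 𝔽₉.extension {roots} nonzero distinct
  where
  roots : Fin 4 → Fin 3 × Fin 3
  roots 0F = 1F , 0F
  roots 1F = 2F , 0F
  roots 2F = 0F , 1F
  roots 3F = 0F , 2F
  nonzero : ∀ j → roots j ≢ (0F , 0F)
  nonzero 0F ()
  nonzero 1F ()
  nonzero 2F ()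
  nonzero 3F ()
  distinct : ∀ {i j} → roots i ≡ roots j → i ≡ j
  distinct {0F} {0F} _ = refl
  distinct {1F} {1F} _ = refl
  distinct {2F} {2F} _ = refl
  distinct {3F} {3F} _ = refl
  distinct {0F} {1F} ()
  distinct {0F} {2F} ()
  distinct {0F} {3F} ()
  distinct {1F} {2F} ()
  distinct {1F} {3F} ()
  distinct {2F} {3F} ()

HitsOnce-assoc : ∀ {A B C : Set} {f : A × B → A × B} {g : C → C} → HitsOnce f → HitsOnce g →
                 HitsOnce λ ((a , b , c) : A × B × C) → proj₁ (f (a , b)) , proj₂ (f (a , b)) , g c
HitsOnce-assoc hf hg (a , b , c) =
  let (a₀ , b₀) , f≡ , unique-f = hf (a , b)
      c₀ , g≡ , unique-g = hg c
  in (a₀ , b₀ , c₀) , cong₂ (λ (a , b) c → a , b , c) f≡ g≡ ,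
     λ (a′ , b′ , c′) eq → cong₂ (λ (a , b) c → a , b , c)
       (unique-f (a′ , b′) (cong (λ (a , b , c) → a , b) eq)) (unique-g c′ (cong (proj₂ ∘ proj₂) eq))

-- Since ℤ₃ has only two nonzero scalars, coordinates are taken two at a time as 𝔽₉, where four
-- distinct nonzero scalars exist.
ternary-multipliers : ∀ ns → Multipliers (tupleGroup ns) → Multipliers (tupleGroup (2 ∷ 2 ∷ ns))
ternary-multipliers ns M = record
  { scale           = λ i (a , b , t) → let (a′ , b′) = N.scale i (a , b) in a′ , b′ , M.scale i t
  ; scale-hits      = λ i → HitsOnce-assoc (N.scale-hits i) (M.scale-hits i)
  ; difference-hits = λ i≢j → HitsOnce-assoc (N.difference-hits i≢j) (M.difference-hits i≢j)
  }
  where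
  module M = Multipliers M
  module N = Multipliers multipliers-9

nice-81 : NiceTuple (3 ∷ 3 ∷ 3 ∷ 3 ∷ [])
nice-81 = record
  { group       = tupleGroup ms
  ; family      = Explicit.explicit-family ms units81 family81?
  ; multipliers = ternary-multipliers (2 ∷ 2 ∷ []) (ternary-multipliers [] multipliers-[])
  }
  where ms = 2 ∷ 2 ∷ 2 ∷ 2 ∷ []

nice-729 : NiceTuple (3 ∷ 3 ∷ 3 ∷ 3 ∷ 3 ∷ 3 ∷ [])
nice-729 = record
  { group       = tupleGroup ms
  ; family      = Explicit.explicit-family ms units729 family729?
  ; multipliers = ternary-multipliers (2 ∷ 2 ∷ 2 ∷ 2 ∷ [])
      (ternary-multipliers (2 ∷ 2 ∷ []) (ternary-multipliers [] multipliers-[]))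
  }
  where ms = 2 ∷ 2 ∷ 2 ∷ 2 ∷ 2 ∷ 2 ∷ []

-- The components of v and the composition of their families

module Components where

  open import Data.List using (replicate)
  open import Data.List.Properties using (upTo-∷ʳ; filter-++; length-filter; length-upTo)
  open import Data.List.Membership.Propositional.Properties using (∈-concatMap⁺)
  open import Data.Nat using (>-nonZero; nonTrivial⇒n>1; _+_; _*_; _^_; _≤_; s≤s⁻¹; _<?_)
  open import Data.Nat.Properties
  open import Data.Nat.Divisibility using (_∣_; _∣?_; _∤_; divides; ∣-trans; ∣⇒≤; ∣m⇒∣m*n; n∣m*n; m∣m*n; ∣m+n∣m⇒∣n; ∣m∣n⇒∣m+n; ∣1⇒≡1; 1∣_)
  open import Data.Nat.Primality.Factorisation using (factorise)
  open import Relation.Nullary using (does)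
  open import Relation.Nullary.Decidable using (from-no)
  open import Relation.Unary using (Decidable)

  -- For a downward closed predicate, filtering an initial segment counts up to the first failure.
  module _ {P : ℕ → Set} (P? : Decidable P) (down : ∀ k → P (suc k) → P k) where

    initial : ℕ → ℕ
    initial n = length (filter P? (upTo n))

    down-≤ : ∀ {j k} → j ≤ k → P k → P j
    down-≤ {j} {zero}  z≤n Pk = Pk
    down-≤ {j} {suc k} j≤  Pk with m≤n⇒m<n∨m≡n j≤
    ... | inj₁ j<  = down-≤ (s≤s⁻¹ j<) (down k Pk)
    ... | inj₂ refl = Pk

    initial-suc : ∀ n → initial (suc n) ≡ initial n + length (filter P? (n ∷ []))
    initial-suc n = begin
      length (filter P? (upTo (suc n)))            ≡⟨ cong (length ∘ filter P?) (sym (upTo-∷ʳ n)) ⟩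
      length (filter P? (upTo n ++ n ∷ []))        ≡⟨ cong length (filter-++ P? (upTo n) (n ∷ [])) ⟩
      length (filter P? (upTo n) ++ filter P? (n ∷ [])) ≡⟨ length-++ (filter P? (upTo n)) ⟩
      initial n + length (filter P? (n ∷ []))      ∎
      where open ≡-Reasoning

    initial-≤ : ∀ n → initial n ≤ n
    initial-≤ n = subst (initial n ≤_) (length-upTo n) (length-filter P? (upTo n))

    initial-spec : ∀ n → (∀ {k} → k < initial n → P k) × (initial n < n → ¬ P (initial n))
    initial-spec zero = (λ ()) , λ ()
    initial-spec (suc n) with initial-spec n | initial-suc n
    ... | below , at | eq with P? n
    ...   | yes Pn = (λ k< → down-≤ (s≤s⁻¹ (subst (_ <_) full k<)) Pn) ,
                     λ lt → contradiction (subst (_< suc n) full lt) (<-irrefl refl)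
      where
      saturated : initial n ≡ n
      saturated with m≤n⇒m<n∨m≡n (initial-≤ n)
      ... | inj₁ lt = contradiction (down-≤ (<⇒≤ lt) Pn) (at lt)
      ... | inj₂ eq = eq
      full : initial (suc n) ≡ suc n
      full = trans eq (trans (cong (_+ 1) saturated) (+-comm n 1))
    ...   | no ¬Pn = (λ k< → below (subst (_ <_) same k<)) , λ _ → ¬P
      where
      same : initial (suc n) ≡ initial n
      same = trans eq (+-identityʳ (initial n))
      ¬P : ¬ P (initial (suc n))
      ¬P P-initial with m≤n⇒m<n∨m≡n (initial-≤ n)
      ... | inj₁ lt = at lt (subst P same P-initial)
      ... | inj₂ eq = ¬Pn (subst P (trans same eq) P-initial)

  n<p^n : ∀ {p} → 2 ≤ p → ∀ n → n < p ^ n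
  n<p^n 2≤p zero = s≤s z≤n
  n<p^n {p} 2≤p (suc n) = begin-strict
    suc n                    <⟨ n<1+n (suc n) ⟩
    1 + suc n                ≡⟨ +-comm 1 (suc n) ⟩
    suc n + 1                ≤⟨ +-mono-≤ (n<p^n 2≤p n) (≤-<-trans z≤n (n<p^n 2≤p n)) ⟩
    p ^ n + p ^ n            ≡⟨ cong (p ^ n +_) (sym (+-identityʳ (p ^ n))) ⟩
    2 * p ^ n                ≤⟨ *-monoˡ-≤ (p ^ n) 2≤p ⟩
    p * p ^ n                ∎
    where open ≤-Reasoning

  module _ {p v : ℕ} (2≤p : 2 ≤ p) (1≤v : 1 ≤ v) where

    private
      down : ∀ k → p ^ suc (suc k) ∣ v → p ^ suc k ∣ v
      down k = ∣-trans (n∣m*n p)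

      spec = initial-spec (λ k → p ^ suc k ∣? v) down v

      instance
        v≢0 : NonZero v
        v≢0 = >-nonZero 1≤v

    p^ν∣v : p ^ ν p v ∣ v
    p^ν∣v with ν p v | spec
    ... | zero  | _         = 1∣ v
    ... | suc n | below , _ = below (n<1+n n)

    -- The count in `ν` is cut off at v. The cutoff is never reached, as p ^ v ∣ v is impossible for
    -- v < p ^ v.
    p^1+ν∤v : ¬ p * p ^ ν p v ∣ v
    p^1+ν∤v div with m≤n⇒m<n∨m≡n (initial-≤ (λ k → p ^ suc k ∣? v) down v)
    ... | inj₁ ν<v = proj₂ spec ν<v div
    ... | inj₂ ν≡v = contradiction (subst (λ n → p ^ n ∣ v) ν≡v p^ν∣v) λ p^v∣v → <⇒≱ (n<p^n 2≤p v) (∣⇒≤ p^v∣v)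

    ν-positive : p ∣ v → 1 ≤ ν p v
    ν-positive p∣v with ν p v | p^1+ν∤v
    ... | zero  | ∤ = contradiction (subst (_∣ v) (sym (*-identityʳ p)) p∣v) ∤
    ... | suc n | _ = s≤s z≤n

  single-≅ : ∀ p → addFin {p} ≅ addTuple (p ∷ [])
  single-≅ p = record
    { to = _, tt ; from = proj₁ ; to-from = λ _ → refl ; from-to = λ _ → refl ; to-+ = λ _ _ → refl }

  double-≅ : ∀ p → (addFin {p} ×-add addFin {p}) ≅ addTuple (p ∷ p ∷ [])
  double-≅ p = record
    { to = λ (x , y) → x , y , tt ; from = λ (x , y , _) → x , y
    ; to-from = λ _ → refl ; from-to = λ _ → refl ; to-+ = λ _ _ → refl }

  ^-mod-8 : ∀ {x} → x % 8 ≡ 1 → ∀ n → (x ^ n) % 8 ≡ 1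
  ^-mod-8 x≡1 zero = refl
  ^-mod-8 {x} x≡1 (suc n) = trans (%-distribˡ-* x (x ^ n) 8) (cong₂ (λ a b → (a * b) % 8) x≡1 (^-mod-8 x≡1 n))

  2∣⇒%8≢1 : ∀ {x} → 2 ∣ x → x % 8 ≢ 1
  2∣⇒%8≢1 {x} 2∣x x≡1 = contradiction (∣1⇒≡1 (∣m+n∣m⇒∣n (subst (2 ∣_) (trans (m≡m%n+[m/n]*n x 8)
    (trans (cong (_+ x / 8 * 8) x≡1) (+-comm 1 (x / 8 * 8)))) 2∣x) (∣-trans (divides 4 refl) (n∣m*n (x / 8))))) λ ()

  odd-half : ∀ {x} → ¬ 2 ∣ x → x ≡ suc (2 * (x / 2))
  odd-half {x} 2∤x = by-parity (x % 2) refl (m%n<n x 2)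
    where
    by-parity : ∀ d → x % 2 ≡ d → d < 2 → x ≡ suc (2 * (x / 2))
    by-parity zero eq _ = contradiction (divides (x / 2) (trans (m≡m%n+[m/n]*n x 2) (cong (_+ x / 2 * 2) eq))) 2∤x
    by-parity (suc zero) eq _ = trans (m≡m%n+[m/n]*n x 2) (trans (cong (_+ x / 2 * 2) eq) (cong suc (*-comm (x / 2) 2)))
    by-parity (suc (suc d)) _ (s≤s (s≤s ()))

  odd-square-mod-8 : ∀ {x} → ¬ 2 ∣ x → x * x % 8 ≡ 1
  odd-square-mod-8 {x} 2∤x = trans (%-distribˡ-* x x 8) (by-residue (x % 8) refl (m%n<n x 8))
    where
    even : ∀ r → 2 ∣ r → x % 8 ≡ r → 2 ∣ x
    even r 2∣r eq = subst (2 ∣_) (sym (trans (m≡m%n+[m/n]*n x 8) (cong (_+ x / 8 * 8) eq)))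
      (∣m∣n⇒∣m+n 2∣r (∣-trans (divides 4 refl) (n∣m*n (x / 8))))
    by-residue : ∀ r → x % 8 ≡ r → r < 8 → (x % 8) * (x % 8) % 8 ≡ 1
    by-residue 0 eq _ = contradiction (even 0 (divides 0 refl) eq) 2∤x
    by-residue 1 eq _ = cong (λ r → r * r % 8) eq
    by-residue 2 eq _ = contradiction (even 2 (divides 1 refl) eq) 2∤x
    by-residue 3 eq _ = cong (λ r → r * r % 8) eq
    by-residue 4 eq _ = contradiction (even 4 (divides 2 refl) eq) 2∤x
    by-residue 5 eq _ = cong (λ r → r * r % 8) eq
    by-residue 6 eq _ = contradiction (even 6 (divides 3 refl) eq) 2∤x
    by-residue 7 eq _ = cong (λ r → r * r % 8) eq
    by-residue (suc (suc (suc (suc (suc (suc (suc (suc _)))))))) _ (s≤s (s≤s (s≤s (s≤s (s≤s (s≤s (s≤s (s≤s ()))))))))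

  nice-prime : ∀ p → Prime p → p % 8 ≡ 1 → NiceTuple (p ∷ [])
  nice-prime p prime-p p≡1 = subst (λ p → NiceTuple (p ∷ [])) (sym p≡)
      (from-quotient (p / 8) (subst Prime p≡ prime-p))
    where
    p≡ : p ≡ suc (8 * (p / 8))
    p≡ = trans (m≡m%n+[m/n]*n p 8) (cong₂ _+_ p≡1 (*-comm (p / 8) 8))
    from-quotient : ∀ k → Prime (suc (8 * k)) → NiceTuple (suc (8 * k) ∷ [])
    from-quotient 0 prime-1 = contradiction (nonTrivial⇒n>1 1 {{prime⇒nonTrivial prime-1}}) λ { (s≤s ()) }
    from-quotient 1 prime-9 = contradiction prime-9 (from-no (prime? 9))
    from-quotient 2 _       = nice-17
    from-quotient k@(suc (suc (suc _))) prime-p =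
      Transport.transport (single-≅ (suc (8 * k))) (PrimeOrder.niceₚ k (s≤s (s≤s (s≤s z≤n))) prime-p (k <? 16384))

  nice-prime-square : ∀ p → 5 ≤ p → Prime p → ¬ 2 ∣ p → p % 8 ≢ 1 → NiceTuple (p ∷ p ∷ [])
  nice-prime-square (suc m) 5≤p prime-p 2∤p p≢1 = Transport.transport (double-≅ (suc m))
    (SquareOrder.niceₚₚ m (s≤s⁻¹ 5≤p) prime-p (suc m / 2) (suc-injective (odd-half 2∤p)) (odd-square-mod-8 2∤p) (m <? 362) p≢1)

  nice-replicate : ∀ {p} → NiceTuple (p ∷ []) → ∀ n → NiceTuple (replicate n p)
  nice-replicate N zero    = nice-[]
  nice-replicate N (suc n) = nice-++ N (nice-replicate N n)

  nice-replicate-square : ∀ {p} → NiceTuple (p ∷ p ∷ []) → ∀ n → NiceTuple (replicate (n * 2) p)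
  nice-replicate-square N zero    = nice-[]
  nice-replicate-square N (suc n) = nice-++ N (nice-replicate-square N n)

  -- An even exponent of at least 4 is a multiple of 4, or 6 plus a multiple of 4.
  nice-ternary : ∀ n → NiceTuple (replicate (suc (suc n) * 2) 3)
  nice-ternary 0             = nice-81
  nice-ternary 1             = nice-729
  nice-ternary (suc (suc n)) = nice-++ nice-81 (nice-ternary n)

  -- The prime p is odd, so p² ≡ 1 mod 8 and an odd n would give p ^ n ≡ p. Hence either p ≡ 1 mod 8
  -- and n copies of ℤ_p are composed, or n is even and the factors are taken in pairs.
  nice-component : ∀ p n → Prime p → 1 ≤ n → 9 < p ^ n → p ^ n % 8 ≡ 1 → NiceTuple (replicate n p)
  nice-component p n prime-p 1≤n 9<q q≡1 with p % 8 ≟ 1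
  ... | yes p≡1 = nice-replicate (nice-prime p prime-p p≡1) n
  ... | no p≢1  = by-parity (2 ∣? n)
    where
    2∤p : ¬ 2 ∣ p
    2∤p 2∣p = 2∣⇒%8≢1 (divides-power n 1≤n) q≡1
      where
      divides-power : ∀ n → 1 ≤ n → 2 ∣ p ^ n
      divides-power (suc n) _ = ∣m⇒∣m*n (p ^ n) 2∣p

    even-power : ∀ j → p ^ (2 * j) % 8 ≡ 1
    even-power j = trans (cong (_% 8) (sym (^-*-assoc p 2 j)))
      (^-mod-8 (trans (cong (λ x → p * x % 8) (*-identityʳ p)) (odd-square-mod-8 2∤p)) j)

    pairs : ∀ j → 9 < p ^ (j * 2) → NiceTuple (replicate (j * 2) p)
    pairs j 9<q with 5 ≤? p
    ... | yes 5≤p = nice-replicate-square (nice-prime-square p 5≤p prime-p 2∤p p≢1) j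
    ... | no 5≰p  = small p (≰⇒> 5≰p) prime-p 2∤p j 9<q
      where
      small : ∀ p → p < 5 → Prime p → ¬ 2 ∣ p → ∀ j → 9 < p ^ (j * 2) → NiceTuple (replicate (j * 2) p)
      small 0 _ prime-0 _ = contradiction (nonTrivial⇒n>1 0 {{prime⇒nonTrivial prime-0}}) λ ()
      small 1 _ prime-1 _ = contradiction (nonTrivial⇒n>1 1 {{prime⇒nonTrivial prime-1}}) λ { (s≤s ()) }
      small 2 _ _ odd     = contradiction (divides 1 refl) odd
      small 3 _ _ _ 0 9<1 = contradiction 9<1 λ { (s≤s ()) }
      -- The component 9 itself is shut out by the strict bound on q; the ternary families begin
      -- with 3⁴.
      small 3 _ _ _ 1 9<9 = contradiction 9<9 (<-irrefl refl)
      small 3 _ _ _ (suc (suc j)) _ = nice-ternary j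
      small 4 _ _ odd     = contradiction (divides 2 refl) odd
      small (suc (suc (suc (suc (suc _))))) (s≤s (s≤s (s≤s (s≤s (s≤s ())))))

    by-parity : Dec (2 ∣ n) → NiceTuple (replicate n p)
    by-parity (yes (divides j refl)) = pairs j 9<q
    by-parity (no 2∤n) = contradiction (begin
      p % 8                              ≡⟨ sym (m%n%n≡m%n p 8) ⟩
      p % 8 % 8                          ≡⟨ cong (_% 8) (sym (*-identityʳ (p % 8))) ⟩
      p % 8 * 1 % 8                      ≡⟨ cong (λ x → p % 8 * x % 8) (sym (even-power (n / 2))) ⟩
      p % 8 * (p ^ (2 * (n / 2)) % 8) % 8 ≡⟨ sym (%-distribˡ-* p (p ^ (2 * (n / 2))) 8) ⟩
      p ^ suc (2 * (n / 2)) % 8          ≡⟨ cong (λ n → p ^ n % 8) (sym (odd-half 2∤n)) ⟩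
      p ^ n % 8                          ≡⟨ q≡1 ⟩
      1                                  ∎) p≢1
      where open ≡-Reasoning

  other : ∀ {m} → 2 ≤ m → (x : Fin m) → Σ (Fin m) (_≢ x)
  other (s≤s (s≤s _)) zero    = 1F , λ ()
  other (s≤s (s≤s _)) (suc _) = 0F , λ ()

  different : ∀ {ms m} → m ∈ ms → 2 ≤ m → (x : Tuple ms) → Σ (Tuple ms) (_≢ x)
  different (here refl) 2≤m (x , xs) = let y , y≢x = other 2≤m x in (y , xs) , y≢x ∘ cong proj₁
  different (there m∈)  2≤m (x , xs) = let ys , ys≢xs = different m∈ 2≤m xs in (x , ys) , ys≢xs ∘ cong proj₂

  prime-divisor : ∀ v → 1 < v → Σ ℕ λ p → Prime p × p ∣ v
  prime-divisor v 1<v with factorise v {{>-nonZero (<-trans (s≤s z≤n) 1<v)}}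
  ... | record { factors = [] ; isFactorisation = eq } = contradiction eq (<⇒≢ 1<v ∘ sym)
  ... | record { factors = p ∷ ps ; isFactorisation = eq ; factorsPrime = prime-p ∷ _ } =
    p , prime-p , subst (p ∣_) (sym eq) (m∣m*n (product ps))

  prime≥2 : ∀ {p} → Prime p → 2 ≤ p
  prime≥2 {p} prime-p = nonTrivial⇒n>1 p {{prime⇒nonTrivial prime-p}}

  module _ (v : ℕ) (1<v : 1 < v) (components : ∀ q → Component q v → 9 < q × q % 8 ≡ 1) where

    1≤v : 1 ≤ v
    1≤v = <⇒≤ 1<v

    part : ℕ → List ℕ
    part p = if does (prime? p) then replicate (ν p v) p else []

    nice-part : ∀ p → NiceTuple (part p)
    nice-part p with prime? p
    ... | no _ = nice-[]
    ... | yes prime-p with ν p v in eq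
    ...   | zero  = nice-[]
    ...   | suc n = nice-component p (suc n) prime-p (s≤s z≤n) (proj₁ bounds) (proj₂ bounds)
      where
      bounds : 9 < p ^ suc n × p ^ suc n % 8 ≡ 1
      bounds = components (p ^ suc n) (p , suc n , prime-p , s≤s z≤n , refl ,
        subst (λ n → p ^ n ∣ v) eq (p^ν∣v (prime≥2 prime-p) 1≤v) ,
        subst (λ n → ¬ p * p ^ n ∣ v) eq (p^1+ν∤v (prime≥2 prime-p) 1≤v))

    nice-parts : ∀ ps → NiceTuple (concatMap part ps)
    nice-parts []       = nice-[]
    nice-parts (p ∷ ps) = nice-++ (nice-part p) (nice-parts ps)

    open Nice (nice-parts (upTo (suc v)))
    open Family family using (Unit; points)

    p∈part : ∀ {p} → Prime p → p ∣ v → p ∈ part p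
    p∈part {p} prime-p p∣v with prime? p
    ... | no ¬prime = contradiction prime-p ¬prime
    ... | yes _ with ν p v | ν-positive (prime≥2 prime-p) 1≤v p∣v
    ...   | suc n | _ = here refl

    -- Here 1 < v enters: a prime divisor p of v contributes a factor ℤ_p with at least two
    -- elements, so the group has a nonzero element, and the slot covering it lies in some unit.
    unit : Unit
    unit =
      let p , prime-p , p∣v = prime-divisor v 1<v
          p∈moduli = ∈-concatMap⁺ part (lose (∈-upTo⁺ (s≤s (∣⇒≤ {{>-nonZero 1≤v}} p∣v))) (p∈part prime-p p∣v))
          x , x≢0 = different p∈moduli (prime≥2 prime-p) (Ab.0# group)
          (u , _) , _ = HitsOnceExcept.hits points x x≢0
      in u

    harmonious-Z2×Fv : Harmonious (Z2×Fv v) (addZ2×Fv v) K24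
    harmonious-Z2×Fv = Develop.harmonious group (Residues.ℤₚ-group 1) family unit

theorem8p1 : (v : ℕ) → 1 < v →
    (∀ q → Component q v → 9 < q × q % 8 ≡ 1) →
    Harmonious (Z2×Fv v) (addZ2×Fv v) K24
theorem8p1 = Components.harmonious-Z2×Fv
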